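{- Let $\mathbf{A}=\mathcal{A}_1\parallel\cdots\parallel\mathcal{A}_n$ be a parallel composition of finite labelled transition systems with interface $\mathcal{A}_i$. Then, for every way of resolving the nondeterministic choices, Algorithm 2 instantiated with the cut-off / cut-off candidate / freeing notions below terminates and returns a (finite) branching process $\mathcal{N}$ such that the folding $\mathcal{S}_i$ of the interface projection $\mathcal{N}_i$ is a summary of $\mathbf{A}$, i.e. $\mathrm{Tr}(\mathcal{S}_i)=\mathrm{Tr}(\mathbf{A})|_{\Sigma_i}$.
   Context: Labelled transition systems. An LTS is $\mathcal{A}=(\Sigma,S,T,\lambda,s^0)$ with actions $\Sigma$, states $S$, transitions $T\subseteq S\times S$, labelling $\lambda:T\to\Sigma$, initial state $s^0$. An execution is a finite or infinite sequence $t_1t_2\cdots$ of transitions with states $s_0s_1\cdots$ such that $t_k=(s_{k-1},s_k)$; a history if $s_0=s^0$. A (finite or infinite) action sequence is a trace if it is $\lambda(t_1)\lambda(t_2)\cdots$ for some history (a realization of it); $\mathrm{Tr}(\mathcal{A})$ is the set of traces. Parallel composition. For $\mathcal{A}_j=(\Sigma_j,S_j,T_j,\lambda_j,s^0_j)$, $\mathbf{A}$ has actions $\bigcup_j\Sigma_j$, global states $(s_1,\dots,s_n)$ with $s_j\in S_j$, initial state $(s^0_1,\dots,s^0_n)$, and global transitions $\mathbf{t}=(t_1,\dots,t_n)\in\prod_j(T_j\cup\{\star\})$, not all $\star$, such that for some action $a$ and every $j$: $t_j$ is an $a$-labelled transition of $T_j$ if $a\in\Sigma_j$, else $t_j=\star$;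 $\mathbf{t}$ is labelled $a$ and leads from $(s_j)_j$ to $(s'_j)_j$ with $s'_j=s_j$ if $t_j=\star$ and $t_j=(s_j,s'_j)$ otherwise; $\mathcal{A}_j$ participates in $\mathbf{t}$ if $t_j\neq\star$. A fixed index $i$ is distinguished ($\mathcal{A}_i$ is the interface). $X|_{\Sigma_i}$ is the set of projections onto $\Sigma_i$ of the sequences in $X$. A summary is an LTS $\mathcal{S}_i$ with action set $\Sigma_i$ and $\mathrm{Tr}(\mathcal{S}_i)=\mathrm{Tr}(\mathbf{A})|_{\Sigma_i}$. Branching processes. Petri nets with conditions (places) and events (transitions), $\bullet x$, $x\bullet$ input/output sets, firing $t$ at $M\supseteq\bullet t$ gives $(M\setminus\bullet t)\cup t\bullet$. Inductively: (1) the net with conditions $b^0_1,\dots,b^0_n$ labelled $s^0_1,\dots,s^0_n$, no events, initial marking $\{b^0_1,\dots,b^0_n\}$ is a branching process; (2) if $\mathcal{N}$ is one, $M'$ a reachable marking, $\mathbf{t}$ a global transition such that for each participating $j$ with $t_j=(s_j,s'_j)$ some condition of $M'$ is labelled $s_j$, $M$ the set of these conditions, and no event labelled $\mathbf{t}$ has input set $M$, then adding a new event $e$ labelled $\mathbf{t}$ (and by its action) with $\bullet e=M$ and new output conditions labelled $s'_j$ for participating $j$ yields a branching process; such $e$ is a possible extension of $\mathcal{N}$. For nodes: $x<y$ if there is a nonempty directed path from $x$ to $y$; $x\#y$ if some condition $z\neq x,y$ has paths to $x$ and $y$ leaving $z$ by different arcs; $x,y$ concurrent if neither $x\le y$, $y\le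 x$ nor $x\#y$. $[e]=\{e':e'\le e\}$; $M(e)$ is the marking reached by any occurrence sequence firing exactly $[e]$; $M(e)_j$ is its unique condition labelled by a state of $\mathcal{A}_j$; $\mathrm{St}(e)$ is the global state formed by the labels of $M(e)$; $ip(e)=M(e)_i$. An $i$-event is an event in whose label $\mathcal{A}_i$ participates; an $i$-condition is one labelled by a state of $\mathcal{A}_i$. Strong causality: $e'\ll e$ if $e'<e$ and $b'<b$ for all $b\in M(e)\setminus M(e')$, $b'\in M(e')\setminus M(e)$. Interface projection and folding. $\mathcal{N}_i$ is the subnet of $i$-conditions, $i$-events and arcs between them; viewed as an LTS with states the $i$-conditions, initial state $b^0_i$, and for each $i$-event an action-labelled transition from its unique input to its unique output $i$-condition. Given an equivalence $\equiv$ on $i$-conditions, the folding has states the $\equiv$-classes, initial state $[b^0_i]_\equiv$, and a transition $([b]_\equiv,[b']_\equiv)$ labelled $a$ for each $a$-labelled transition $(b,b')$ of $\mathcal{N}_i$. Cut-offs etc. For the current branching process $\mathcal{N}$ and set $co$ of cut-offs, $\mathrm{Con}_{\mathcal{N}}(e)$ is the set of $i$-events of $\mathcal{N}$ not in $co$ that are concurrent with $e$. An event $e$ is a cut-off if it is an $i$-event and $\mathcal{N}$ contains an $i$-event $e'$ with $\mathrm{St}(e)=\mathrm{St}(e')$ ($e'$ is its companion). $e$ is a cut-off candidate of $\mathcal{N}$ if it is not an $i$-event and $\mathcal{N}$ contains $e'\ll e$ with $\mathrm{St}(e)=\mathrm{St}(e')$, $ip(e')=ip(e)$ and $\mathrm{Con}_{\mathcal{N}}(e)\subseteq\mathrm{Con}_{\mathcal{N}}(e')$.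 An event $e$ frees a cut-off candidate $e_c$ of $\mathcal{N}$ if $e_c$ is not a cut-off candidate of the branching process obtained by adding $e$ to $\mathcal{N}$. Algorithm 2. Start with the branching process without events, $co=coc=\emptyset$. While some possible extension of $\mathcal{N}$ has no event of $co\cup coc$ among its causal predecessors, choose any such $e$; if $e$ is a cut-off, add it to $co$; else if $e$ is a cut-off candidate of $\mathcal{N}$, add it to $coc$; otherwise remove from $coc$ every $e'\in coc$ that $e$ frees; then add $e$ to $\mathcal{N}$. At the end, $\equiv$ is the equivalence on $i$-conditions generated by $M(e)_i\equiv M(e')_i$ for every $e\in co$ with companion $e'$. -}

module Defs where

open import Data.Nat using (ℕ; zero; suc; _<_; _≤_)
open import Data.Fin using (Fin)
open import Data.List using (List; []; _∷_; filter; length; _∷ʳ_)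
open import Data.List.Membership.Propositional using (_∈_; _∉_)
open import Data.List.Membership.DecPropositional Data.Nat._≟_ using (_∈?_)
open import Data.Maybe using (Maybe; just; nothing)
open import Data.Bool using (Bool; true; false)
open import Data.Product using (Σ; _×_; _,_; ∃; ∃-syntax)
open import Data.Sum using (_⊎_)
open import Relation.Nullary using (¬_)
open import Relation.Binary.PropositionalEquality using (_≡_; _≢_)
open import Relation.Binary.Construct.Closure.Transitive using (TransClosure)
open import Relation.Binary.Construct.Closure.Equivalence using (EqClosure)
open import Relation.Binary.Construct.Closure.ReflexiveTransitive using (Star)
open import Induction.WellFounded using (Acc)

_⇔_ : Set → Set → Set
P ⇔ Q = (P → Q) × (Q → P)

nth : {A : Set} → List A → ℕ → Maybe A
nth []       _       = nothing
nth (x ∷ xs) zero    = just x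
nth (x ∷ xs) (suc k) = nth xs k

prefix : {A : Set} → (ℕ → A) → ℕ → List A
prefix u zero    = []
prefix u (suc m) = u 0 ∷ prefix (λ k → u (suc k)) m

-- Finite labelled transition systems (actions are natural numbers).
-- States are Fin size; T ⊆ S × S together with λ : T → Σ is encoded as a
-- partial function  tr : S → S → Maybe Act  (tr s s' ≡ just a  iff
-- (s,s') ∈ T and λ(s,s') = a).

record LTS : Set where
  field
    size   : ℕ
    acts   : List ℕ
    init   : Fin size
    tr     : Fin size → Fin size → Maybe ℕ
    tr-acts : ∀ s s' a → tr s s' ≡ just a → a ∈ acts
open LTS public

record TS : Set₁ where
  field
    St    : Set
    start : St
    step  : St → ℕ → St → Set
open TS public

data Path (T : TS) : St T → List ℕ → Set where
  []  : ∀ {s} → Path T s []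
  _∷_ : ∀ {s a s' w} → step T s a s' → Path T s' w → Path T s (a ∷ w)

FinTrace : TS → List ℕ → Set
FinTrace T w = Path T (start T) w

InfTrace : TS → (ℕ → ℕ) → Set
InfTrace T w = Σ (ℕ → St T) λ f →
  (f 0 ≡ start T) × (∀ k → step T (f k) (w k) (f (suc k)))

module Comp (n : ℕ) (A : Fin n → LTS) (i : Fin n) where

  S : Fin n → Set
  S j = Fin (size (A j))

  GState : Set
  GState = (j : Fin n) → S j

  ginit : GState
  ginit j = init (A j)

  -- g --a--> g' is a global transition (it is uniquely determined by g, a, g')
  GStep : GState → ℕ → GState → Set
  GStep g a g' =
    (∀ j → (a ∈ acts (A j) → tr (A j) (g j) (g' j) ≡ just a)
         × (a ∉ acts (A j) → g' j ≡ g j))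
    × ∃[ j ] (a ∈ acts (A j))

  Global : TS
  Global = record { St = GState ; start = ginit ; step = GStep }

  Σi : List ℕ
  Σi = acts (A i)

  proj : List ℕ → List ℕ
  proj = filter (_∈? Σi)

  FinProjOfInf : (ℕ → ℕ) → List ℕ → Set
  FinProjOfInf u w = ∃[ m ] (proj (prefix u m) ≡ w × (∀ k → m ≤ k → u k ∉ Σi))

  InfProjOfInf : (ℕ → ℕ) → (ℕ → ℕ) → Set
  InfProjOfInf u w = Σ (ℕ → ℕ) λ g →
      (∀ k → g k < g (suc k))
    × (∀ k → (u (g k) ∈ Σi) × (u (g k) ≡ w k))
    × (∀ m → u m ∈ Σi → ∃[ k ] (g k ≡ m))

  FinInProj : List ℕ → Set
  FinInProj w =
      (∃[ u ] (FinTrace Global u × proj u ≡ w))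
    ⊎ (∃[ u ] (InfTrace Global u × FinProjOfInf u w))

  InfInProj : (ℕ → ℕ) → Set
  InfInProj w = ∃[ u ] (InfTrace Global u × InfProjOfInf u w)

  IsSummary : TS → Set
  IsSummary T = (∀ w → FinTrace T w ⇔ FinInProj w)
              × (∀ w → InfTrace T w ⇔ InfInProj w)

  -- conditions: the initial ones, and  out k j  = output condition of the
  -- k-th added event belonging to component j
  data CId : Set where
    ini : Fin n → CId
    out : ℕ → Fin n → CId

  compOf : CId → Fin n
  compOf (ini j)   = j
  compOf (out _ j) = j

  -- an event: its action, and for each component j either ⋆ (nothing) or
  -- (b , s') : it consumes the condition b (labelled s_j) and t_j = (s_j , s')
  record Event : Set where
    constructor mkEvent
    field
      act  : ℕ
      part : (j : Fin n) → Maybe (CId × S j)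
  open Event public

  -- a net is the list of its events in the order they were added
  Net : Set
  Net = List Event

  labC : Net → CId → Maybe (Σ (Fin n) S)
  labC N (ini j) = just (j , init (A j))
  labC N (out k j) with nth N k
  ... | nothing = nothing
  ... | just e with part e j
  ...   | nothing = nothing
  ...   | just (_ , s') = just (j , s')

  InPre : Event → CId → Set
  InPre e b = ∃[ j ] Σ (S j) λ s' → part e j ≡ just (b , s')

  InPost : ℕ → Event → CId → Set
  InPost k e b = ∃[ j ] (b ≡ out k j × Σ (CId × S j) λ p → part e j ≡ just p)

  data Node : Set where
    cnd : CId → Node
    evt : ℕ → Node

  data Arc (N : Net) : Node → Node → Set where
    inArc  : ∀ {k e b} → nth N k ≡ just e → InPre e b → Arc N (cnd b) (evt k)
    outArc : ∀ {k e b} → nth N k ≡ just e → InPost k e b → Arc N (evt k) (cnd b)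

  _⊢_<ₙ_ : Net → Node → Node → Set
  N ⊢ x <ₙ y = TransClosure (Arc N) x y

  _⊢_≤ₙ_ : Net → Node → Node → Set
  N ⊢ x ≤ₙ y = (x ≡ y) ⊎ (N ⊢ x <ₙ y)

  _⊢_#_ : Net → Node → Node → Set
  N ⊢ x # y = ∃[ z ] ((cnd z ≢ x) × (cnd z ≢ y) × ∃[ k₁ ] ∃[ k₂ ]
      ((k₁ ≢ k₂) × Arc N (cnd z) (evt k₁) × Arc N (cnd z) (evt k₂)
       × (N ⊢ evt k₁ ≤ₙ x) × (N ⊢ evt k₂ ≤ₙ y)))

  Concurrent : Net → Node → Node → Set
  Concurrent N x y = ¬ (N ⊢ x ≤ₙ y) × ¬ (N ⊢ y ≤ₙ x) × ¬ (N ⊢ x # y)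

  Marking : Set
  Marking = CId → Bool

  M₀ : Marking
  M₀ (ini _)   = true
  M₀ (out _ _) = false

  Fire : Net → Marking → ℕ → Marking → Set
  Fire N M k M' = ∃[ e ] (nth N k ≡ just e
      × (∀ b → InPre e b → M b ≡ true)
      × (∀ b → (M' b ≡ true) ⇔ (InPost k e b ⊎ ((M b ≡ true) × ¬ InPre e b))))

  data Occ (N : Net) : Marking → List ℕ → Marking → Set where
    done : ∀ {M M'} → (∀ b → M b ≡ M' b) → Occ N M [] M'
    fire : ∀ {M M₁ M₂ k σ} → Fire N M k M₁ → Occ N M₁ σ M₂ → Occ N M (k ∷ σ) M₂

  Reachable : Net → Marking → Set
  Reachable N M = ∃[ σ ] Occ N M₀ σ M

  PossExt : Net → Event → Set
  PossExt N e =
      (∀ j → (act e ∈ acts (A j) → Σ (CId × S j) λ p → part e j ≡ just p)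
           × (act e ∉ acts (A j) → part e j ≡ nothing))
    × (∃[ j ] (act e ∈ acts (A j)))
    × (Σ Marking λ M' → Reachable N M' × (∀ j b s' → part e j ≡ just (b , s') →
         (M' b ≡ true) × Σ (S j) λ s → (labC N b ≡ just (j , s))
                                      × (tr (A j) s s' ≡ just (act e))))
    × ¬ (∃[ k ] Σ Event λ e' → (nth N k ≡ just e')
           × (act e' ≡ act e) × (∀ j → part e' j ≡ part e j))

  data IsBP : Net → Set where
    base : IsBP []
    extend : ∀ {N e} → IsBP N → PossExt N e → IsBP (N ∷ʳ e)

  InM : Net → ℕ → CId → Set
  InM N k b = ∃[ σ ] Σ Marking λ M → Occ N M₀ σ M
      × (∀ k' → (k' ∈ σ) ⇔ (N ⊢ evt k' ≤ₙ evt k)) × (M b ≡ true)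

  IsMj : Net → ℕ → Fin n → CId → Set
  IsMj N k j b = InM N k b × (compOf b ≡ j)

  SameSt : Net → ℕ → ℕ → Set
  SameSt N k k' = ∀ j b b' → IsMj N k j b → IsMj N k' j b' → labC N b ≡ labC N b'

  SameIp : Net → ℕ → ℕ → Set
  SameIp N k k' = ∀ b b' → IsMj N k i b → IsMj N k' i b' → b ≡ b'

  IsIEvent : Net → ℕ → Set
  IsIEvent N k = Σ Event λ e → (nth N k ≡ just e) × Σ (CId × S i) λ p → part e i ≡ just p

  _⊢_≪_ : Net → ℕ → ℕ → Set
  N ⊢ k' ≪ k = (N ⊢ evt k' <ₙ evt k)
      × (∀ b b' → InM N k b → ¬ InM N k' b → InM N k' b' → ¬ InM N k b'
                → N ⊢ cnd b' <ₙ cnd b)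

  -- cut-off sets: co maps a cut-off to its companion; coc is a set
  CoSet : Set
  CoSet = ℕ → Maybe ℕ

  -- x ∈ Con_N(e_k)  (N lists the events of the current process; concurrency
  -- is evaluated in N')
  InCon : Net → Net → CoSet → ℕ → ℕ → Set
  InCon N N' co x k = (x < length N) × IsIEvent N' x × (co x ≡ nothing)
                    × Concurrent N' (evt x) (evt k)

  -- e_k (an event of N') is a cut-off candidate of the process N
  -- (Con computed w.r.t. the events of N), N' = N or N plus a possible extension
  IsCand : Net → Net → CoSet → ℕ → Set
  IsCand N N' co k = (Σ Event λ e → nth N' k ≡ just e) × ¬ IsIEvent N' k
      × ∃[ k' ] ((k' < length N) × (N' ⊢ k' ≪ k) × SameSt N' k k' × SameIp N' k k'
                 × (∀ x → InCon N N' co x k → InCon N N' co x k'))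

  IsCutoffWith : Net → Event → ℕ → Set
  IsCutoffWith N e k' = IsIEvent (N ∷ʳ e) (length N)
      × (k' < length N) × IsIEvent N k' × SameSt (N ∷ʳ e) (length N) k'

  IsCutoff : Net → Event → Set
  IsCutoff N e = ∃[ k' ] IsCutoffWith N e k'

  Frees : Net → CoSet → Event → ℕ → Set
  Frees N co e k = IsCand N N co k × ¬ IsCand (N ∷ʳ e) (N ∷ʳ e) co k

  record AState : Set where
    constructor ⟨_,_,_⟩
    field
      net : Net
      co  : CoSet
      coc : ℕ → Bool
  open AState public

  initial : AState
  initial = ⟨ [] , (λ _ → nothing) , (λ _ → false) ⟩

  Eligible : AState → Event → Set
  Eligible st e = PossExt (net st) e
    × (∀ k → (net st ∷ʳ e) ⊢ evt k <ₙ evt (length (net st))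
           → (co st k ≡ nothing) × (coc st k ≡ false))

  AlgStep : AState → AState → Set
  AlgStep st st' = Σ Event λ e → Eligible st e × (net st' ≡ net st ∷ʳ e) ×
    (   (∃[ k' ] (IsCutoffWith (net st) e k'
          × (co st' (length (net st)) ≡ just k')
          × (∀ x → x ≢ length (net st) → co st' x ≡ co st x)
          × (∀ x → coc st' x ≡ coc st x)))
      ⊎ (¬ IsCutoff (net st) e
          × IsCand (net st) (net st ∷ʳ e) (co st) (length (net st))
          × (∀ x → co st' x ≡ co st x)
          × (coc st' (length (net st)) ≡ true)
          × (∀ x → x ≢ length (net st) → coc st' x ≡ coc st x))
      ⊎ (¬ IsCutoff (net st) e
          × ¬ IsCand (net st) (net st ∷ʳ e) (co st) (length (net st))
          × (∀ x → co st' x ≡ co st x)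
          × (∀ x → (coc st' x ≡ true) ⇔ ((coc st x ≡ true) × ¬ Frees (net st) (co st) e x))))

  Final : AState → Set
  Final st = ¬ (Σ Event λ e → Eligible st e)

  Gen : Net → CoSet → CId → CId → Set
  Gen N co b b' = ∃[ k ] ∃[ k' ] ((co k ≡ just k') × IsMj N k i b × IsMj N k' i b')

  _⊢_≈_ : (Net × CoSet) → CId → CId → Set
  (N , co) ⊢ b ≈ b' = EqClosure (Gen N co) b b'

  -- the folding of the interface projection N_i w.r.t. ≈, with states given by
  -- representatives (steps closed under ≈)
  Folding : Net → CoSet → TS
  Folding N co = record
    { St = CId
    ; start = ini i
    ; step = λ C a C' → ∃[ k ] Σ Event λ e → Σ CId λ b → Σ (S i) λ s' →
        (nth N k ≡ just e) × (part e i ≡ just (b , s')) × (act e ≡ a)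
        × ((N , co) ⊢ C ≈ b) × ((N , co) ⊢ out k i ≈ C')
    }

{-# OPTIONS --safe #-}
module Submission where

-- Events are numbered in the order in which they were added, which refines causality, so a
-- configuration is a set of events each of which consumes the cut reached by its smaller-numbered
-- members.
--
-- Soundness: the global state reached after the past of the producer of an i-condition is invariant
-- under folding, and consecutive i-events are joined by a run with no other i-action.
--
-- Completeness: a silent run from the state after a non-cut-off i-event x, followed by an i-action, is
-- replayed in the final net. If the replay meets a cut-off candidate k with companion k', strong
-- causality and Con(k) ⊆ Con(k') force [x] ∩ [k] ⊆ [k'], so [x] ∪ [k] and [x] ∪ [k'] reach the same
-- state and the run can be replaced by a strictly shorter one.
--
-- Termination: cut a long causal chain into equal blocks; either some block misses a component that
-- moves on the chain, and one recurses into it, or all moving components move in every block. In the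
-- latter case any n + 1 consecutive blocks spread the knowledge of an event to all moving components,
-- so their end points are related by ≪. By pigeonhole two end points agree on St, ip and Con, and the
-- later one is a candidate. Hence causal depth, and with it the number of events, is bounded uniformly.

open import Defs
open import Data.Bool using (Bool; true; false; _∨_; _∧_; not) renaming (_≟_ to _B≟_)
open import Data.Bool.Properties using (∨-identityʳ)
open import Data.Empty using (⊥; ⊥-elim)
open import Data.Fin using (Fin; combine; remQuot; toℕ)
import Data.Fin.Properties as Fin
open import Data.List using (List; []; _∷_; length; _∷ʳ_; allFin)
open import Data.List.Membership.Propositional using (_∈_; _∉_)
import Data.List.Membership.Propositional as Mem
open import Data.List.Membership.Propositional.Properties using (∈-++⁺ˡ; ∈-++⁺ʳ; ∈-++⁻; ∈-allFin)
open import Data.List.Properties using (length-++; length-tabulate; filter-accept; filter-reject)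
open import Data.List.Relation.Unary.Any as Any using (Any; here; there)
open import Data.Maybe using (Maybe; just; nothing)
open import Data.Maybe.Properties using (just-injective) renaming (≡-dec to maybe-≡-dec)
open import Data.Nat using (ℕ; zero; suc; _+_; _*_; _<_; _≤_; s≤s; z≤n; _<?_)
open import Data.Nat.Induction using (<-rec)
open import Data.Nat.Properties
open import Data.List.Membership.DecPropositional _≟_ using (_∈?_)
open import Data.Product using (Σ; _×_; _,_; ∃-syntax; proj₁; proj₂)
open import Data.Product.Properties using () renaming (≡-dec to ×-≡-dec)
open import Data.Sum using (_⊎_; inj₁; inj₂)
open import Data.Unit using (⊤; tt)
open import Function using (_∘_; case_of_)
open import Induction.WellFounded using (Acc; acc)
open import Relation.Binary.Construct.Closure.ReflexiveTransitive using (Star; ε; _◅_; _◅◅_)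
open import Relation.Binary.Construct.Closure.Symmetric using (fwd; bwd)
open import Relation.Binary.Construct.Closure.Transitive using ([_]; _∷_; _++_)
open import Relation.Binary.Definitions using (tri<; tri≈; tri>)
open import Relation.Binary.PropositionalEquality using (_≡_; _≢_; refl; sym; trans; cong; subst)
open import Relation.Nullary using (¬_; Dec; yes; no; does)
open import Relation.Nullary.Decidable using (map′; _×-dec_; _⊎-dec_; _→-dec_; ¬?; dec-true; dec-false; decidable-stable; ¬¬-excluded-middle)

-- A later i-event may enlarge Con and so destroy candidacy. The invariant therefore reads `coc`
-- against the net as it stands: up to double negation it holds exactly the candidates of the
-- current net, and neither they nor cut-offs have successors. Completeness and termination both
-- rest on this. At the end, an event enabled after a configuration that avoids `co` and `coc` must
-- already be present; during a run, an event with a successor is no candidate.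
--
-- The obstacle is logical. Concurrency and Con are built from negations, and candidacy is available
-- only up to double negation. Each use of it therefore aims at a decidable or a negative statement:
-- a silent run of bounded length, which can be searched for because global states are finite in
-- number, or the absence of a long chain.
--
-- Con contains no cut-offs, so a replay must start after an i-event that Con can see. This is why
-- output conditions of cut-offs are first exchanged for those of companions.
--
-- Global states are functions and are compared pointwise; they are coded in a finite product
-- wherever they are searched or counted.

module Unfolding (n : ℕ) (A : Fin n → LTS) (i : Fin n) where
  open Comp n A i

  does-true : {P : Set} (d : Dec P) → does d ≡ true → P
  does-true (yes p) _ = p

  partOf : Maybe Event → (j : Fin n) → Maybe (CId × S j)
  partOf nothing  j = nothing
  partOf (just e) j = part e j

  actOf : Maybe Event → ℕ
  actOf nothing  = 0
  actOf (just e) = act e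

  partAt : Net → ℕ → (j : Fin n) → Maybe (CId × S j)
  partAt N k = partOf (nth N k)

  actAt : Net → ℕ → ℕ
  actAt N k = actOf (nth N k)

  -- A record rather than a Σ-type: `partAt` is not injective, so from a bare equation `N`, `k` and
  -- `j` could not be inferred.
  record Participates (N : Net) (k : ℕ) (j : Fin n) : Set where
    constructor _,_
    field
      component-part : CId × S j
      part≡          : partAt N k j ≡ just component-part

  out-injective : ∀ {k k' j j'} → out k j ≡ out k' j' → k ≡ k'
  out-injective refl = refl

  participates? : ∀ N k j → Dec (Participates N k j)
  participates? N k j with partAt N k j in eq
  ... | just p  = yes (p , eq)
  ... | nothing = no λ { (p , e) → case trans (sym eq) e of λ () }

  EventSet : Set
  EventSet = ℕ → Bool

  _⊆ₑ_ : EventSet → EventSet → Set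
  C ⊆ₑ D = ∀ k → C k ≡ true → D k ≡ true

  -- Cuts

  cutStep : ∀ {X : Set} → Bool → Maybe X → CId → CId → CId
  cutStep true (just _) new old = new
  cutStep true nothing  new old = old
  cutStep false _       new old = old

  -- Only members numbered below `m` count, so for an event `m` of `C` this is the cut that `m`
  -- finds when `C` is fired in numerical order. The function is total: `C` may be any set.
  cut : Net → EventSet → ℕ → Fin n → CId
  cut N C zero    j = ini j
  cut N C (suc m) j = cutStep (C m) (partAt N m j) (out m j) (cut N C m j)

  data Cut (N : Net) (C : EventSet) (m : ℕ) (j : Fin n) : CId → Set where
    none : (∀ k → k < m → C k ≡ true → ¬ Participates N k j) → Cut N C m j (ini j)
    last : ∀ k → k < m → C k ≡ true → Participates N k j →
           (∀ k' → k < k' → k' < m → C k' ≡ true → ¬ Participates N k' j) → Cut N C m j (out k j)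

  cut-suc : ∀ {N C m j b} → (C m ≡ true → ¬ Participates N m j) → Cut N C m j b → Cut N C (suc m) j b
  cut-suc {m = m} h (none f) = none λ k k<1+m Ck → case k k<1+m Ck
    where
    case : ∀ k → k < suc m → _ → ¬ _
    case k (s≤s k≤m) Ck with m≤n⇒m<n∨m≡n k≤m
    ... | inj₁ k<m  = f k k<m Ck
    ... | inj₂ refl = h Ck
  cut-suc {m = m} h (last k k<m Ck jk f) = last k (m<n⇒m<1+n k<m) Ck jk case
    where
    case : ∀ k' → k < k' → k' < suc m → _ → ¬ _
    case k' k<k' (s≤s k'≤m) Ck' with m≤n⇒m<n∨m≡n k'≤m
    ... | inj₁ k'<m = f k' k<k' k'<m Ck'
    ... | inj₂ refl = h Ck'

  cut-view : ∀ N C m j → Cut N C m j (cut N C m j)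
  cut-view N C zero j = none λ k ()
  cut-view N C (suc m) j with C m in eC | partAt N m j in eP | cut-view N C m j
  ... | true  | just p  | _ = last m ≤-refl eC (p , eP) λ k' m<k' k'≤m → ⊥-elim (<⇒≱ m<k' (≤-pred k'≤m))
  ... | true  | nothing | v = cut-suc (λ _ → λ { (p , e) → case trans (sym eP) e of λ () }) v
  ... | false | _ | v = cut-suc (λ e → case trans (sym eC) e of λ ()) v

  cut-unique : ∀ {N C m j b b'} → Cut N C m j b → Cut N C m j b' → b ≡ b'
  cut-unique (none f) (none g) = refl
  cut-unique (none f) (last k k<m Ck jk g) = ⊥-elim (f k k<m Ck jk)
  cut-unique (last k k<m Ck jk g) (none f) = ⊥-elim (f k k<m Ck jk)
  cut-unique (last k k<m Ck jk f) (last k' k'<m Ck' jk' g) with <-cmp k k'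
  ... | tri< k<k' _ _ = ⊥-elim (f k' k<k' k'<m Ck' jk')
  ... | tri≈ _ refl _ = refl
  ... | tri> _ _ k'<k = ⊥-elim (g k k'<k k<m Ck jk)

  cut-≡ : ∀ {N C m j b} → Cut N C m j b → cut N C m j ≡ b
  cut-≡ v = cut-unique (cut-view _ _ _ _) v

  cut-cong : ∀ {N C C'} m j → (∀ k → k < m → Participates N k j → C k ≡ C' k) → cut N C m j ≡ cut N C' m j
  cut-cong zero j h = refl
  cut-cong {N} {C} {C'} (suc m) j h
    with IH ← cut-cong {N} {C} {C'} m j (λ k k<m → h k (m<n⇒m<1+n k<m)) | partAt N m j in eP
  ... | just p  rewrite h m ≤-refl (p , eP) | IH = refl
  ... | nothing = trans (stay (C m)) (trans IH (sym (stay (C' m))))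
    where stay : ∀ c {x y} → cutStep {X = CId × S j} c nothing x y ≡ y
          stay true  = refl
          stay false = refl

  cut-≥ : ∀ {N C m j k} → k < m → C k ≡ true → Participates N k j →
          Σ ℕ λ k' → cut N C m j ≡ out k' j × k ≤ k' × k' < m × C k' ≡ true × Participates N k' j
  cut-≥ {N} {C} {m} {j} {k} k<m Ck jk with cut N C m j | cut-view N C m j
  ... | _ | none f = ⊥-elim (f k k<m Ck jk)
  ... | _ | last k' k'<m Ck' jk' f with k' <? k
  ...   | yes k'<k = ⊥-elim (f k k'<k k<m Ck jk)
  ...   | no k'≮k  = k' , refl , ≮⇒≥ k'≮k , k'<m , Ck' , jk'

  cut-later : ∀ {N C m m' j} → m ≤ m' → (∀ k → m ≤ k → k < m' → C k ≡ true → ¬ Participates N k j) →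
              cut N C m' j ≡ cut N C m j
  cut-later {N} {C} {m} {m'} {j} m≤m' h with cut N C m j | cut-view N C m j
  ... | _ | none f = cut-≡ (none λ k k<m' Ck → case k k<m' Ck)
    where
    case : ∀ k → k < m' → C k ≡ true → ¬ Participates N k j
    case k k<m' Ck with k <? m
    ... | yes k<m = f k k<m Ck
    ... | no k≮m  = h k (≮⇒≥ k≮m) k<m' Ck
  ... | _ | last k₀ k₀<m Ck₀ jk₀ f = cut-≡ (last k₀ (<-≤-trans k₀<m m≤m') Ck₀ jk₀ case)
    where
    case : ∀ k → k₀ < k → k < m' → C k ≡ true → ¬ Participates N k j
    case k k₀<k k<m' Ck with k <? m
    ... | yes k<m = f k k₀<k k<m Ck
    ... | no k≮m  = h k (≮⇒≥ k≮m) k<m' Ck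

  cut-comp : ∀ N C m j → compOf (cut N C m j) ≡ j
  cut-comp N C m j with cut N C m j | cut-view N C m j
  ... | _ | none _ = refl
  ... | _ | last _ _ _ _ _ = refl

  -- Causality between events

  -- Storing `k < m` makes causality well founded and decidable for arbitrary lists of events,
  -- before well-formedness is available.
  record DirectCause (N : Net) (k m : ℕ) : Set where
    constructor _,_
    field
      cause-<    : k < m
      cause-part : ∃[ j ] Σ (S j) λ s' → partAt N m j ≡ just (out k j , s')
  open DirectCause

  directCause? : ∀ N k m → Dec (DirectCause N k m)
  directCause? N k m = map′ (λ (p , q) → p , q) (λ (p , q) → p , q) ((k <? m) ×-dec Fin.any? d)
    where
    d : ∀ j → Dec (Σ (S j) λ s' → partAt N m j ≡ just (out k j , s'))
    d j with partAt N m j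
    ... | nothing = no λ ()
    ... | just (ini _ , s) = no λ ()
    ... | just (out k' j' , s) with k' ≟ k | j' Fin.≟ j
    ...   | yes refl | yes refl = yes (s , refl)
    ...   | no ¬p | _ = no λ { (_ , refl) → ¬p refl }
    ...   | yes _ | no ¬p = no λ { (_ , refl) → ¬p refl }

  _⊢_≼_ : Net → ℕ → ℕ → Set
  N ⊢ k ≼ m = Star (DirectCause N) k m

  _⊢_≺_ : Net → ℕ → ℕ → Set
  N ⊢ k ≺ m = Σ ℕ λ k' → N ⊢ k ≼ k' × DirectCause N k' m

  unsnoc : ∀ {N k m} → N ⊢ k ≼ m → k ≡ m ⊎ N ⊢ k ≺ m
  unsnoc ε = inj₁ refl
  unsnoc (d ◅ ds) with unsnoc ds
  ... | inj₁ refl = inj₂ (_ , ε , d)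
  ... | inj₂ (k' , p , d') = inj₂ (k' , d ◅ p , d')

  ≺⇒≼ : ∀ {N k m} → N ⊢ k ≺ m → N ⊢ k ≼ m
  ≺⇒≼ (_ , p , d) = p ◅◅ (d ◅ ε)

  ≼⇒≤ : ∀ {N k m} → N ⊢ k ≼ m → k ≤ m
  ≼⇒≤ ε = ≤-refl
  ≼⇒≤ (d ◅ ds) = ≤-trans (<⇒≤ (cause-< d)) (≼⇒≤ ds)

  ≺⇒< : ∀ {N k m} → N ⊢ k ≺ m → k < m
  ≺⇒< (_ , p , d) = ≤-<-trans (≼⇒≤ p) (cause-< d)

  ≼-≺-trans : ∀ {N k l m} → N ⊢ k ≼ l → N ⊢ l ≺ m → N ⊢ k ≺ m
  ≼-≺-trans p (_ , q , d) = _ , p ◅◅ q , d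

  ≺-≼-trans : ∀ {N k l m} → N ⊢ k ≺ l → N ⊢ l ≼ m → N ⊢ k ≺ m
  ≺-≼-trans (_ , p , d) q with unsnoc q
  ... | inj₁ refl = _ , p , d
  ... | inj₂ r = ≼-≺-trans (p ◅◅ (d ◅ ε)) r

  ≼? : ∀ N k m → Dec (N ⊢ k ≼ m)
  ≼? N k = <-rec (λ m → Dec (N ⊢ k ≼ m)) go
    where
    go : ∀ m → (∀ {m'} → m' < m → Dec (N ⊢ k ≼ m')) → Dec (N ⊢ k ≼ m)
    go m rec = map′ to from ((k ≟ m) ⊎-dec search m ≤-refl)
      where
      search : ∀ b → b ≤ m → Dec (∃[ m' ] (m' < b × N ⊢ k ≼ m' × DirectCause N m' m))
      search zero _ = no λ { (_ , () , _) }
      search (suc b) b<m with rec b<m ×-dec directCause? N b m | search b (<⇒≤ b<m)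
      ... | yes p | _ = yes (b , ≤-refl , p)
      ... | no _  | yes (m' , m'<b , p) = yes (m' , m<n⇒m<1+n m'<b , p)
      ... | no ¬p | no ¬q = no λ { (m' , s≤s m'≤b , p) → case m' m'≤b p }
        where
        case : ∀ m' → m' ≤ b → ¬ (N ⊢ k ≼ m' × DirectCause N m' m)
        case m' m'≤b p with m≤n⇒m<n∨m≡n m'≤b
        ... | inj₁ m'<b = ¬q (m' , m'<b , p)
        ... | inj₂ refl = ¬p p
      to : (k ≡ m) ⊎ (∃[ m' ] (m' < m × N ⊢ k ≼ m' × DirectCause N m' m)) → N ⊢ k ≼ m
      to (inj₁ refl) = ε
      to (inj₂ (m' , _ , p , d)) = p ◅◅ (d ◅ ε)
      from : N ⊢ k ≼ m → (k ≡ m) ⊎ (∃[ m' ] (m' < m × N ⊢ k ≼ m' × DirectCause N m' m))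
      from p with unsnoc p
      ... | inj₁ e = inj₁ e
      ... | inj₂ (m' , q , d) = inj₂ (m' , cause-< d , q , d)

  -- Opaque so that goals mention `past` instead of the unfolded decision procedure; the two lemmas
  -- are its interface.
  opaque
    past : Net → ℕ → EventSet
    past N m k = does (≼? N k m)

    past⇒ : ∀ {N m k} → past N m k ≡ true → N ⊢ k ≼ m
    past⇒ {N} {m} {k} = does-true (≼? N k m)

    ⇒past : ∀ {N m k} → N ⊢ k ≼ m → past N m k ≡ true
    ⇒past {N} {m} {k} = dec-true (≼? N k m)

  -- Configurations

  -- One requirement covers both classical ones. A consumed condition found in the cut has its
  -- producer in `C`, which gives causal closure; two consumers of one condition cannot both find
  -- it, which gives conflict-freeness.
  Config : Net → EventSet → Set
  Config N C = ∀ m → C m ≡ true →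
    m < length N × (∀ j b s' → partAt N m j ≡ just (b , s') → cut N C m j ≡ b)

  Down : Net → EventSet → Set
  Down N D = ∀ k m → DirectCause N k m → D m ≡ true → D k ≡ true

  down-≼ : ∀ {N D k m} → Down N D → N ⊢ k ≼ m → D m ≡ true → D k ≡ true
  down-≼ dn ε Dm = Dm
  down-≼ dn (d ◅ p) Dm = dn _ _ d (down-≼ dn p Dm)

  down-past : ∀ N m → Down N (past N m)
  down-past N m k k' d e = ⇒past (d ◅ past⇒ e)

  config-down : ∀ {N C} → Config N C → Down N C
  config-down {N} {C} in-config k m (k<m , j , s' , e) Cm
    with cut N C m j | cut-view N C m j | proj₂ (in-config m Cm) j (out k j) s' e
  ... | _ | last _ _ Ck _ _ | refl = Ck

  -- The last j-event of `C` before `m` is the producer of the j-condition that `m` consumes. Causal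
  -- closure puts it into `D`, and a subset contains nothing between the two.
  sub-config : ∀ {N C D} → Config N C → D ⊆ₑ C → Down N D → Config N D
  sub-config {N} {C} {D} in-config sub dn m Dm = proj₁ (in-config m (sub m Dm)) , origin
    where
    origin : ∀ j b s' → partAt N m j ≡ just (b , s') → cut N D m j ≡ b
    origin j b s' e with cut N C m j | cut-view N C m j | proj₂ (in-config m (sub m Dm)) j b s' e
    ... | _ | none f | refl = cut-≡ (none λ k k<m Dk → f k k<m (sub k Dk))
    ... | _ | last k k<m Ck jk f | refl =
      cut-≡ (last k k<m (dn k m (k<m , j , s' , e) Dm) jk λ k' p q Dk' → f k' p q (sub k' Dk'))

  -- The latest j-event of `C` before `m` produced the condition that `m` consumes, hence is a
  -- direct cause of `m`; the induction descends from it to `k`.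
  ≺-same-comp : ∀ {N C j} → Config N C → ∀ m {k} → k < m → C k ≡ true → C m ≡ true →
                Participates N k j → Participates N m j → N ⊢ k ≺ m
  ≺-same-comp {N} {C} {j} in-config = <-rec _ go
    where
    go : ∀ m → (∀ {m'} → m' < m → ∀ {k} → k < m' → C k ≡ true → C m' ≡ true →
                Participates N k j → Participates N m' j → N ⊢ k ≺ m') →
         ∀ {k} → k < m → C k ≡ true → C m ≡ true → Participates N k j → Participates N m j → N ⊢ k ≺ m
    go m rec {k} k<m Ck Cm jk ((b , s') , e)
      with cut-≥ {N} {C} {m} {j} k<m Ck jk
    ... | k' , eq , k≤k' , k'<m , Ck' , jk' with trans (sym (proj₂ (in-config m Cm) j b s' e)) eq
    ... | refl with m≤n⇒m<n∨m≡n k≤k'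
    ... | inj₁ k<k' = k' , ≺⇒≼ (rec k'<m k<k' Ck Ck' jk jk') , (k'<m , j , s' , e)
    ... | inj₂ refl = k , ε , (k'<m , j , s' , e)

  ≼-total-comp : ∀ {N C j k m} → Config N C → C k ≡ true → C m ≡ true →
                 Participates N k j → Participates N m j → N ⊢ k ≼ m ⊎ N ⊢ m ≺ k
  ≼-total-comp {N} {C} {j} {k} {m} in-config Ck Cm jk jm with <-cmp k m
  ... | tri< k<m _ _ = inj₁ (≺⇒≼ (≺-same-comp in-config m k<m Ck Cm jk jm))
  ... | tri≈ _ refl _ = inj₁ ε
  ... | tri> _ _ m<k = inj₂ (≺-same-comp in-config k m<k Cm Ck jm jk)

  finalCut : Net → EventSet → Fin n → CId
  finalCut N C = cut N C (length N)

  -- The state of component j a condition of component j is labelled with; junk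
  -- (the initial state) for conditions that do not exist.
  labelOf : ∀ {j} → Maybe (CId × S j) → S j
  labelOf {j} nothing         = init (A j)
  labelOf     (just (_ , s')) = s'

  labelAt : Net → (j : Fin n) → CId → S j
  labelAt N j (ini _)   = init (A j)
  labelAt N j (out k _) = labelOf (partAt N k j)

  stateOf : Net → EventSet → GState
  stateOf N C j = labelAt N j (finalCut N C j)

  _≐_ : GState → GState → Set
  g ≐ h = ∀ j → g j ≡ h j

  -- The facts about branching processes on which the proof relies, freed of markings. `in-config`
  -- is the trace left by the reachable marking of `PossExt`: an event lies in some configuration,
  -- so its past is one.
  record WellFormed (N : Net) : Set where
    field
      origin  : ∀ {k j b s'} → partAt N k j ≡ just (b , s') →
             b ≡ ini j ⊎ (Σ ℕ λ k' → k' < k × b ≡ out k' j × Participates N k' j)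
      in-config  : ∀ {k} → k < length N → Σ EventSet λ C → Config N C × C k ≡ true
      ∈⇒participates  : ∀ {k j} → k < length N → actAt N k ∈ acts (A j) → Participates N k j
      some-∈  : ∀ {k} → k < length N → ∃[ j ] (actAt N k ∈ acts (A j))
      is-transition  : ∀ {k j b s'} → partAt N k j ≡ just (b , s') → tr (A j) (labelAt N j b) s' ≡ just (actAt N k)
      distinct : ∀ {k k'} → k < length N → k' < length N → actAt N k ≡ actAt N k' →
             (∀ j → partAt N k j ≡ partAt N k' j) → k ≡ k'

  partAt-< : ∀ N k j {p} → partAt N k j ≡ just p → k < length N
  partAt-< (x ∷ N) zero    j e = s≤s z≤n
  partAt-< (x ∷ N) (suc k) j e = s≤s (partAt-< N k j e)

  participates-< : ∀ {N k j} → Participates N k j → k < length N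
  participates-< {N} {k} {j} (p , e) = partAt-< N k j e

  add : EventSet → ℕ → EventSet
  add C k m = C m ∨ does (m ≟ k)

  add-old : ∀ {C k m} → C m ≡ true → add C k m ≡ true
  add-old e rewrite e = refl

  add-new : ∀ C k → add C k k ≡ true
  add-new C k with C k
  ... | true = refl
  ... | false = dec-true (k ≟ k) refl

  add⇒ : ∀ {C k m} → add C k m ≡ true → C m ≡ true ⊎ m ≡ k
  add⇒ {C} {k} {m} e with C m
  ... | true = inj₁ refl
  ... | false = inj₂ (does-true (m ≟ k) e)

  add-≢ : ∀ {C k m} → m ≢ k → add C k m ≡ C m
  add-≢ {C} {k} {m} m≢k rewrite dec-false (m ≟ k) m≢k = ∨-identityʳ (C m)

  Fireable : Net → EventSet → ℕ → Set
  Fireable N C k = k < length N × (∀ j b s' → partAt N k j ≡ just (b , s') → finalCut N C j ≡ b)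

  module Core {N : Net} (wf : WellFormed N) where
    open WellFormed wf

    participates⇒∈ : ∀ {k j} → Participates N k j → actAt N k ∈ acts (A j)
    participates⇒∈ {k} {j} ((b , s') , e) = tr-acts (A j) _ _ _ (is-transition e)

    participant : ∀ {k} → k < length N → ∃[ j ] Participates N k j
    participant k< with some-∈ k<
    ... | j , a∈ = j , ∈⇒participates k< a∈

    past-config : ∀ {k} → k < length N → Config N (past N k)
    past-config {k} k< with in-config k<
    ... | C , c , Ck = sub-config c (λ m e → down-≼ (config-down c) (past⇒ e) Ck) (down-past N k)

    -- The cut contains a condition older than k, so every event of C in that component is older than k.
    fire-no-later : ∀ {C k j m} → Fireable N C k → Participates N k j → k ≤ m → C m ≡ true → ¬ Participates N m j
    fire-no-later {C} {k} {j} {m} (k< , f) ((b , s') , e) k≤m Cm jm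
      with cut-≥ {N} {C} {length N} {j} {m} (participates-< jm) Cm jm | origin e
    ... | k₁ , eq , m≤k₁ , _ | inj₁ b≡ini with trans (sym eq) (trans (f j b s' e) b≡ini)
    ...   | ()
    fire-no-later {C} {k} {j} {m} (k< , f) ((b , s') , e) k≤m Cm jm
        | k₁ , eq , m≤k₁ , _ | inj₂ (k₂ , k₂<k , b≡out , _)
      with out-injective (trans (sym eq) (trans (f j b s' e) b≡out))
    ...   | refl = <⇒≱ k₂<k (≤-trans k≤m m≤k₁)

    fire-∉ : ∀ {C k} → Fireable N C k → ¬ (C k ≡ true)
    fire-∉ fr Ck with participant (proj₁ fr)
    ... | j , jk = fire-no-later fr jk ≤-refl Ck jk

    -- The number of `k` may fall in the middle of `C`. By `fire-no-later` no member with a larger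
    -- number shares a component with `k`, so the insertion is invisible to the cuts those members
    -- find.
    fire-config : ∀ {C k} → Config N C → Fireable N C k → Config N (add C k)
    fire-config {C} {k} c fr m e with add⇒ {C} {k} {m} e
    ... | inj₂ refl = proj₁ fr , pre'
      where
      pre' : ∀ j b s' → partAt N k j ≡ just (b , s') → cut N (add C k) k j ≡ b
      pre' j b s' e' = trans
        (cut-cong k j (λ k' k'<k _ → add-≢ {C} (<⇒≢ k'<k)))
        (trans (sym (cut-later (<⇒≤ (proj₁ fr)) λ k' k≤k' _ → fire-no-later fr (_ , e') k≤k'))
               (proj₂ fr j b s' e'))
    ... | inj₁ Cm = proj₁ (c m Cm) , pre'
      where
      pre' : ∀ j b s' → partAt N m j ≡ just (b , s') → cut N (add C k) m j ≡ b
      pre' j b s' e' = trans (cut-cong m j same) (proj₂ (c m Cm) j b s' e')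
        where
        same : ∀ k' → k' < m → Participates N k' j → add C k k' ≡ C k'
        same k' k'<m jk' with k' ≟ k
        ... | yes refl = ⊥-elim (fire-no-later fr jk' (<⇒≤ k'<m) Cm (_ , e'))
        ... | no k'≢k = add-≢ {C} k'≢k

    fire-cut-new : ∀ {C k j} → Fireable N C k → Participates N k j → finalCut N (add C k) j ≡ out k j
    fire-cut-new {C} {k} {j} fr jk = cut-≡ (last k (proj₁ fr) (add-new C k) jk later)
      where
      later : ∀ k' → k < k' → k' < length N → add C k k' ≡ true → ¬ Participates N k' j
      later k' k<k' _ e with add⇒ {C} {k} {k'} e
      ... | inj₁ Ck' = fire-no-later fr jk (<⇒≤ k<k') Ck'
      ... | inj₂ refl = ⊥-elim (<-irrefl refl k<k')

    fire-cut-old : ∀ {C k j} → ¬ Participates N k j → finalCut N (add C k) j ≡ finalCut N C j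
    fire-cut-old {C} {k} {j} ¬jk = cut-cong (length N) j λ m _ jm → add-≢ {C} λ { refl → ¬jk jm }

    fire-step : ∀ {C k} → Fireable N C k → GStep (stateOf N C) (actAt N k) (stateOf N (add C k))
    fire-step {C} {k} fr = (λ j → moves j , stays j) , some-∈ (proj₁ fr)
      where
      moves : ∀ j → actAt N k ∈ acts (A j) → tr (A j) (stateOf N C j) (stateOf N (add C k) j) ≡ just (actAt N k)
      moves j a∈ with ∈⇒participates (proj₁ fr) a∈
      ... | (b , s') , e rewrite fire-cut-new fr (_ , e) | e | proj₂ fr j b s' e = is-transition e
      stays : ∀ j → actAt N k ∉ acts (A j) → stateOf N (add C k) j ≡ stateOf N C j
      stays j a∉ = cong (labelAt N j) (fire-cut-old {C} λ jk → a∉ (participates⇒∈ jk))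

  -- Markings and firing sequences

  bool-≡ : ∀ {x y : Bool} → (x ≡ true → y ≡ true) → (y ≡ true → x ≡ true) → x ≡ y
  bool-≡ {true}  {true}  f g = refl
  bool-≡ {true}  {false} f g = sym (f refl)
  bool-≡ {false} {true}  f g = g refl
  bool-≡ {false} {false} f g = refl

  _≟ᶜ_ : (b b' : CId) → Dec (b ≡ b')
  ini j ≟ᶜ ini j' = map′ (cong ini) (λ { refl → refl }) (j Fin.≟ j')
  ini _ ≟ᶜ out _ _ = no λ ()
  out _ _ ≟ᶜ ini _ = no λ ()
  out k j ≟ᶜ out k' j' = map′ (λ { (refl , refl) → refl }) (λ { refl → refl , refl }) ((k ≟ k') ×-dec (j Fin.≟ j'))

  nth-< : ∀ {X : Set} (N : List X) k {e} → nth N k ≡ just e → k < length N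
  nth-< (x ∷ N) zero _ = s≤s z≤n
  nth-< (x ∷ N) (suc k) e = s≤s (nth-< N k e)

  <-nth : ∀ {X : Set} (N : List X) k → k < length N → Σ X λ e → nth N k ≡ just e
  <-nth (x ∷ N) zero _ = x , refl
  <-nth (x ∷ N) (suc k) (s≤s k<) = <-nth N k k<

  partAt-nth : ∀ N k j {p} → partAt N k j ≡ just p → Σ Event λ e → nth N k ≡ just e × part e j ≡ just p
  partAt-nth N k j eq with nth N k
  ... | just e = e , refl , eq

  nth-partAt : ∀ N k {e} j → nth N k ≡ just e → partAt N k j ≡ part e j
  nth-partAt N k j eq rewrite eq = refl

  Consumes : Net → ℕ → CId → Set
  Consumes N f b = ∃[ j ] Σ (S j) λ s' → partAt N f j ≡ just (b , s')

  Ends : Net → Node → ℕ → Set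
  Ends N (evt k) m = k ≡ m
  Ends N (cnd b) m = ∃[ j ] (b ≡ out m j × Participates N m j)

  Matches : Net → Marking → EventSet → Set
  Matches N M C = ∀ b → (M b ≡ true) ⇔ (finalCut N C (compOf b) ≡ b)

  matches-unique : ∀ {N M M' C} → Matches N M C → Matches N M' C → ∀ b → M b ≡ M' b
  matches-unique h h' b = bool-≡ (λ e → proj₂ (h' b) (proj₁ (h b) e)) (λ e → proj₂ (h b) (proj₁ (h' b) e))

  matches-cong : ∀ {N M C C'} → (∀ k → C k ≡ C' k) → Matches N M C → Matches N M C'
  matches-cong {N} {M} {C} {C'} eq h b =
    (λ e → trans (sym c) (proj₁ (h b) e)) , (λ e → proj₂ (h b) (trans c e))
    where
    c : finalCut N C (compOf b) ≡ finalCut N C' (compOf b)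
    c = cut-cong (length N) (compOf b) λ k _ _ → eq k

  Mark : Net → EventSet → Marking
  Mark N C b = does (finalCut N C (compOf b) ≟ᶜ b)

  mark-matches : ∀ N C → Matches N (Mark N C) C
  mark-matches N C b = does-true (finalCut N C (compOf b) ≟ᶜ b) , dec-true (finalCut N C (compOf b) ≟ᶜ b)

  ∅ : EventSet
  ∅ _ = false

  cut-∅ : ∀ N m j → cut N ∅ m j ≡ ini j
  cut-∅ N zero j = refl
  cut-∅ N (suc m) j = cut-∅ N m j

  M₀-matches : ∀ N → Matches N M₀ ∅
  M₀-matches N (ini j) = (λ _ → cut-∅ N (length N) j) , (λ _ → refl)
  M₀-matches N (out k j) = (λ ()) , λ e → case trans (sym (cut-∅ N (length N) j)) e of λ ()

  ∅-config : ∀ N → Config N ∅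
  ∅-config N m ()

  occ-snoc : ∀ {N M M₁ M₂ k σ} → Occ N M σ M₁ → Fire N M₁ k M₂ → Occ N M (σ ∷ʳ k) M₂
  occ-snoc (done eq) (e , ne , origin , post) =
    fire (e , ne , (λ b p → trans (eq b) (origin b p)) ,
          λ b → (λ x → f₁ b (proj₁ (post b) x)) , (λ x → proj₂ (post b) (f₂ b x))) (done λ _ → refl)
    where
    f₁ : ∀ b → _ → _
    f₁ b (inj₁ p) = inj₁ p
    f₁ b (inj₂ (m , p)) = inj₂ (trans (eq b) m , p)
    f₂ : ∀ b → _ → _
    f₂ b (inj₁ p) = inj₁ p
    f₂ b (inj₂ (m , p)) = inj₂ (trans (sym (eq b)) m , p)
  occ-snoc (fire f o) g = fire f (occ-snoc o g)

  upto : EventSet → ℕ → EventSet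
  upto C m k = C k ∧ does (k <? m)

  upto⇒ : ∀ C m k → upto C m k ≡ true → C k ≡ true × k < m
  upto⇒ C m k e with C k
  ... | true = refl , does-true (k <? m) e

  ⇒upto : ∀ {C m k} → C k ≡ true → k < m → upto C m k ≡ true
  ⇒upto {C} {m} {k} e k<m rewrite e = dec-true (k <? m) k<m

  upto-suc : ∀ C m → C m ≡ true → ∀ k → add (upto C m) m k ≡ upto C (suc m) k
  upto-suc C m Cm k = bool-≡ to from
    where
    to : add (upto C m) m k ≡ true → upto C (suc m) k ≡ true
    to e with add⇒ {upto C m} {m} {k} e
    ... | inj₁ u = let c , k<m = upto⇒ C m k u in ⇒upto {C} c (m<n⇒m<1+n k<m)
    ... | inj₂ refl = ⇒upto {C} Cm ≤-refl
    from : upto C (suc m) k ≡ true → add (upto C m) m k ≡ true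
    from u with upto⇒ C (suc m) k u
    ... | c , s≤s k≤m with m≤n⇒m<n∨m≡n k≤m
    ... | inj₁ k<m = add-old {upto C m} (⇒upto {C} c k<m)
    ... | inj₂ refl = add-new (upto C m) m

  upto-same : ∀ C m → C m ≡ false → ∀ k → upto C m k ≡ upto C (suc m) k
  upto-same C m Cm k = bool-≡ (λ u → let c , k<m = upto⇒ C m k u in ⇒upto {C} c (m<n⇒m<1+n k<m)) from
    where
    from : upto C (suc m) k ≡ true → upto C m k ≡ true
    from u with upto⇒ C (suc m) k u
    ... | c , s≤s k≤m with m≤n⇒m<n∨m≡n k≤m
    ... | inj₁ k<m = ⇒upto {C} c k<m
    ... | inj₂ refl = case trans (sym Cm) c of λ ()

  module Link {N : Net} (wf : WellFormed N) where
    open WellFormed wf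
    open Core wf

    pre-comp : ∀ {k j b s'} → partAt N k j ≡ just (b , s') → compOf b ≡ j
    pre-comp e with origin e
    ... | inj₁ refl = refl
    ... | inj₂ (_ , _ , refl , _) = refl

    consumes⇒cause : ∀ {k j f} → Consumes N f (out k j) → DirectCause N k f
    consumes⇒cause (j , s' , e) with origin e
    ... | inj₂ (k , k<f , refl , _) = k<f , j , s' , e

    participates-arc : ∀ {k j} → Participates N k j → Arc N (evt k) (cnd (out k j))
    participates-arc {k} {j} (p , e) with partAt-nth N k j e
    ... | ev , ne , pe = outArc ne (j , refl , p , pe)

    consumes-arc : ∀ {f b} → Consumes N f b → Arc N (cnd b) (evt f)
    consumes-arc {f} (j , s' , e) with partAt-nth N f j e
    ... | ev , ne , pe = inArc ne (j , s' , pe)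

    arc-consumes : ∀ {f b} → Arc N (cnd b) (evt f) → Consumes N f b
    arc-consumes {f} (inArc ne (j , s' , pe)) = j , s' , trans (nth-partAt N f j ne) pe

    cause⇒< : ∀ {k m} → DirectCause N k m → N ⊢ evt k <ₙ evt m
    cause⇒< {k} {m} (k<m , j , s' , e) with origin e
    ... | inj₂ (_ , _ , refl , jk) = participates-arc jk ∷ [ consumes-arc (j , s' , e) ]

    ≼⇒≤ₙ : ∀ {k m} → N ⊢ k ≼ m → N ⊢ evt k ≤ₙ evt m
    ≼⇒≤ₙ ε = inj₁ refl
    ≼⇒≤ₙ (d ◅ p) with ≼⇒≤ₙ p
    ... | inj₁ refl = inj₂ (cause⇒< d)
    ... | inj₂ q = inj₂ (cause⇒< d ++ q)

    ≺⇒<ₙ : ∀ {k m} → N ⊢ k ≺ m → N ⊢ evt k <ₙ evt m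
    ≺⇒<ₙ (k' , p , d) with ≼⇒≤ₙ p
    ... | inj₁ refl = cause⇒< d
    ... | inj₂ q = q ++ cause⇒< d

    cnd-< : ∀ {b f m j} → Consumes N f b → N ⊢ f ≼ m → Participates N m j → N ⊢ cnd b <ₙ cnd (out m j)
    cnd-< c p jm with ≼⇒≤ₙ p
    ... | inj₁ refl = consumes-arc c ∷ [ participates-arc jm ]
    ... | inj₂ q = consumes-arc c ∷ (q ++ [ participates-arc jm ])

    from-cnd : ∀ {b y} → N ⊢ cnd b <ₙ y → ∃[ f ] ∃[ m ] (Consumes N f b × N ⊢ f ≼ m × Ends N y m)
    from-evt : ∀ {k y} → N ⊢ evt k <ₙ y →
               (∃[ j ] (y ≡ cnd (out k j) × Participates N k j)) ⊎ (∃[ m ] (N ⊢ k ≺ m × Ends N y m))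
    from-cnd [ a@(inArc {k = k} _ _) ] = k , k , arc-consumes a , ε , refl
    from-cnd (a@(inArc {k = k} _ _) ∷ p) with from-evt p
    ... | inj₁ (j , refl , jk) = k , k , arc-consumes a , ε , j , refl , jk
    ... | inj₂ (m , k≺m , y) = k , m , arc-consumes a , ≺⇒≼ k≺m , y
    from-evt {k} [ outArc ne (j , refl , q , pe) ] = inj₁ (j , refl , (q , trans (nth-partAt N k j ne) pe))
    from-evt {k} (outArc ne (j , refl , q , pe) ∷ p) with from-cnd p
    ... | f , m , c , f≼m , y = inj₂ (m , ≺-≼-trans (k , ε , consumes⇒cause c) f≼m , y)

    <ₙ⇒≺ : ∀ {k m} → N ⊢ evt k <ₙ evt m → N ⊢ k ≺ m
    <ₙ⇒≺ p with from-evt p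
    ... | inj₂ (_ , q , refl) = q

    ≤ₙ⇒≼ : ∀ {k m} → N ⊢ evt k ≤ₙ evt m → N ⊢ k ≼ m
    ≤ₙ⇒≼ (inj₁ refl) = ε
    ≤ₙ⇒≼ (inj₂ p) = ≺⇒≼ (<ₙ⇒≺ p)

    post-iff : ∀ {C k e} → Fireable N C k → nth N k ≡ just e → ∀ b →
      (finalCut N (add C k) (compOf b) ≡ b) ⇔ (InPost k e b ⊎ ((finalCut N C (compOf b) ≡ b) × ¬ InPre e b))
    post-iff {C} {k} {e} fr ne b = to , from
      where
      to : finalCut N (add C k) (compOf b) ≡ b → InPost k e b ⊎ ((finalCut N C (compOf b) ≡ b) × ¬ InPre e b)
      to eq with participates? N k (compOf b)
      ... | yes (p , pe) = inj₁ (compOf b , trans (sym eq) (fire-cut-new fr (p , pe)) , p ,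
                                 trans (sym (nth-partAt N k _ ne)) pe)
      ... | no ¬j = inj₂ (trans (sym (fire-cut-old {C} ¬j)) eq ,
        λ { (j , s' , pe) → let e' = trans (nth-partAt N k j ne) pe in
            ¬j (subst (Participates N k) (sym (pre-comp e')) (_ , e')) })
      from : InPost k e b ⊎ ((finalCut N C (compOf b) ≡ b) × ¬ InPre e b) → finalCut N (add C k) (compOf b) ≡ b
      from (inj₁ (j , refl , p , pe)) = fire-cut-new fr (p , trans (nth-partAt N k j ne) pe)
      from (inj₂ (eq , ¬pre)) with participates? N k (compOf b)
      ... | no ¬j = trans (fire-cut-old {C} ¬j) eq
      ... | yes ((b' , s') , pe) with trans (sym eq) (proj₂ fr (compOf b) b' s' pe)
      ... | refl = ⊥-elim (¬pre (compOf b , s' , trans (sym (nth-partAt N k _ ne)) pe))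

    fire-fireable : ∀ {M M' C k} → Matches N M C → Fire N M k M' → Fireable N C k
    fire-fireable {k = k} mt (e , ne , pr , post) = nth-< N k ne ,
      λ j b s' pe → subst (λ j → finalCut N _ j ≡ b) (pre-comp pe)
        (proj₁ (mt b) (pr b (j , s' , trans (sym (nth-partAt N k j ne)) pe)))

    fire-matches : ∀ {M M' C k} → Matches N M C → Fire N M k M' → Matches N M' (add C k)
    fire-matches {M} {M'} {C} {k} mt f@(e , ne , pr , post) b =
      (λ m → proj₂ iff (to (proj₁ (post b) m))) , (λ m → proj₂ (post b) (from (proj₁ iff m)))
      where
      iff = post-iff {C} (fire-fireable {M} {M'} {C} mt f) ne b
      to : _ → _
      to (inj₁ p) = inj₁ p
      to (inj₂ (m , p)) = inj₂ (proj₁ (mt b) m , p)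
      from : _ → _
      from (inj₁ p) = inj₁ p
      from (inj₂ (m , p)) = inj₂ (proj₂ (mt b) m , p)

    fireable-fire : ∀ {M M' C k} → Fireable N C k → Matches N M C → Matches N M' (add C k) → Fire N M k M'
    fireable-fire {M} {M'} {C} {k} fr mt mt' with <-nth N k (proj₁ fr)
    ... | e , ne = e , ne , pr , λ b →
        (λ m → from b (proj₁ (post-iff {C} fr ne b) (proj₁ (mt' b) m)))
      , (λ m → proj₂ (mt' b) (proj₂ (post-iff {C} fr ne b) (to b m)))
      where
      pr : ∀ b → InPre e b → M b ≡ true
      pr b (j , s' , pe) = let e' = trans (nth-partAt N k j ne) pe in
        proj₂ (mt b) (subst (λ j → finalCut N C j ≡ b) (sym (pre-comp e')) (proj₂ fr j b s' e'))
      to : ∀ b → _ → _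
      to b (inj₁ p) = inj₁ p
      to b (inj₂ (m , p)) = inj₂ (proj₁ (mt b) m , p)
      from : ∀ b → _ → _
      from b (inj₁ p) = inj₁ p
      from b (inj₂ (m , p)) = inj₂ (proj₂ (mt b) m , p)

    -- Only the set of fired events is kept. Their order is irrelevant because the marking is read
    -- off from the set through its cut.
    occ-config : ∀ {C M σ M'} → Config N C → Matches N M C → Occ N M σ M' →
      Σ EventSet λ C' → Config N C' × Matches N M' C' × (∀ k → (C' k ≡ true) ⇔ (C k ≡ true ⊎ k ∈ σ))
    occ-config {C} c mt (done eq) = C , c ,
      (λ b → (λ m → proj₁ (mt b) (trans (eq b) m)) , (λ m → trans (sym (eq b)) (proj₂ (mt b) m))) ,
      λ k → inj₁ , λ { (inj₁ m) → m }
    occ-config {C} c mt (fire {M} {M₁} {M₂} {k} f o)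
      with occ-config (fire-config c (fire-fireable {M} {M₁} {C} mt f)) (fire-matches {M} {M₁} {C} mt f) o
    ... | C' , c' , mt' , iff = C' , c' , mt' , λ m → (λ x → to m (proj₁ (iff m) x)) , (λ x → proj₂ (iff m) (from m x))
      where
      to : ∀ m → add C k m ≡ true ⊎ m ∈ _ → C m ≡ true ⊎ m ∈ (k ∷ _)
      to m (inj₂ p) = inj₂ (there p)
      to m (inj₁ e) with add⇒ {C} {k} {m} e
      ... | inj₁ p = inj₁ p
      ... | inj₂ refl = inj₂ (here refl)
      from : ∀ m → C m ≡ true ⊎ m ∈ (k ∷ _) → add C k m ≡ true ⊎ m ∈ _
      from m (inj₁ e) = inj₁ (add-old {C} e)
      from m (inj₂ (here refl)) = inj₁ (add-new C k)
      from m (inj₂ (there p)) = inj₂ p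

    upto-config : ∀ {C} m → Config N C → Config N (upto C m)
    upto-config {C} m c = sub-config c (λ k u → proj₁ (upto⇒ C m k u))
      λ k m' d u → let Cm' , m'<m = upto⇒ C m m' u in
        ⇒upto {C} (config-down c k m' d Cm') (<-trans (DirectCause.cause-< d) m'<m)

    upto-fireable : ∀ {C m} → Config N C → C m ≡ true → Fireable N (upto C m) m
    upto-fireable {C} {m} c Cm = proj₁ (c m Cm) , λ j b s' e →
      trans (cut-later (<⇒≤ (proj₁ (c m Cm))) λ k m≤k _ u _ → <⇒≱ (proj₂ (upto⇒ C m k u)) m≤k)
     (trans (cut-cong m j λ k k<m _ → bool-≡ (λ u → proj₁ (upto⇒ C m k u)) (λ Ck → ⇒upto {C} Ck k<m))
            (proj₂ (c m Cm) j b s' e))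

    -- Firing in increasing order never blocks: when `m` is reached, the smaller members have
    -- produced exactly the cut that `Config` promises to `m`.
    upto-occ : ∀ {C} m → Config N C → ∀ {M'} → Matches N M' (upto C m) →
               ∃[ σ ] (Occ N M₀ σ M' × (∀ k → (k ∈ σ) ⇔ (upto C m k ≡ true)))
    upto-occ {C} zero c mt = [] , done (matches-unique {N} {C = ∅} (M₀-matches N) (matches-cong {N} empty mt)) ,
      λ k → (λ ()) , λ u → case proj₂ (upto⇒ C zero k u) of λ ()
      where
      empty : ∀ k → upto C zero k ≡ false
      empty k = bool-≡ (λ u → case proj₂ (upto⇒ C zero k u) of λ ()) λ ()
    upto-occ {C} (suc m) c {M'} mt with C m in Cm
    ... | false with upto-occ {C} m c (matches-cong {N} (λ k → sym (upto-same C m Cm k)) mt)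
    ...   | σ , o , iff = σ , o , λ k → (λ x → trans (sym (upto-same C m Cm k)) (proj₁ (iff k) x))
                                      , (λ x → proj₂ (iff k) (trans (upto-same C m Cm k) x))
    upto-occ {C} (suc m) c {M'} mt | true
      with upto-occ {C} m c (mark-matches N (upto C m))
    ...   | σ , o , iff = σ ∷ʳ m
          , occ-snoc o (fireable-fire {Mark N (upto C m)} (upto-fireable c Cm) (mark-matches N (upto C m))
              (matches-cong {N} (λ k → sym (upto-suc C m Cm k)) mt))
          , λ k → to k , from k
      where
      to : ∀ k → k ∈ σ ∷ʳ m → upto C (suc m) k ≡ true
      to k p with ∈-++⁻ σ p
      ... | inj₁ q = trans (sym (upto-suc C m Cm k)) (add-old {upto C m} (proj₁ (iff k) q))
      ... | inj₂ (here refl) = ⇒upto {C} Cm ≤-refl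
      from : ∀ k → upto C (suc m) k ≡ true → k ∈ σ ∷ʳ m
      from k u with add⇒ {upto C m} {m} {k} (trans (upto-suc C m Cm k) u)
      ... | inj₁ q = ∈-++⁺ˡ (proj₂ (iff k) q)
      ... | inj₂ refl = ∈-++⁺ʳ σ (here refl)

    config-occ : ∀ {C} → Config N C →
                 ∃[ σ ] (Occ N M₀ σ (Mark N C) × (∀ k → (k ∈ σ) ⇔ (C k ≡ true)))
    config-occ {C} c with upto-occ {C} (length N) c (matches-cong {N} (λ k → sym (all k)) (mark-matches N C))
      where
      all : ∀ k → upto C (length N) k ≡ C k
      all k = bool-≡ (λ u → proj₁ (upto⇒ C (length N) k u)) (λ Ck → ⇒upto {C} Ck (proj₁ (c k Ck)))
    ... | σ , o , iff = σ , o , λ k → (λ x → proj₁ (upto⇒ C (length N) k (proj₁ (iff k) x)))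
                                    , (λ Ck → proj₂ (iff k) (⇒upto {C} Ck (proj₁ (c k Ck))))

    -- `InM` allows any firing sequence of [k]. All of them fire the same set, so the choice does
    -- not influence the marking.
    InM⇒ : ∀ {k b} → InM N k b → finalCut N (past N k) (compOf b) ≡ b
    InM⇒ {k} {b} (σ , M , o , iff , Mb) with occ-config {∅} (∅-config N) (M₀-matches N) o
    ... | C' , c' , mt , iff' = trans (cut-cong (length N) (compOf b) λ m _ _ → bool-≡ (from m) (to m)) (proj₁ (mt b) Mb)
      where
      to : ∀ m → C' m ≡ true → past N k m ≡ true
      to m e with proj₁ (iff' m) e
      ... | inj₂ m∈ = ⇒past (≤ₙ⇒≼ (proj₁ (iff m) m∈))
      from : ∀ m → past N k m ≡ true → C' m ≡ true
      from m e = proj₂ (iff' m) (inj₂ (proj₂ (iff m) (≼⇒≤ₙ (past⇒ e))))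

    ⇒InM : ∀ {k b} → k < length N → finalCut N (past N k) (compOf b) ≡ b → InM N k b
    ⇒InM {k} {b} k< e = let σ , o , iff = config-occ (past-config k<) in
                        σ , Mark N (past N k) , o , (λ m → (λ p → ≼⇒≤ₙ (past⇒ (proj₁ (iff m) p)))
                                          , (λ p → proj₂ (iff m) (⇒past (≤ₙ⇒≼ p))))
                      , proj₂ (mark-matches N (past N k) b) e

    cutOf : ℕ → Fin n → CId
    cutOf k = finalCut N (past N k)

    IsMj-cutOf : ∀ {k} → k < length N → ∀ j → IsMj N k j (cutOf k j)
    IsMj-cutOf {k} k< j = ⇒InM k< (cong (cutOf k) c) , c
      where c = cut-comp N (past N k) (length N) j

    IsMj⇒ : ∀ {k j b} → IsMj N k j b → b ≡ cutOf k j
    IsMj⇒ (m , refl) = sym (InM⇒ m)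

    cutOf-own : ∀ {k j} → Participates N k j → cutOf k j ≡ out k j
    cutOf-own {k} {j} jk = cut-≡ (last k (participates-< jk) (⇒past ε) jk
      λ k' k<k' _ e _ → <⇒≱ k<k' (≼⇒≤ (past⇒ e)))

  -- Adding an event

  nth-old : ∀ {X : Set} (N : List X) e {k} → k < length N → nth (N ∷ʳ e) k ≡ nth N k
  nth-old (x ∷ N) e {zero} _ = refl
  nth-old (x ∷ N) e {suc k} (s≤s k<) = nth-old N e k<

  nth-new : ∀ {X : Set} (N : List X) e → nth (N ∷ʳ e) (length N) ≡ just e
  nth-new [] e = refl
  nth-new (x ∷ N) e = nth-new N e

  length-∷ʳ : ∀ {X : Set} (N : List X) e → length (N ∷ʳ e) ≡ suc (length N)
  length-∷ʳ N e = trans (length-++ N) (+-comm (length N) 1)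

  cut-net : ∀ {N N' C} m {j} → (∀ k → k < m → partAt N k j ≡ partAt N' k j) → cut N C m j ≡ cut N' C m j
  cut-net zero h = refl
  cut-net {N} {N'} {C} (suc m) {j} h
    rewrite h m ≤-refl | cut-net {N} {N'} {C} m {j} (λ k k<m → h k (m<n⇒m<1+n k<m)) = refl

  data LabSpec (N : Net) (j : Fin n) (s : S j) : CId → Set where
    lini : init (A j) ≡ s → LabSpec N j s (ini j)
    lout : ∀ {k b} → partAt N k j ≡ just (b , s) → LabSpec N j s (out k j)

  labC-spec : ∀ N b {j s} → labC N b ≡ just (j , s) → LabSpec N j s b
  labC-spec N (ini j) refl = lini refl
  labC-spec N (out k j) eq with nth N k in ne
  ... | just e with part e j in pe
  labC-spec N (out k j) refl | just e | just (b , s) = lout (trans (nth-partAt N k j ne) pe)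

  lab-spec : ∀ {N j s b} → LabSpec N j s b → labelAt N j b ≡ s
  lab-spec (lini e) = e
  lab-spec (lout e) rewrite e = refl

  spec-labC : ∀ {N j s b} → LabSpec N j s b → labC N b ≡ just (j , s)
  spec-labC (lini refl) = refl
  spec-labC {N} {j} (lout {k} e) with nth N k
  ... | just ev rewrite e = refl

  module Ext (N : Net) (e : Event) where

    N' : Net
    N' = N ∷ʳ e

    len' : length N' ≡ suc (length N)
    len' = length-∷ʳ N e

    old-< : ∀ {k} → k < length N → k < length N'
    old-< k< = subst (_ <_) (sym len') (m<n⇒m<1+n k<)

    new-< : length N < length N'
    new-< = subst (length N <_) (sym len') ≤-refl

    split : ∀ {k} → k < length N' → k < length N ⊎ k ≡ length N
    split {k} k< with subst (k <_) len' k<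
    ... | s≤s k≤ = m≤n⇒m<n∨m≡n k≤

    partAt-old : ∀ {k} j → k < length N → partAt N' k j ≡ partAt N k j
    partAt-old j k< rewrite nth-old N e k< = refl

    actAt-old : ∀ {k} → k < length N → actAt N' k ≡ actAt N k
    actAt-old k< rewrite nth-old N e k< = refl

    partAt-new : ∀ j → partAt N' (length N) j ≡ part e j
    partAt-new j rewrite nth-new N e = refl

    actAt-new : actAt N' (length N) ≡ act e
    actAt-new rewrite nth-new N e = refl

    participates↑ : ∀ {k j} → Participates N k j → Participates N' k j
    participates↑ {k} {j} jk@(p , eq) = p , trans (partAt-old j (participates-< jk)) eq

    participates↓ : ∀ {k j} → k < length N → Participates N' k j → Participates N k j
    participates↓ {k} {j} k< (p , eq) = p , trans (sym (partAt-old j k<)) eq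

    cut-old : ∀ {C m j} → m ≤ length N → cut N' C m j ≡ cut N C m j
    cut-old {C} {m} m≤ = cut-net {N'} {N} {C} m λ k k<m → partAt-old _ (<-≤-trans k<m m≤)

    config↑ : ∀ {C} → Config N C → Config N' C
    config↑ {C} c m Cm = let m< = proj₁ (c m Cm) in old-< m< , λ j b s' eq →
      trans (cut-old {C} (<⇒≤ m<)) (proj₂ (c m Cm) j b s' (trans (sym (partAt-old j m<)) eq))

    labSpec↑ : ∀ {j s b} → LabSpec N j s b → LabSpec N' j s b
    labSpec↑ (lini x) = lini x
    labSpec↑ {j} (lout x) = lout (trans (partAt-old j (partAt-< N _ j x)) x)

    module _ (wf : WellFormed N) where
      open WellFormed wf
      open Core wf
      open Link wf

      pre-spec : ∀ {k j b s'} → partAt N k j ≡ just (b , s') → LabSpec N j (labelAt N j b) b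
      pre-spec eq with origin eq
      ... | inj₁ refl = lini refl
      ... | inj₂ (k' , _ , refl , (p , eq')) rewrite eq' = lout eq'

      wf-extend : PossExt N e → WellFormed N'
      wf-extend (acting , aex' , (M' , (σ , o) , marked) , fresh) = record
        { origin = pre' ; in-config = cfg' ; ∈⇒participates = ain' ; some-∈ = aexx ; is-transition = trn' ; distinct = dist' }
        where
        L = length N
        new-pt : ∀ {j b s'} → partAt N' L j ≡ just (b , s') → part e j ≡ just (b , s')
        new-pt {j} eq = trans (sym (partAt-new j)) eq

        new-spec : ∀ {j b s'} → part e j ≡ just (b , s') →
                   Σ (S j) λ s → LabSpec N j s b × (tr (A j) s s' ≡ just (act e))
        new-spec {j} {b} {s'} eq with proj₂ (marked j b s' eq)
        ... | s , l , t = s , labC-spec N b l , t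

        pre' : ∀ {k j b s'} → partAt N' k j ≡ just (b , s') →
               b ≡ ini j ⊎ (Σ ℕ λ k' → k' < k × b ≡ out k' j × Participates N' k' j)
        pre' {k} {j} eq with split (partAt-< N' k j eq)
        ... | inj₁ k< with origin (trans (sym (partAt-old j k<)) eq)
        ...   | inj₁ x = inj₁ x
        ...   | inj₂ (k' , k'<k , x , jk') = inj₂ (k' , k'<k , x , participates↑ jk')
        pre' {k} {j} eq | inj₂ refl with new-spec (new-pt eq)
        ... | s , lini _ , _ = inj₁ refl
        ... | s , lout {k'} x , _ = inj₂ (k' , partAt-< N k' j x , refl , participates↑ (_ , x))

        cfg' : ∀ {k} → k < length N' → Σ EventSet λ C → Config N' C × C k ≡ true
        cfg' {k} k< with split k<
        ... | inj₁ k<L = let C , c , Ck = in-config k<L in C , config↑ c , Ck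
        -- The events fired to reach the marking of the possible extension, together with the new
        -- event, form a configuration. The new event has the largest number, so the cuts found by
        -- the others are unchanged.
        ... | inj₂ refl with occ-config {∅} (∅-config N) (M₀-matches N) o
        ...   | C , c , mt , _ = add C L , c' , add-new C L
          where
          same : ∀ m j → m ≤ L → cut N' (add C L) m j ≡ cut N C m j
          same m j m≤L = trans (cut-old {add C L} m≤L)
            (cut-cong m j λ k k<m _ → add-≢ {C} (<⇒≢ (<-≤-trans k<m m≤L)))
          c' : Config N' (add C L)
          c' m eq with add⇒ {C} {L} {m} eq
          ... | inj₁ Cm = let m< , p = config↑ c m Cm in m< , λ j b s' pe →
                  trans (trans (same m j (<⇒≤ (proj₁ (c m Cm)))) (sym (cut-old {C} (<⇒≤ (proj₁ (c m Cm)))))) (p j b s' pe)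
          ... | inj₂ refl = new-< , λ j b s' pe →
                  trans (same L j ≤-refl) (in-cut j b s' (new-pt pe))
            where
            in-cut : ∀ j b s' → part e j ≡ just (b , s') → finalCut N C j ≡ b
            in-cut j b s' pe with proj₁ (mt b) (proj₁ (marked j b s' pe)) | new-spec pe
            ... | x | _ , lini _ , _ = x
            ... | x | _ , lout _ , _ = x

        ain' : ∀ {k j} → k < length N' → actAt N' k ∈ acts (A j) → Participates N' k j
        ain' {k} {j} k< a∈ with split k<
        ... | inj₁ k<L = participates↑ (∈⇒participates k<L (subst (_∈ acts (A j)) (actAt-old k<L) a∈))
        ... | inj₂ refl = let p , x = proj₁ (acting j) (subst (_∈ acts (A j)) actAt-new a∈) in p , trans (partAt-new j) x

        aexx : ∀ {k} → k < length N' → ∃[ j ] (actAt N' k ∈ acts (A j))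
        aexx {k} k< with split k<
        ... | inj₁ k<L = let j , x = some-∈ k<L in j , subst (_∈ acts (A j)) (sym (actAt-old k<L)) x
        ... | inj₂ refl = let j , x = aex' in j , subst (_∈ acts (A j)) (sym actAt-new) x

        trn' : ∀ {k j b s'} → partAt N' k j ≡ just (b , s') → tr (A j) (labelAt N' j b) s' ≡ just (actAt N' k)
        trn' {k} {j} {b} eq with split (partAt-< N' k j eq)
        ... | inj₁ k<L rewrite actAt-old k<L = let eq' = trans (sym (partAt-old j k<L)) eq in
                trans (cong (λ s → tr (A j) s _) (lab-spec (labSpec↑ (pre-spec eq')))) (is-transition eq')
        ... | inj₂ refl rewrite actAt-new = let s , l , t = new-spec (new-pt eq) in
                trans (cong (λ s → tr (A j) s _) (lab-spec (labSpec↑ l))) t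

        old-new : ∀ {k} → k < L → actAt N' k ≡ actAt N' L → ¬ (∀ j → partAt N' k j ≡ partAt N' L j)
        old-new {k} k<L a p with <-nth N k k<L
        ... | e' , ne = fresh (k , e' , ne
            , trans (trans (sym (cong actOf ne)) (sym (actAt-old k<L))) (trans a actAt-new)
            , λ j → trans (trans (sym (nth-partAt N k j ne)) (sym (partAt-old j k<L))) (trans (p j) (partAt-new j)))

        dist' : ∀ {k k'} → k < length N' → k' < length N' → actAt N' k ≡ actAt N' k' →
                (∀ j → partAt N' k j ≡ partAt N' k' j) → k ≡ k'
        dist' k< k'< a p with split k< | split k'<
        ... | inj₁ x | inj₁ y = distinct x y (trans (sym (actAt-old x)) (trans a (actAt-old y)))
                                  (λ j → trans (sym (partAt-old j x)) (trans (p j) (partAt-old j y)))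
        ... | inj₁ x | inj₂ refl = ⊥-elim (old-new x a p)
        ... | inj₂ refl | inj₁ y = ⊥-elim (old-new y (sym a) (λ j → sym (p j)))
        ... | inj₂ refl | inj₂ refl = refl

  wf-[] : WellFormed []
  wf-[] = record
    { origin = λ () ; in-config = λ () ; ∈⇒participates = λ () ; some-∈ = λ () ; is-transition = λ () ; distinct = λ () }

  branching⇒wellFormed : ∀ {N} → IsBP N → WellFormed N
  branching⇒wellFormed base = wf-[]
  branching⇒wellFormed (extend {N} {e} bp pe) = Ext.wf-extend N e (branching⇒wellFormed bp) pe

  -- Invariants of the algorithm

  ≐-sym : ∀ {g h} → g ≐ h → h ≐ g
  ≐-sym p j = sym (p j)

  ≐-trans : ∀ {g h k} → g ≐ h → h ≐ k → g ≐ k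
  ≐-trans p q j = trans (p j) (q j)

  St[_] : Net → ℕ → GState
  St[ N ] k = stateOf N (past N k)

  iEvent⇒participates : ∀ {N k} → IsIEvent N k → Participates N k i
  iEvent⇒participates {N} {k} (e , ne , p , pe) = p , trans (nth-partAt N k i ne) pe

  participates⇒iEvent : ∀ {N k} → Participates N k i → IsIEvent N k
  participates⇒iEvent {N} {k} (p , pe) with partAt-nth N k i pe
  ... | e , ne , x = e , ne , p , x

  cut-spec : ∀ N C m j → LabSpec N j (labelAt N j (cut N C m j)) (cut N C m j)
  cut-spec N C m j with cut N C m j | cut-view N C m j
  ... | _ | none _ = lini refl
  ... | _ | last k _ _ (p , eq) _ rewrite eq = lout eq

  module Sem {N : Net} (wf : WellFormed N) where
    open Link wf

    sameSt⇒ : ∀ {k k'} → k < length N → k' < length N → SameSt N k k' → St[ N ] k ≐ St[ N ] k'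
    sameSt⇒ {k} {k'} k< k'< h j
      with trans (sym (spec-labC (cut-spec N (past N k) (length N) j)))
          (trans (h j _ _ (IsMj-cutOf k< j) (IsMj-cutOf k'< j)) (spec-labC (cut-spec N (past N k') (length N) j)))
    ... | eq = proj-snd (just-injective eq)
      where
      proj-snd : ∀ {s s' : S j} → (j , s) ≡ (j , s') → s ≡ s'
      proj-snd refl = refl

    ⇒sameSt : ∀ {k k'} → St[ N ] k ≐ St[ N ] k' → SameSt N k k'
    ⇒sameSt {k} {k'} h j b b' m m' rewrite IsMj⇒ m | IsMj⇒ m' =
      trans (spec-labC (cut-spec N (past N k) (length N) j))
     (trans (cong (λ s → just (j , s)) (h j)) (sym (spec-labC (cut-spec N (past N k') (length N) j))))

    sameIp⇒ : ∀ {k k'} → k < length N → k' < length N → SameIp N k k' → cutOf k i ≡ cutOf k' i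
    sameIp⇒ k< k'< h = h _ _ (IsMj-cutOf k< i) (IsMj-cutOf k'< i)

    ⇒sameIp : ∀ {k k'} → cutOf k i ≡ cutOf k' i → SameIp N k k'
    ⇒sameIp h b b' m m' = trans (IsMj⇒ m) (trans h (sym (IsMj⇒ m')))

  -- The new event is maximal: a path into an old node runs through old nodes only. Pasts, cuts,
  -- concurrency and `≪` of old events are therefore the same in both nets.
  module Stab (N : Net) (e : Event) (wf : WellFormed N) (wf' : WellFormed (N ∷ʳ e)) where
    open Ext N e
    module L = Link wf
    module L' = Link wf'

    cause↑ : ∀ {k m} → DirectCause N k m → DirectCause N' k m
    cause↑ (k<m , j , s' , eq) = k<m , j , s' , trans (partAt-old j (partAt-< N _ j eq)) eq

    cause↓ : ∀ {k m} → m < length N → DirectCause N' k m → DirectCause N k m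
    cause↓ m< (k<m , j , s' , eq) = k<m , j , s' , trans (sym (partAt-old j m<)) eq

    ≼↑ : ∀ {k m} → N ⊢ k ≼ m → N' ⊢ k ≼ m
    ≼↑ ε = ε
    ≼↑ (d ◅ p) = cause↑ d ◅ ≼↑ p

    ≼↓ : ∀ {k m} → m < length N → N' ⊢ k ≼ m → N ⊢ k ≼ m
    ≼↓ m< ε = ε
    ≼↓ m< (d ◅ p) = cause↓ (≤-<-trans (≼⇒≤ p) m<) d ◅ ≼↓ m< p

    ≺↓ : ∀ {k m} → m < length N → N' ⊢ k ≺ m → N ⊢ k ≺ m
    ≺↓ m< (k' , p , d) = k' , ≼↓ (<-trans (DirectCause.cause-< d) m<) p , cause↓ m< d

    past-old : ∀ {k} → k < length N → ∀ m → past N' k m ≡ past N k m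
    past-old k< m = bool-≡ (λ p → ⇒past (≼↓ k< (past⇒ p))) (λ p → ⇒past (≼↑ (past⇒ p)))

    cutOf-old : ∀ {k} j → k < length N → L'.cutOf k j ≡ L.cutOf k j
    cutOf-old {k} j k< =
      trans (cut-cong {N'} {past N' k} {past N k} (length N') j λ m _ _ → past-old k< m)
     (trans (cut-later (<⇒≤ new-<) λ m L≤m _ p _ → <⇒≱ (≤-<-trans (≼⇒≤ (past⇒ p)) k<) L≤m)
            (cut-old {past N k} ≤-refl))

    St-old : ∀ {k} → k < length N → St[ N' ] k ≐ St[ N ] k
    St-old {k} k< j rewrite cutOf-old j k< =
      lab-spec (labSpec↑ (cut-spec N (past N k) (length N) j))

    -- Being old passes backwards along arcs, which is how paths of the larger net are pulled back.
    ok : Node → Set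
    ok (evt k)         = k < length N
    ok (cnd (ini _))   = ⊤
    ok (cnd (out k _)) = k < length N

    arc↑ : ∀ {x y} → Arc N x y → Arc N' x y
    arc↑ (inArc {k} ne p) = inArc (trans (nth-old N e (nth-< N k ne)) ne) p
    arc↑ (outArc {k} ne p) = outArc (trans (nth-old N e (nth-< N k ne)) ne) p

    arc↓ : ∀ {x y} → ok y → Arc N' x y → Arc N x y × ok x
    arc↓ k< (inArc {k} {ev} {b} ne (j , s' , pe)) = inArc ne' (j , s' , pe) , okb
      where
      ne' = trans (sym (nth-old N e k<)) ne
      okb : ok (cnd b)
      okb with WellFormed.origin wf (trans (nth-partAt N k j ne') pe)
      ... | inj₁ refl = tt
      ... | inj₂ (k' , k'<k , refl , _) = <-trans k'<k k<
    arc↓ k< (outArc ne (j , refl , p)) = outArc (trans (sym (nth-old N e k<)) ne) (j , refl , p) , k<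

    <↑ : ∀ {x y} → N ⊢ x <ₙ y → N' ⊢ x <ₙ y
    <↑ [ a ] = [ arc↑ a ]
    <↑ (a ∷ p) = arc↑ a ∷ <↑ p

    <↓ : ∀ {x y} → ok y → N' ⊢ x <ₙ y → (N ⊢ x <ₙ y) × ok x
    <↓ o [ a ] = let a' , o' = arc↓ o a in [ a' ] , o'
    <↓ o (a ∷ p) = let p' , o' = <↓ o p ; a' , o'' = arc↓ o' a in (a' ∷ p') , o''

    ≤↑ : ∀ {x y} → N ⊢ x ≤ₙ y → N' ⊢ x ≤ₙ y
    ≤↑ (inj₁ eq) = inj₁ eq
    ≤↑ (inj₂ p) = inj₂ (<↑ p)

    ≤↓ : ∀ {x y} → ok y → N' ⊢ x ≤ₙ y → (N ⊢ x ≤ₙ y) × ok x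
    ≤↓ o (inj₁ refl) = inj₁ refl , o
    ≤↓ o (inj₂ p) = let p' , o' = <↓ o p in inj₂ p' , o'

    #↑ : ∀ {x y} → N ⊢ x # y → N' ⊢ x # y
    #↑ (z , p , q , k₁ , k₂ , d , a₁ , a₂ , l₁ , l₂) =
      z , p , q , k₁ , k₂ , d , arc↑ a₁ , arc↑ a₂ , ≤↑ l₁ , ≤↑ l₂

    #↓ : ∀ {x y} → ok x → ok y → N' ⊢ x # y → N ⊢ x # y
    #↓ ox oy (z , p , q , k₁ , k₂ , d , a₁ , a₂ , l₁ , l₂) =
      let l₁' , o₁ = ≤↓ ox l₁ ; l₂' , o₂ = ≤↓ oy l₂
      in z , p , q , k₁ , k₂ , d , proj₁ (arc↓ o₁ a₁) , proj₁ (arc↓ o₂ a₂) , l₁' , l₂'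

    conc↑ : ∀ {x y} → ok x → ok y → Concurrent N x y → Concurrent N' x y
    conc↑ ox oy (a , b , c) = (λ p → a (proj₁ (≤↓ oy p))) , (λ p → b (proj₁ (≤↓ ox p))) , (λ p → c (#↓ ox oy p))

    conc↓ : ∀ {x y} → Concurrent N' x y → Concurrent N x y
    conc↓ (a , b , c) = (λ p → a (≤↑ p)) , (λ p → b (≤↑ p)) , (λ p → c (#↑ p))

    InM↑ : ∀ {k b} → k < length N → InM N k b → InM N' k b
    InM↑ {k} {b} k< m = L'.⇒InM (old-< k<) (trans (cutOf-old _ k<) (L.InM⇒ m))

    InM↓ : ∀ {k b} → k < length N → InM N' k b → InM N k b
    InM↓ {k} {b} k< m = L.⇒InM k< (trans (sym (cutOf-old _ k<)) (L'.InM⇒ m))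

    InM-ok : ∀ {k b} → InM N k b → ok (cnd b)
    InM-ok {k} {b} m = subst (λ b → ok (cnd b)) (L.InM⇒ m) (okc (cut-view N (past N k) (length N) (compOf b)))
      where
      okc : ∀ {C j b} → Cut N C (length N) j b → ok (cnd b)
      okc (none _) = tt
      okc (last _ k< _ _ _) = k<

    ≪↑ : ∀ {k' k} → k < length N → k' < length N → N ⊢ k' ≪ k → N' ⊢ k' ≪ k
    ≪↑ k< k'< (p , h) = <↑ p , λ b b' m ¬m m' ¬m' →
      <↑ (h b b' (InM↓ k< m) (λ x → ¬m (InM↑ k'< x)) (InM↓ k'< m') (λ x → ¬m' (InM↑ k< x)))

    ≪↓ : ∀ {k' k} → k < length N → k' < length N → N' ⊢ k' ≪ k → N ⊢ k' ≪ k
    ≪↓ k< k'< (p , h) = proj₁ (<↓ k< p) , λ b b' m ¬m m' ¬m' →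
      proj₁ (<↓ (InM-ok m) (h b b' (InM↑ k< m) (λ x → ¬m (InM↓ k'< x)) (InM↑ k'< m') (λ x → ¬m' (InM↓ k< x))))

    sameSt↑ : ∀ {k k'} → k < length N → k' < length N → SameSt N k k' → SameSt N' k k'
    sameSt↑ k< k'< h = Sem.⇒sameSt wf'
      (≐-trans (St-old k<) (≐-trans (Sem.sameSt⇒ wf k< k'< h) (≐-sym (St-old k'<))))

    sameSt↓ : ∀ {k k'} → k < length N → k' < length N → SameSt N' k k' → SameSt N k k'
    sameSt↓ k< k'< h = Sem.⇒sameSt wf
      (≐-trans (≐-sym (St-old k<)) (≐-trans (Sem.sameSt⇒ wf' (old-< k<) (old-< k'<) h) (St-old k'<)))

    sameIp↑ : ∀ {k k'} → k < length N → k' < length N → SameIp N k k' → SameIp N' k k'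
    sameIp↑ k< k'< h = Sem.⇒sameIp wf'
      (trans (cutOf-old i k<) (trans (Sem.sameIp⇒ wf k< k'< h) (sym (cutOf-old i k'<))))

    sameIp↓ : ∀ {k k'} → k < length N → k' < length N → SameIp N' k k' → SameIp N k k'
    sameIp↓ k< k'< h = Sem.⇒sameIp wf
      (trans (sym (cutOf-old i k<)) (trans (Sem.sameIp⇒ wf' (old-< k<) (old-< k'<) h) (cutOf-old i k'<)))

    iEvent↑ : ∀ {k} → IsIEvent N k → IsIEvent N' k
    iEvent↑ p = participates⇒iEvent (participates↑ (iEvent⇒participates p))

    iEvent↓ : ∀ {k} → k < length N → IsIEvent N' k → IsIEvent N k
    iEvent↓ k< p = participates⇒iEvent (participates↓ k< (iEvent⇒participates p))

    module Cands (co co' : CoSet) (agree : ∀ x → x ≢ length N → co' x ≡ co x) where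

      con↑ : ∀ {x k} → k < length N → InCon N N co x k → InCon N' N' co' x k
      con↑ k< (x< , ix , cx , c) = old-< x< , iEvent↑ ix , trans (agree _ (<⇒≢ x<)) cx , conc↑ x< k< c

      con↓ : ∀ {x k} → x < length N → InCon N' N' co' x k → InCon N N co x k
      con↓ x< (_ , ix , cx , c) = x< , iEvent↓ x< ix , trans (sym (agree _ (<⇒≢ x<))) cx , conc↓ c

      -- An old event never becomes a candidate: the companion lies in its causal past, hence is old
      -- too, and the inclusion of Con restricts to old events.
      cand↓ : ∀ {k} → k < length N → IsCand N' N' co' k → IsCand N N co k
      cand↓ {k} k< (_ , ¬i , k' , k'< , ll , st , ip , con) =
        <-nth N k k< , (λ p → ¬i (iEvent↑ p)) , k' , k'<L , ≪↓ k< k'<L ll , sameSt↓ k< k'<L st , sameIp↓ k< k'<L ip ,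
        λ x c → con↓ (proj₁ c) (con x (con↑ k< c))
        where k'<L = <-trans (≺⇒< (L'.<ₙ⇒≺ (proj₁ ll))) k<

      -- Only the new event can spoil the inclusion of Con, and only as an i-event outside `co`; the
      -- hypothesis on `length N` excludes this.
      cand↑ : ∀ {k} → k < length N → (IsIEvent N' (length N) → co' (length N) ≢ nothing) →
              IsCand N N co k → IsCand N' N' co' k
      cand↑ {k} k< new (_ , ¬i , k' , k'< , ll , st , ip , con) =
        <-nth N' k (old-< k<) , (λ p → ¬i (iEvent↓ k< p)) , k' , old-< k'< , ≪↑ k< k'< ll , sameSt↑ k< k'< st , sameIp↑ k< k'< ip ,
        con'
        where
        con' : ∀ x → InCon N' N' co' x k → InCon N' N' co' x k'
        con' x c@(x< , ix , cx , _) with split x<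
        ... | inj₁ x<L = con↑ k'< (con x (con↓ x<L c))
        ... | inj₂ refl = ⊥-elim (new ix cx)

      -- The algorithm tests the new event with Con taken before its addition, the invariant takes
      -- Con afterwards. The step between them is that an event is not concurrent with itself.
      cand-new↑ : IsCand N N' co (length N) → IsCand N' N' co' (length N)
      cand-new↑ (ne , ¬i , k' , k'< , ll , st , ip , con) =
        ne , ¬i , k' , old-< k'< , ll , st , ip , con'
        where
        con' : ∀ x → InCon N' N' co' x (length N) → InCon N' N' co' x k'
        con' x (x< , ix , cx , c) with split x<
        ... | inj₂ refl = ⊥-elim (proj₁ c (inj₁ refl))
        ... | inj₁ x<L with con x (x<L , ix , trans (sym (agree _ (<⇒≢ x<L))) cx , c)
        ... | _ , _ , _ , c' = x< , ix , cx , c'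

      cand-new↓ : IsCand N' N' co' (length N) → IsCand N N' co (length N)
      cand-new↓ (ne , ¬i , k' , k'< , ll , st , ip , con) =
        ne , ¬i , k' , ≺⇒< (L'.<ₙ⇒≺ (proj₁ ll)) , ll , st , ip , con'
        where
        con' : ∀ x → InCon N N' co x (length N) → InCon N N' co x k'
        con' x (x< , ix , cx , c) with con x (old-< x< , ix , trans (agree _ (<⇒≢ x<)) cx , c)
        ... | _ , _ , _ , c' = x< , ix , cx , c'

  -- By `co-none`, a non-cut-off i-event is identified by its global state. In `co-just` the
  -- companion has the smaller number, which makes following companions well founded.
  record Inv (st : AState) : Set where
    private
      N = net st
    field
      bp      : IsBP N
      co-just : ∀ {k k'} → co st k ≡ just k' →
                k < length N × k' < k × Participates N k i × Participates N k' i × St[ N ] k ≐ St[ N ] k'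
      co-none : ∀ {k k'} → k' < k → Participates N k i → Participates N k' i → co st k ≡ nothing → ¬ (St[ N ] k ≐ St[ N ] k')
      -- Freeing is not decided, so membership in coc yields candidacy only up to double negation.
      coc-t   : ∀ {k} → coc st k ≡ true → k < length N × ¬ ¬ IsCand N N (co st) k
      coc-f   : ∀ {k} → k < length N → coc st k ≡ false → ¬ IsCand N N (co st) k
      succs   : ∀ {k m} → N ⊢ k ≺ m → co st k ≡ nothing × coc st k ≡ false

    wf : WellFormed N
    wf = branching⇒wellFormed bp

  inv-initial : Inv initial
  inv-initial = record
    { bp = base ; co-just = λ () ; co-none = λ { _ (_ , ()) } ; coc-t = λ () ; coc-f = λ ()
    ; succs = λ { (_ , _ , (_ , _ , _ , ())) } }

  module StepInv {st : AState} (inv : Inv st) (e : Event) (el : Eligible st e) where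
    open Inv inv
    N = net st
    open Ext N e
    wf' : WellFormed N'
    wf' = wf-extend wf (proj₁ el)
    open Stab N e wf wf'

    -- What the three kinds of step share. On old events `co` is unchanged and `coc` can only
    -- shrink, so `succs` survives there; for the causes of the new event it is the eligibility
    -- condition.
    build : ∀ co' coc' →
      (∀ x → x ≢ length N → co' x ≡ co st x) →
      (∀ x → x ≢ length N → coc' x ≡ true → coc st x ≡ true) →
      (∀ {k'} → co' (length N) ≡ just k' → IsCutoffWith N e k') →
      (co' (length N) ≡ nothing → ¬ IsCutoff N e) →
      (∀ {k} → coc' k ≡ true → k < length N' × ¬ ¬ IsCand N' N' co' k) →
      (∀ {k} → k < length N' → coc' k ≡ false → ¬ IsCand N' N' co' k) →
      Inv ⟨ N' , co' , coc' ⟩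
    build co' coc' agree low newj newn cT cF = record
      { bp = extend bp (proj₁ el) ; co-just = cj ; co-none = cn ; coc-t = cT ; coc-f = cF ; succs = sc }
      where
      cj : ∀ {k k'} → co' k ≡ just k' →
           k < length N' × k' < k × Participates N' k i × Participates N' k' i × St[ N' ] k ≐ St[ N' ] k'
      cj {k} {k'} eq with k ≟ length N
      ... | no k≢ = let k< , k'<k , jk , jk' , s = co-just (trans (sym (agree k k≢)) eq) in
            old-< k< , k'<k , participates↑ jk , participates↑ jk'
          , ≐-trans (St-old k<) (≐-trans s (≐-sym (St-old (<-trans k'<k k<))))
      ... | yes refl = let ie , k'< , ie' , s = newj eq in
            new-< , k'< , iEvent⇒participates ie , participates↑ (iEvent⇒participates ie') , Sem.sameSt⇒ wf' new-< (old-< k'<) s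
      cn : ∀ {k k'} → k' < k → Participates N' k i → Participates N' k' i → co' k ≡ nothing → ¬ (St[ N' ] k ≐ St[ N' ] k')
      cn {k} {k'} k'<k jk jk' eq s with split (participates-< jk)
      ... | inj₁ k< = co-none k'<k (participates↓ k< jk) (participates↓ (<-trans k'<k k<) jk') (trans (sym (agree k (<⇒≢ k<))) eq)
                        (≐-trans (≐-sym (St-old k<)) (≐-trans s (St-old (<-trans k'<k k<))))
      ... | inj₂ refl = newn eq (k' , participates⇒iEvent jk , k'<k , participates⇒iEvent (participates↓ k'<k jk') , Sem.⇒sameSt wf' s)
      sc : ∀ {k m} → N' ⊢ k ≺ m → co' k ≡ nothing × coc' k ≡ false
      sc {k} {m} p@(_ , _ , (_ , j , _ , eq)) with split (partAt-< N' m j eq)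
      ... | inj₁ m< = lift (<-trans (≺⇒< p) m<) (succs (≺↓ m< p))
        where
        lift : k < length N → co st k ≡ nothing × coc st k ≡ false → co' k ≡ nothing × coc' k ≡ false
        lift k< (a , b) = trans (agree k (<⇒≢ k<)) a ,
          bool-≡ (λ t → trans (sym b) (low k (<⇒≢ k<) t)) (λ ())
      ... | inj₂ refl with proj₂ el k (L'.≺⇒<ₙ p)
      ...   | a , b = trans (agree k (<⇒≢ (≺⇒< p))) a ,
          bool-≡ (λ t → trans (sym b) (low k (<⇒≢ (≺⇒< p)) t)) (λ ())

    co-new : co st (length N) ≡ nothing
    co-new with co st (length N) in eq
    ... | nothing = refl
    ... | just k' = ⊥-elim (<-irrefl refl (proj₁ (co-just eq)))

    cutoff-step : ∀ {co' coc' k'} → IsCutoffWith N e k' → co' (length N) ≡ just k' →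
      (∀ x → x ≢ length N → co' x ≡ co st x) → (∀ x → coc' x ≡ coc st x) → Inv ⟨ N' , co' , coc' ⟩
    cutoff-step {co'} {coc'} {k'} cw eq agree same = build co' coc' agree (λ x _ t → trans (sym (same x)) t)
      (λ eq' → subst (IsCutoffWith N e) (just-injective (trans (sym eq) eq')) cw)
      (λ eq' → case trans (sym eq) eq' of λ ())
      (λ {k} t → let k< , c = coc-t (trans (sym (same k)) t) in
         old-< k< , λ ¬c → c λ x → ¬c (cand↑ k< (λ _ eq' → case trans (sym eq) eq' of λ ()) x))
      cF
      where
      open Cands (co st) co' agree
      cF : ∀ {k} → k < length N' → coc' k ≡ false → ¬ IsCand N' N' co' k
      cF {k} k< f c with split k<
      ... | inj₁ k<L = coc-f k<L (trans (sym (same k)) f) (cand↓ k<L c)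
      ... | inj₂ refl = proj₁ (proj₂ c) (proj₁ cw)

    cand-step : ∀ {co' coc'} → ¬ IsCutoff N e → IsCand N N' (co st) (length N) →
      (∀ x → co' x ≡ co st x) → coc' (length N) ≡ true → (∀ x → x ≢ length N → coc' x ≡ coc st x) →
      Inv ⟨ N' , co' , coc' ⟩
    cand-step {co'} {coc'} ¬cut cand same t agree = build co' coc' (λ x _ → same x)
      (λ x x≢ t' → trans (sym (agree x x≢)) t')
      (λ eq → case trans (sym eq) (trans (same _) co-new) of λ ())
      (λ _ → ¬cut) cT cF
      where
      open Cands (co st) co' (λ x _ → same x)
      cT : ∀ {k} → coc' k ≡ true → k < length N' × ¬ ¬ IsCand N' N' co' k
      cT {k} t' with k ≟ length N
      ... | yes refl = new-< , λ ¬c → ¬c (cand-new↑ cand)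
      ... | no k≢ = let k< , c = coc-t (trans (sym (agree k k≢)) t') in
          old-< k< , λ ¬c → c λ x → ¬c (cand↑ k< (λ ie → ⊥-elim (proj₁ (proj₂ cand) ie)) x)
      cF : ∀ {k} → k < length N' → coc' k ≡ false → ¬ IsCand N' N' co' k
      cF {k} k< f c with split k<
      ... | inj₁ k<L = coc-f k<L (trans (sym (agree k (<⇒≢ k<L))) f) (cand↓ k<L c)
      ... | inj₂ refl = case trans (sym t) f of λ ()

    plain-step : ∀ {co' coc'} → ¬ IsCutoff N e → ¬ IsCand N N' (co st) (length N) →
      (∀ x → co' x ≡ co st x) →
      (∀ x → (coc' x ≡ true) ⇔ ((coc st x ≡ true) × ¬ Frees N (co st) e x)) →
      Inv ⟨ N' , co' , coc' ⟩
    plain-step {co'} {coc'} ¬cut ¬cand same iff = build co' coc' (λ x _ → same x)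
      (λ x _ t → proj₁ (proj₁ (iff x) t))
      (λ eq → case trans (sym eq) (trans (same _) co-new) of λ ())
      (λ _ → ¬cut) cT cF
      where
      module Cs = Cands (co st) co' (λ x _ → same x)
      recast : ∀ {k co₁ co₂} → (∀ x → co₂ x ≡ co₁ x) → IsCand N' N' co₁ k → IsCand N' N' co₂ k
      recast eq (ne , ¬i , k' , k'< , ll , s , ip , con) = ne , ¬i , k' , k'< , ll , s , ip ,
        λ x (a , b , c , d) → let a' , b' , c' , d' = con x (a , b , trans (sym (eq x)) c , d)
                              in a' , b' , trans (eq x) c' , d'
      cT : ∀ {k} → coc' k ≡ true → k < length N' × ¬ ¬ IsCand N' N' co' k
      -- Not being freed excludes being a candidate before and a non-candidate now. Candidacy
      -- before, known up to double negation, thus passes on up to double negation.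
      cT {k} t = let t' , ¬fr = proj₁ (iff k) t ; k< , c = coc-t t' in
        old-< k< , λ ¬c → c λ x → ¬fr (x , λ y → ¬c (recast same y))
      cF : ∀ {k} → k < length N' → coc' k ≡ false → ¬ IsCand N' N' co' k
      cF {k} k< f c with split k<
      ... | inj₂ refl = ¬cand (Cs.cand-new↓ c)
      ... | inj₁ k<L with coc st k in ck
      ...   | false = coc-f k<L ck (Cs.cand↓ k<L c)
      ...   | true = case trans (sym f) (proj₂ (iff k) (ck , λ (_ , ¬c) → ¬c (recast (λ x → sym (same x)) c))) of λ ()

  inv-step : ∀ {st st'} → Inv st → AlgStep st st' → Inv st'
  inv-step {st' = ⟨ _ , co' , coc' ⟩} inv (e , el , refl , inj₁ (k' , cw , eq , agree , same)) =
    StepInv.cutoff-step inv e el {co'} cw eq agree same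
  inv-step {st' = ⟨ _ , co' , coc' ⟩} inv (e , el , refl , inj₂ (inj₁ (¬cut , cand , same , t , agree))) =
    StepInv.cand-step inv e el {co'} {coc'} ¬cut cand same t agree
  inv-step {st' = ⟨ _ , co' , coc' ⟩} inv (e , el , refl , inj₂ (inj₂ (¬cut , ¬cand , same , iff))) =
    StepInv.plain-step inv e el {co'} {coc'} ¬cut ¬cand same iff

  inv-star : ∀ {st st'} → Inv st → Star AlgStep st st' → Inv st'
  inv-star inv ε = inv
  inv-star inv (s ◅ ss) = inv-star (inv-step inv s) ss

  -- Silent runs and soundness

  SilentRun : ℕ → GState → GState → Set
  SilentRun zero    g h = g ≐ h
  SilentRun (suc m) g h = Σ ℕ λ a → Σ GState λ g' → a ∉ Σi × GStep g a g' × SilentRun m g' h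

  gstep-resp : ∀ {g g' a h h'} → g ≐ g' → h ≐ h' → GStep g a h → GStep g' a h'
  gstep-resp {g} {g'} {a} {h} {h'} p q (f , ex) = (λ j →
      (λ a∈ → trans (cong (λ s → tr (A j) s (h' j)) (sym (p j)))
             (trans (cong (tr (A j) (g j)) (sym (q j))) (proj₁ (f j) a∈)))
    , (λ a∉ → trans (sym (q j)) (trans (proj₂ (f j) a∉) (p j)))) , ex

  silent-respˡ : ∀ m {g g' h} → g ≐ g' → SilentRun m g h → SilentRun m g' h
  silent-respˡ zero p r = ≐-trans (≐-sym p) r
  silent-respˡ (suc m) p (a , x , a∉ , s , r) = a , x , a∉ , gstep-resp p (λ _ → refl) s , r

  silent-respʳ : ∀ m {g h h'} → h ≐ h' → SilentRun m g h → SilentRun m g h'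
  silent-respʳ zero p r = ≐-trans r p
  silent-respʳ (suc m) p (a , x , a∉ , s , r) = a , x , a∉ , s , silent-respʳ m p r

  silent-append : ∀ m {m' g h k} → SilentRun m g h → SilentRun m' h k → SilentRun (m + m') g k
  silent-append zero {m'} p r = silent-respˡ m' (≐-sym p) r
  silent-append (suc m) (a , x , a∉ , s , r) r' = a , x , a∉ , s , silent-append m r r'

  silent-snoc : ∀ m {g h a k} → SilentRun m g h → a ∉ Σi → GStep h a k → SilentRun (suc m) g k
  silent-snoc zero {h = h} {a} {k} p a∉ s = a , k , a∉ , gstep-resp (≐-sym p) (λ _ → refl) s , λ _ → refl
  silent-snoc (suc m) (a , x , a∉ , s , r) b∉ s' = a , x , a∉ , s , silent-snoc m r b∉ s'

  bump : Bool → ℕ → ℕ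
  bump true  c = suc c
  bump false c = c

  count : EventSet → ℕ → ℕ
  count C zero    = 0
  count C (suc m) = bump (C m) (count C m)

  _∖_ : EventSet → EventSet → EventSet
  (C ∖ D) k = C k ∧ not (D k)

  _∪_ : EventSet → EventSet → EventSet
  (C ∪ D) k = C k ∨ D k

  ∖⇒ : ∀ C D k → (C ∖ D) k ≡ true → C k ≡ true × D k ≡ false
  ∖⇒ C D k e with C k | D k
  ... | true | false = refl , refl

  ⇒∖ : ∀ C D k → C k ≡ true → D k ≡ false → (C ∖ D) k ≡ true
  ⇒∖ C D k p q rewrite p | q = refl

  ∖-false : ∀ C D k → C k ≡ true → (C ∖ D) k ≡ false → D k ≡ true
  ∖-false C D k p q with C k | D k
  ∖-false C D k p q | true | true = refl

  ∪⇒ : ∀ C D k → (C ∪ D) k ≡ true → C k ≡ true ⊎ D k ≡ true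
  ∪⇒ C D k e with C k
  ... | true = inj₁ refl
  ... | false = inj₂ e

  ∪-l : ∀ C D k → C k ≡ true → (C ∪ D) k ≡ true
  ∪-l C D k p rewrite p = refl

  ∪-r : ∀ C D k → D k ≡ true → (C ∪ D) k ≡ true
  ∪-r C D k p with C k
  ... | true = refl
  ... | false = p

  true⇒≢false : ∀ {x : Bool} → x ≡ true → x ≢ false
  true⇒≢false refl ()

  ≢true⇒false : ∀ {x : Bool} → x ≢ true → x ≡ false
  ≢true⇒false {true} h = ⊥-elim (h refl)
  ≢true⇒false {false} h = refl

  stateOf-cong : ∀ {N C C'} → (∀ k → C k ≡ C' k) → stateOf N C ≐ stateOf N C'
  stateOf-cong {N} eq j = cong (labelAt N j) (cut-cong (length N) j λ k _ _ → eq k)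

  pastOf : Net → CId → EventSet
  pastOf N (ini _)   = ∅
  pastOf N (out k _) = past N k

  stateAfter : Net → CId → GState
  stateAfter N c = stateOf N (pastOf N c)

  Segment : GState → ℕ → GState → Set
  Segment g a h = Σ ℕ λ m → Σ GState λ s → SilentRun m g s × GStep s a h

  ginit-stateAfter : ∀ N → ginit ≐ stateAfter N (ini i)
  ginit-stateAfter N j rewrite cut-∅ N (length N) j = refl

  -- Global runs obtained by firing the difference of two configurations

  module Runs {N : Net} (wf : WellFormed N) where
    open WellFormed wf
    open Core wf
    open Link wf

    module _ {C D : EventSet} (c : Config N C) (d : Config N D) (D⊆C : D ⊆ₑ C) where

      grow : ℕ → EventSet
      grow m = D ∪ upto C m

      -- `D` may contain events numbered above `m`. One that shared a component with `m` would have
      -- `m` among its causes, and then `m` would belong to `D`.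
      grow-fireable : ∀ m → (C ∖ D) m ≡ true → Fireable N (grow m) m
      grow-fireable m e = m< , λ j b s' eq →
        trans (cut-later (<⇒≤ m<) (later j eq)) (trans (cut-cong m j λ k k<m _ → same k k<m) (proj₂ (c m Cm) j b s' eq))
        where
        Cm = proj₁ (∖⇒ C D m e)
        Dm = proj₂ (∖⇒ C D m e)
        m< = proj₁ (c m Cm)
        same : ∀ k → k < m → grow m k ≡ C k
        same k k<m = bool-≡ to λ Ck → ∪-r D (upto C m) k (⇒upto {C} Ck k<m)
          where
          to : grow m k ≡ true → C k ≡ true
          to g with ∪⇒ D (upto C m) k g
          ... | inj₁ Dk = D⊆C k Dk
          ... | inj₂ u = proj₁ (upto⇒ C m k u)
        later : ∀ j {p} → partAt N m j ≡ just p → ∀ k → m ≤ k → k < length N → grow m k ≡ true → ¬ Participates N k j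
        later j eq k m≤k _ g jk with ∪⇒ D (upto C m) k g
        ... | inj₂ u = <⇒≱ (proj₂ (upto⇒ C m k u)) m≤k
        ... | inj₁ Dk with m≤n⇒m<n∨m≡n m≤k
        ...   | inj₂ refl = true⇒≢false Dk Dm
        ...   | inj₁ m<k = true⇒≢false (down-≼ (config-down d) (≺⇒≼ (≺-same-comp c k m<k Cm (D⊆C k Dk) (_ , eq) jk)) Dk) Dm

      grow-add : ∀ m → (C ∖ D) m ≡ true → ∀ k → add (grow m) m k ≡ grow (suc m) k
      grow-add m e k = bool-≡ to from
        where
        Cm = proj₁ (∖⇒ C D m e)
        to : add (grow m) m k ≡ true → grow (suc m) k ≡ true
        to g with add⇒ {grow m} {m} {k} g
        ... | inj₂ refl = ∪-r D (upto C (suc m)) k (⇒upto {C} Cm ≤-refl)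
        ... | inj₁ g' with ∪⇒ D (upto C m) k g'
        ...   | inj₁ Dk = ∪-l D (upto C (suc m)) k Dk
        ...   | inj₂ u = ∪-r D (upto C (suc m)) k (trans (sym (upto-suc C m Cm k)) (add-old {upto C m} u))
        from : grow (suc m) k ≡ true → add (grow m) m k ≡ true
        from g with ∪⇒ D (upto C (suc m)) k g
        ... | inj₁ Dk = add-old {grow m} (∪-l D (upto C m) k Dk)
        ... | inj₂ u with add⇒ {upto C m} {m} {k} (trans (upto-suc C m Cm k) u)
        ...   | inj₁ u' = add-old {grow m} (∪-r D (upto C m) k u')
        ...   | inj₂ refl = add-new (grow m) m

      grow-same : ∀ m → (C ∖ D) m ≡ false → ∀ k → grow m k ≡ grow (suc m) k
      grow-same m e k = bool-≡ to from
        where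
        to : grow m k ≡ true → grow (suc m) k ≡ true
        to g with ∪⇒ D (upto C m) k g
        ... | inj₁ Dk = ∪-l D (upto C (suc m)) k Dk
        ... | inj₂ u = let x , y = upto⇒ C m k u in ∪-r D (upto C (suc m)) k (⇒upto {C} x (m<n⇒m<1+n y))
        from : grow (suc m) k ≡ true → grow m k ≡ true
        from g with ∪⇒ D (upto C (suc m)) k g
        ... | inj₁ Dk = ∪-l D (upto C m) k Dk
        ... | inj₂ u with upto⇒ C (suc m) k u
        ...   | Ck , s≤s k≤m with m≤n⇒m<n∨m≡n k≤m
        ...     | inj₁ k<m = ∪-r D (upto C m) k (⇒upto {C} Ck k<m)
        ...     | inj₂ refl = ∪-l D (upto C m) k (∖-false C D k Ck e)

      -- The length is exactly the number of events in the difference, so runs can later be compared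
      -- by counting events.
      run : (∀ k → (C ∖ D) k ≡ true → ¬ Participates N k i) → SilentRun (count (C ∖ D) (length N)) (stateOf N D) (stateOf N C)
      run noI = silent-respʳ (count (C ∖ D) (length N)) (stateOf-cong {N} all) (go (length N))
        where
        all : ∀ k → grow (length N) k ≡ C k
        all k = bool-≡ to λ Ck → ∪-r D (upto C (length N)) k (⇒upto {C} Ck (proj₁ (c k Ck)))
          where
          to : grow (length N) k ≡ true → C k ≡ true
          to g with ∪⇒ D (upto C (length N)) k g
          ... | inj₁ Dk = D⊆C k Dk
          ... | inj₂ u = proj₁ (upto⇒ C (length N) k u)
        go : ∀ m → SilentRun (count (C ∖ D) m) (stateOf N D) (stateOf N (grow m))
        go zero = stateOf-cong {N} λ k → bool-≡ (∪-l D (upto C zero) k) (from k)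
          where
          from : ∀ k → grow zero k ≡ true → D k ≡ true
          from k g with ∪⇒ D (upto C zero) k g
          ... | inj₁ Dk = Dk
          ... | inj₂ u = case proj₂ (upto⇒ C zero k u) of λ ()
        go (suc m) = extend-by _ refl
          where
          extend-by : ∀ x → (C ∖ D) m ≡ x → SilentRun (bump x (count (C ∖ D) m)) (stateOf N D) (stateOf N (grow (suc m)))
          extend-by false e = silent-respʳ (count (C ∖ D) m) (stateOf-cong {N} (grow-same m e)) (go m)
          extend-by true e = silent-respʳ (suc (count (C ∖ D) m)) (stateOf-cong {N} (grow-add m e))
            (silent-snoc (count (C ∖ D) m) (go m)
              (λ a∈ → noI m e (∈⇒participates (proj₁ (c m (proj₁ (∖⇒ C D m e)))) a∈))
              (fire-step {grow m} {m} (grow-fireable m e)))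

    pastOf-config : ∀ {c} → (∀ {k j} → c ≡ out k j → k < length N) → Config N (pastOf N c)
    pastOf-config {ini _} h = ∅-config N
    pastOf-config {out k j} h = past-config (h refl)

    -- The silent part fires the rest of the past of `k` after the past of the producer of `b`. No
    -- i-event is among it: the i-events strictly below `k` form a chain that ends with this
    -- producer, or there are none if `b` is initial.
    event-seg : ∀ {k b s'} → partAt N k i ≡ just (b , s') → Segment (stateAfter N b) (actAt N k) (stateAfter N (out k i))
    event-seg {k} {b} {s'} eq = _ , stateOf N C , run {C} {D} c d D⊆C noI ,
      gstep-resp (λ _ → refl) (stateOf-cong {N} whole) (fire-step {C} {k} (upto-fireable pc (⇒past ε)))
      where
      k< = partAt-< N k i eq
      pc = past-config k<
      C = upto (past N k) k
      D = pastOf N b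
      c = upto-config k pc
      b-dp : ∀ {x j} → b ≡ out x j → DirectCause N x k
      b-dp refl = consumes⇒cause (i , s' , eq)
      d : Config N D
      d = pastOf-config λ b≡ → <-trans (DirectCause.cause-< (b-dp b≡)) k<
      whole : ∀ m → add C k m ≡ past N k m
      whole m = trans (upto-suc (past N k) k (⇒past ε) m)
        (bool-≡ (λ u → proj₁ (upto⇒ (past N k) (suc k) m u)) (λ p → ⇒upto {past N k} p (s≤s (≼⇒≤ (past⇒ p)))))
      in-b : ∀ m x j → b ≡ out x j → N ⊢ m ≼ x → D m ≡ true
      in-b m x j refl p = ⇒past p
      D⊆C : D ⊆ₑ C
      D⊆C m Dm = go b refl Dm
        where
        go : ∀ b' → b ≡ b' → pastOf N b' m ≡ true → C m ≡ true
        go (out x j) b≡ e = ⇒upto {past N k} (⇒past (past⇒ e ◅◅ (b-dp b≡ ◅ ε)))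
                              (≤-<-trans (≼⇒≤ (past⇒ e)) (DirectCause.cause-< (b-dp b≡)))
      noI : ∀ m → (C ∖ D) m ≡ true → ¬ Participates N m i
      noI m e jm with ∖⇒ C D m e
      ... | Cm , Dm with upto⇒ (past N k) k m Cm
      ... | pm , m<k with cut-≥ {N} {past N k} {k} {i} m<k pm jm
      ... | x , cx , m≤x , x<k , px , jx with trans (sym (proj₂ (pc k (⇒past ε)) i b s' eq)) cx
      ... | b≡ with m≤n⇒m<n∨m≡n m≤x
      ...   | inj₁ m<x = true⇒≢false (in-b m x i b≡ (≺⇒≼ (≺-same-comp pc x m<x pm px jm jx))) Dm
      ...   | inj₂ refl = true⇒≢false (in-b m x i b≡ ε) Dm

  path-resp : ∀ {g h w} → g ≐ h → Path Global g w → Path Global h w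
  path-resp p [] = []
  path-resp p (s ∷ ss) = gstep-resp p (λ _ → refl) s ∷ ss

  silent-path : ∀ m {g h v} → SilentRun m g h → Path Global h v → ∃[ u ] (Path Global g u × proj u ≡ proj v)
  silent-path zero p q = _ , path-resp (≐-sym p) q , refl
  silent-path (suc m) (a , x , a∉ , s , r) q =
    let u , p , e = silent-path m r q in a ∷ u , s ∷ p , trans (filter-reject (_∈? Σi) a∉) e

  seg-path : ∀ {g a h v} → a ∈ Σi → Segment g a h → Path Global h v → ∃[ u ] (Path Global g u × proj u ≡ a ∷ proj v)
  seg-path a∈ (m , s , r , st) q =
    let u , p , e = silent-path m r (st ∷ q) in u , p , trans e (filter-accept (_∈? Σi) a∈)

  seg-respˡ : ∀ {g g' a h} → g ≐ g' → Segment g a h → Segment g' a h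
  seg-respˡ p (m , s , r , st) = m , s , silent-respˡ m p r , st

  seg-respʳ : ∀ {g a h h'} → h ≐ h' → Segment g a h → Segment g a h'
  seg-respʳ p (m , s , r , st) = m , s , r , gstep-resp (λ _ → refl) p st

  mono-steps : ∀ (f : ℕ → ℕ) → (∀ k → f k < f (suc k)) → ∀ {k l} → k < l → f k < f l
  mono-steps f h {k} {suc l} (s≤s k≤l) with m≤n⇒m<n∨m≡n k≤l
  ... | inj₁ k<l = <-trans (mono-steps f h k<l) (h l)
  ... | inj₂ refl = h k

  -- The infinite run must be a function of time although the lengths of the segments are arbitrary.
  -- A machine that carries the rest of the current segment yields one step at a time, so the
  -- segment belonging to a given time is never searched for.
  module Concat (G : ℕ → GState) (w : ℕ → ℕ) (w∈ : ∀ k → w k ∈ Σi)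
                (segs : ∀ k → Segment (G k) (w k) (G (suc k))) where

    record Mach : Set where
      constructor mach
      field
        idx  : ℕ
        cur  : GState
        rem  : ℕ
        goal : GState
        way  : SilentRun rem cur goal
        fin  : GStep goal (w idx) (G (suc idx))
    open Mach

    begin : ℕ → Mach
    begin k = let m , s , r , st = segs k in mach k (G k) m s r st

    action : Mach → ℕ
    action (mach k _ zero _ _ _) = w k
    action (mach k _ (suc _) _ (a , _) _) = a

    next : Mach → Mach
    next (mach k _ zero _ _ _) = begin (suc k)
    next (mach k _ (suc m) s (_ , g , _ , _ , r) st) = mach k g m s r st

    next-step : ∀ x → GStep (cur x) (action x) (cur (next x))
    next-step (mach k _ zero _ p st) = gstep-resp (≐-sym p) (λ _ → refl) st
    next-step (mach k _ (suc m) s (_ , g , _ , x , r) st) = x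

    at : ℕ → Mach
    at zero    = begin 0
    at (suc t) = next (at t)

    pos : ℕ → ℕ
    pos zero    = proj₁ (segs 0)
    pos (suc k) = suc (pos k) + proj₁ (segs (suc k))

    pos-< : ∀ k → pos k < pos (suc k)
    pos-< k = m≤m+n (suc (pos k)) _

    -- `pos k` is the time of the action `w k`. The machine is `rem x` steps before the action of
    -- its segment, and the preceding action is already over; together these determine `idx` at time
    -- `pos k`.
    Timed : ℕ → Mach → Set
    Timed t x = t + rem x ≡ pos (idx x) × (∀ {k} → idx x ≡ suc k → pos k < t)

    timed-next : ∀ {t} x → Timed t x → Timed (suc t) (next x)
    timed-next {t} (mach k _ zero _ _ _) (e , f) =
      cong (λ z → suc z + _) t≡ , λ { refl → subst (_< suc t) t≡ ≤-refl }
      where t≡ = trans (sym (+-identityʳ t)) e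
    timed-next {t} (mach k _ (suc m) s (_ , g , _ , x , r) st) (e , f) =
      trans (sym (+-suc t m)) e , λ q → m<n⇒m<1+n (f q)

    timed : ∀ t → Timed t (at t)
    timed zero = refl , λ ()
    timed (suc t) = timed-next (at t) (timed t)

    action-∈ : ∀ x → action x ∈ Σi → rem x ≡ 0
    action-∈ (mach _ _ zero _ _ _) _ = refl
    action-∈ (mach _ _ (suc _) _ (_ , _ , a∉ , _) _) a∈ = ⊥-elim (a∉ a∈)

    action-0 : ∀ x → rem x ≡ 0 → action x ≡ w (idx x)
    action-0 (mach _ _ zero _ _ _) _ = refl

    idx-pos : ∀ k → idx (at (pos k)) ≡ k
    idx-pos k with idx (at (pos k)) in e | timed (pos k)
    ... | l | eq , f = ≤-antisym (lower l refl) (≮⇒≥ λ l<k → <⇒≱ (mono-steps pos pos-< l<k)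
                         (subst (pos k ≤_) (trans eq refl) (m≤m+n _ _)))
      where
      lower : ∀ l' → l ≡ l' → l' ≤ k
      lower zero _ = z≤n
      lower (suc l') l≡ = ≰⇒> λ k≤l' → <⇒≱ (f l≡) (pos-≤ k≤l')
        where
        pos-≤ : ∀ {a b} → a ≤ b → pos a ≤ pos b
        pos-≤ a≤b with m≤n⇒m<n∨m≡n a≤b
        ... | inj₁ a<b = <⇒≤ (mono-steps pos pos-< a<b)
        ... | inj₂ refl = ≤-refl

    rem-pos : ∀ k → rem (at (pos k)) ≡ 0
    rem-pos k = +-cancelˡ-≡ (pos k) _ _
      (trans (proj₁ (timed (pos k))) (trans (cong pos (idx-pos k)) (sym (+-identityʳ _))))

    word : ℕ → ℕ
    word t = action (at t)

    word-pos : ∀ k → word (pos k) ≡ w k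
    word-pos k = trans (action-0 (at (pos k)) (rem-pos k)) (cong w (idx-pos k))

    concat-proj : InfProjOfInf word w
    concat-proj = pos , pos-< , (λ k → subst (_∈ Σi) (sym (word-pos k)) (w∈ k) , word-pos k) ,
      λ t a∈ → idx (at t) , trans (sym (proj₁ (timed t)))
        (trans (cong (t +_) (action-∈ (at t) a∈)) (+-identityʳ t))

    concat-run : ∀ t → GStep (cur (at t)) (word t) (cur (at (suc t)))
    concat-run t = next-step (at t)

  module Sound {st : AState} (inv : Inv st) where
    open Inv inv
    N = net st
    open Core wf
    open Link wf
    open Runs wf

    F : TS
    F = Folding N (co st)

    gen-stateAfter : ∀ {b b'} → Gen N (co st) b b' → stateAfter N b ≐ stateAfter N b'
    gen-stateAfter (k , k' , eq , m , m') with co-just eq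
    ... | k< , k'< , jk , jk' , s
      rewrite trans (IsMj⇒ m) (cutOf-own jk) | trans (IsMj⇒ m') (cutOf-own jk') = s

    ≈-stateAfter : ∀ {b b'} → (N , co st) ⊢ b ≈ b' → stateAfter N b ≐ stateAfter N b'
    ≈-stateAfter ε j = refl
    ≈-stateAfter (fwd g ◅ p) = ≐-trans (gen-stateAfter g) (≈-stateAfter p)
    ≈-stateAfter (bwd g ◅ p) = ≐-trans (≐-sym (gen-stateAfter g)) (≈-stateAfter p)

    fold-seg : ∀ {C a C'} → step F C a C' → a ∈ Σi × Segment (stateAfter N C) a (stateAfter N C')
    fold-seg (k , e , b , s' , ne , pe , refl , p , q) =
      subst (_∈ Σi) (cong actOf ne) (participates⇒∈ (_ , eq)) ,
      seg-respˡ (≐-sym (≈-stateAfter p)) (seg-respʳ (≈-stateAfter q)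
        (subst (λ a → Segment (stateAfter N b) a (stateAfter N (out k i))) (cong actOf ne) (event-seg eq)))
      where
      eq : partAt N k i ≡ just (b , s')
      eq = trans (nth-partAt N k i ne) pe

    fin-sound′ : ∀ {C w g} → g ≐ stateAfter N C → Path F C w → ∃[ u ] (Path Global g u × proj u ≡ w)
    fin-sound′ eq [] = [] , [] , refl
    fin-sound′ {C} {w} {g} eq (_∷_ {a = a} {s' = C'} s ss) with fin-sound′ {g = stateAfter N C'} (λ _ → refl) ss
    ... | u , p , e with fold-seg s
    ... | a∈ , sg with seg-path a∈ (seg-respˡ (≐-sym eq) sg) p
    ... | u' , p' , e' = u' , p' , trans e' (cong (a ∷_) e)

    fin-sound : ∀ {w} → FinTrace F w → FinInProj w
    fin-sound p = inj₁ (fin-sound′ (ginit-stateAfter N) p)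

    inf-sound : ∀ {w} → InfTrace F w → InfInProj w
    inf-sound {w} (f , f0 , steps) = C.word , ((λ t → Cc.cur (C.at t)) , refl , C.concat-run) , C.concat-proj
      where
      G : ℕ → GState
      -- `InfTrace` asks for `ginit` itself, while the state after the empty past is only pointwise
      -- equal to it.
      G zero    = ginit
      G (suc k) = stateAfter N (f (suc k))
      segs : ∀ k → Segment (G k) (w k) (G (suc k))
      segs zero = seg-respˡ (≐-trans (subst (λ c → stateAfter N c ≐ stateAfter N (ini i)) (sym f0) (λ _ → refl)) (≐-sym (ginit-stateAfter N)))
                    (proj₂ (fold-seg (steps 0)))
      segs (suc k) = proj₂ (fold-seg (steps (suc k)))
      module C = Concat G w (λ k → proj₁ (fold-seg (steps k))) segs
      module Cc = C.Mach

  -- Completeness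

  -- The number of choice functions, in particular of global states. Coding them by `Fin` makes them
  -- searchable and subject to the pigeonhole principle; decoding returns the function up to
  -- pointwise equality.
  ∏ : ∀ {m} → (Fin m → ℕ) → ℕ
  ∏ {zero}  f = 1
  ∏ {suc m} f = f Fin.zero * ∏ (f ∘ Fin.suc)

  encode : ∀ {m} (f : Fin m → ℕ) → (∀ j → Fin (f j)) → Fin (∏ f)
  encode {zero}  f g = Fin.zero
  encode {suc m} f g = combine (g Fin.zero) (encode (f ∘ Fin.suc) (g ∘ Fin.suc))

  decode : ∀ {m} (f : Fin m → ℕ) → Fin (∏ f) → ∀ j → Fin (f j)
  decode {suc m} f c Fin.zero    = proj₁ (remQuot (∏ (f ∘ Fin.suc)) c)
  decode {suc m} f c (Fin.suc j) = decode (f ∘ Fin.suc) (proj₂ (remQuot {f Fin.zero} (∏ (f ∘ Fin.suc)) c)) j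

  decode-encode : ∀ {m} (f : Fin m → ℕ) g j → decode f (encode f g) j ≡ g j
  decode-encode {suc m} f g Fin.zero = cong proj₁ (Fin.remQuot-combine (g Fin.zero) (encode (f ∘ Fin.suc) (g ∘ Fin.suc)))
  decode-encode {suc m} f g (Fin.suc j) = trans
    (cong (λ c → decode (f ∘ Fin.suc) (proj₂ c) j) (Fin.remQuot-combine (g Fin.zero) (encode (f ∘ Fin.suc) (g ∘ Fin.suc))))
    (decode-encode (f ∘ Fin.suc) (g ∘ Fin.suc) j)

  gstep? : ∀ g a h → Dec (GStep g a h)
  gstep? g a h = Fin.all? (λ j →
      ((a ∈? acts (A j)) →-dec maybe-≡-dec _≟_ (tr (A j) (g j) (h j)) (just a))
      ×-dec (¬? (a ∈? acts (A j)) →-dec (h j Fin.≟ g j)))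
    ×-dec Fin.any? (λ j → a ∈? acts (A j))

  sizes : Fin n → ℕ
  sizes j = size (A j)

  -- The search is finite: the action of a global step belongs to some component, and the successor
  -- state has a code. This decision later removes the double negation on candidacy.
  silentRun? : ∀ m g h → Dec (SilentRun m g h)
  silentRun? zero g h = Fin.all? λ j → g j Fin.≟ h j
  silentRun? (suc m) g h = map′ to from (Fin.any? λ j → Any.any? (λ a → Fin.any? λ c →
      ¬? (a ∈? Σi) ×-dec gstep? g a (decode sizes c) ×-dec silentRun? m (decode sizes c) h) (acts (A j)))
    where
    Q : ℕ → Set
    Q a = ∃[ c ] (a ∉ Σi × GStep g a (decode sizes c) × SilentRun m (decode sizes c) h)
    to : (∃[ j ] Any Q (acts (A j))) → SilentRun (suc m) g h
    to (j , p) with Any.satisfied p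
    ... | a , c , a∉ , s , r = a , decode sizes c , a∉ , s , r
    from : SilentRun (suc m) g h → ∃[ j ] Any Q (acts (A j))
    from (a , g' , a∉ , s , r) = proj₁ (proj₂ s) , Mem.lose (proj₂ (proj₂ s))
      (encode sizes g' , a∉ , gstep-resp (λ _ → refl) (λ j → sym (decode-encode sizes g' j)) s
       , silent-respˡ m (λ j → sym (decode-encode sizes g' j)) r)

  -- Counting events

  bump-≤ : ∀ x c → bump x c ≤ suc c
  bump-≤ true  c = ≤-refl
  bump-≤ false c = n≤1+n c

  ≤-bump : ∀ x c → c ≤ bump x c
  ≤-bump true  c = n≤1+n c
  ≤-bump false c = ≤-refl

  bump-mono : ∀ x {c d} → c ≤ suc d → bump x c ≤ suc (bump x d)
  bump-mono true  p = s≤s p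
  bump-mono false p = p

  count-cong : ∀ {X Y} m → (∀ k → k < m → X k ≡ Y k) → count X m ≡ count Y m
  count-cong zero h = refl
  count-cong {X} {Y} (suc m) h rewrite h m ≤-refl | count-cong {X} {Y} m (λ k p → h k (m<n⇒m<1+n p)) = refl

  count-insert : ∀ {X Y k} m → (∀ x → x ≢ k → X x ≡ Y x) → count X m ≤ suc (count Y m)
  count-insert zero h = z≤n
  count-insert {X} {Y} {k} (suc m) h with m ≟ k
  ... | no m≢k rewrite h m m≢k = bump-mono (Y m) (count-insert {X} {Y} m h)
  ... | yes refl rewrite count-cong {X} {Y} m (λ x x<m → h x (<⇒≢ x<m)) =
    ≤-trans (bump-≤ (X m) _) (s≤s (≤-bump (Y m) _))

  Sub : Bool → Bool → Bool → Set
  Sub x y z = (x ≡ true → z ≡ true) × (y ≡ true → z ≡ true) × (x ≡ true → y ≡ true → ⊥)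

  bump-sub : ∀ {x y z c d e} → Sub x y z → c + d ≤ e → bump x c + bump y d ≤ bump z e
  bump-sub {true} {true} (_ , _ , h) p = ⊥-elim (h refl refl)
  bump-sub {true} {false} {z} (h , _) p rewrite h refl = s≤s p
  bump-sub {false} {true} {z} {c} {d} (_ , h , _) p rewrite h refl | +-suc c d = s≤s p
  bump-sub {false} {false} {z} {e = e} _ p = ≤-trans p (≤-bump z e)

  count-sub : ∀ {X Y Z} m → (∀ k → Sub (X k) (Y k) (Z k)) → count X m + count Y m ≤ count Z m
  count-sub zero h = z≤n
  count-sub {X} {Y} {Z} (suc m) h = bump-sub (h m) (count-sub {X} {Y} {Z} m h)

  count-sub-< : ∀ {X Y Z k} m → k < m → (∀ k → Sub (X k) (Y k) (Z k)) →
                X k ≡ false → Y k ≡ false → Z k ≡ true → count X m + count Y m < count Z m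
  count-sub-< {X} {Y} {Z} {k} (suc m) (s≤s k≤m) h x y z with m≤n⇒m<n∨m≡n k≤m
  ... | inj₁ k<m = bump-sub< (h m) (count-sub-< {X} {Y} {Z} m k<m h x y z)
    where
    bump-sub< : ∀ {x y z c d e} → Sub x y z → c + d < e → bump x c + bump y d < bump z e
    bump-sub< {x} {y} {z} {c} {d} {e} s p = ≤-trans (≤-reflexive (sym (bump-suc x))) (bump-sub {x} {y} {z} {suc c} {d} {e} s p)
      where
      bump-suc : ∀ x → bump x (suc c) + bump y d ≡ suc (bump x c + bump y d)
      bump-suc true = refl
      bump-suc false = refl
  ... | inj₂ refl rewrite x | y | z = s≤s (count-sub {X} {Y} {Z} m h)

  -- Replaying global runs in the final net

  module Complete {st : AState} (inv : Inv st) (fin : Final st) where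
    open Inv inv
    N = net st
    open WellFormed wf
    open Core wf
    open Link wf
    open Runs wf
    open Sound inv using (F)

    Clean : EventSet → Set
    Clean C = ∀ k → C k ≡ true → co st k ≡ nothing × coc st k ≡ false

    -- The wanted event takes its inputs from the cut of `C` and its targets from `g'`. If the net
    -- lacked it, it would be a possible extension whose causes all lie in the clean set `C`, hence
    -- eligible, against `Final`.
    occurs : ∀ {C g a g'} → Config N C → Clean C → g ≐ stateOf N C → GStep g a g' →
             Σ ℕ λ k → Fireable N C k × actAt N k ≡ a × stateOf N (add C k) ≐ g'
    occurs {C} {g} {a} {g'} c clean eq (f , ex) = find (anyUpTo? match? (length N))
      where
      partFor : ∀ j → Dec (a ∈ acts (A j)) → Maybe (CId × S j)
      partFor j (yes _) = just (finalCut N C j , g' j)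
      partFor j (no _)  = nothing
      e : Event
      e = mkEvent a λ j → partFor j (a ∈? acts (A j))
      Match : ℕ → Set
      Match k = actAt N k ≡ a × (∀ j → partAt N k j ≡ part e j)
      match? : ∀ k → Dec (Match k)
      match? k = (actAt N k ≟ a) ×-dec Fin.all? λ j → maybe-≡-dec (×-≡-dec _≟ᶜ_ Fin._≟_) (partAt N k j) (part e j)

      part-yes : ∀ j → a ∈ acts (A j) → part e j ≡ just (finalCut N C j , g' j)
      part-yes j a∈ with a ∈? acts (A j)
      ... | yes _ = refl
      ... | no a∉ = ⊥-elim (a∉ a∈)
      part-no : ∀ j → a ∉ acts (A j) → part e j ≡ nothing
      part-no j a∉ with a ∈? acts (A j)
      ... | yes a∈ = ⊥-elim (a∉ a∈)
      ... | no _ = refl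
      part-inv : ∀ j {b s'} → part e j ≡ just (b , s') → a ∈ acts (A j) × finalCut N C j ≡ b × g' j ≡ s'
      part-inv j pe with a ∈? acts (A j)
      part-inv j refl | yes a∈ = a∈ , refl , refl

      possible : ¬ (∃[ k ] (k < length N × Match k)) → PossExt N e
      possible none' = (λ j → (λ a∈ → _ , part-yes j a∈) , part-no j) , ex
        , (Mark N C , (let σ , o , _ = config-occ c in σ , o) , marked)
        , λ { (k , e' , ne , ae , pe) → none' (k , nth-< N k ne , trans (cong actOf ne) ae
                                           , λ j → trans (nth-partAt N k j ne) (pe j)) }
        where
        marked : ∀ j b s' → part e j ≡ just (b , s') → (Mark N C b ≡ true) ×
                 Σ (S j) λ s → (labC N b ≡ just (j , s)) × (tr (A j) s s' ≡ just a)
        marked j b s' pe with part-inv j pe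
        ... | a∈ , refl , refl =
            proj₂ (mark-matches N C _) (cong (finalCut N C) (cut-comp N C (length N) j))
          , stateOf N C j , spec-labC (cut-spec N C (length N) j)
          , trans (cong (λ s → tr (A j) s (g' j)) (sym (eq j))) (proj₁ (f j) a∈)

      eligible : PossExt N e → Eligible st e
      eligible pe = pe , λ k p → clean k (below k (Link.<ₙ⇒≺ wf' p))
        where
        open Ext N e
        wf' = wf-extend wf pe
        open Stab N e wf wf'
        below : ∀ k → N' ⊢ k ≺ length N → C k ≡ true
        below k (k' , p , (k'<L , j , s' , eq')) with part-inv j (trans (sym (partAt-new j)) eq')
        ... | _ , cx , _ = down-≼ (config-down c) (≼↓ k'<L p) (in-cut cx)
          where
          in-cut : finalCut N C j ≡ out k' j → C k' ≡ true
          in-cut cx with finalCut N C j | cut-view N C (length N) j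
          in-cut refl | _ | last _ _ Ck' _ _ = Ck'

      find : Dec (∃[ k ] (k < length N × Match k)) → _
      find (no none') = ⊥-elim (fin (e , eligible (possible none')))
      find (yes (k , k< , ae , pe)) = k , fr , ae , state
        where
        fr : Fireable N C k
        fr = k< , λ j b s' eq' → proj₁ (proj₂ (part-inv j (trans (sym (pe j)) eq')))
        state : stateOf N (add C k) ≐ g'
        state j with a ∈? acts (A j)
        ... | yes a∈ with trans (pe j) (part-yes j a∈)
        ...   | p rewrite fire-cut-new {C} fr (_ , p) | p = refl
        state j | no a∉ = trans (cong (labelAt N j) (fire-cut-old {C} λ (p , q) → case trans (sym q) (trans (pe j) (part-no j a∉)) of λ ()))
                         (trans (sym (eq j)) (sym (proj₂ (f j) a∉)))

    -- The i-conditions at which a replay starts. Outputs of cut-offs are left out: Con ignores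
    -- cut-offs, and the shortening argument must apply Con to the event that produced the anchor.
    data Anchor : CId → Set where
      root : Anchor (ini i)
      node : ∀ {x} → Participates N x i → co st x ≡ nothing → Anchor (out x i)

    anchor-config : ∀ {c} → Anchor c → Config N (pastOf N c)
    anchor-config root = ∅-config N
    anchor-config (node jx _) = past-config (participates-< jx)

    anchor-clean : ∀ {c} → Anchor c → Clean (pastOf N c)
    anchor-clean root k ()
    anchor-clean (node {x} jx cx) k p with unsnoc (past⇒ p)
    ... | inj₂ k≺x = succs k≺x
    ... | inj₁ refl = cx , ≢true⇒false λ t → proj₂ (coc-t t) λ cand → proj₁ (proj₂ cand) (participates⇒iEvent jx)

    anchor-cut : ∀ {c} → Anchor c → finalCut N (pastOf N c) i ≡ c
    anchor-cut root = cut-∅ N (length N) i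
    anchor-cut (node jx _) = cutOf-own jx

    -- A companion may itself be a cut-off, so companions are followed until one is not; their
    -- numbers decrease.
    anchorOf : ∀ k → Participates N k i →
               Σ CId λ c → Anchor c × ((N , co st) ⊢ out k i ≈ c) × (St[ N ] k ≐ stateAfter N c)
    anchorOf = <-rec _ go
      where
      P : ℕ → Set
      P k = Participates N k i → Σ CId λ c → Anchor c × ((N , co st) ⊢ out k i ≈ c) × (St[ N ] k ≐ stateAfter N c)
      go : ∀ k → (∀ {k'} → k' < k → P k') → P k
      go k rec jk with co st k in ck
      ... | nothing = out k i , node jk ck , ε , λ _ → refl
      ... | just k' with co-just ck
      ...   | k< , k'<k , _ , jk' , s with rec k'<k jk'
      ...     | c , an , eqv , s' = c , an , fwd (k , k' , ck , own k jk , own k' jk') ◅ eqv , ≐-trans s s'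
        where
        own : ∀ k → Participates N k i → IsMj N k i (out k i)
        own k jk = subst (IsMj N k i) (cutOf-own jk) (IsMj-cutOf (participates-< jk) i)

    -- Replacing the past of a cut-off candidate by the past of its companion leads to the same global state.
    module Shorten {c : CId} (an : Anchor c) {C : EventSet} (cfgC : Config N C) (E⊆C : pastOf N c ⊆ₑ C)
                   (noI : ∀ m → (C ∖ pastOf N c) m ≡ true → ¬ Participates N m i)
                   {k : ℕ} (fr : Fireable N C k) (cand : IsCand N N (co st) k) where

      E = pastOf N c
      C⁺ = add C k
      K = past N k
      k' = proj₁ (proj₂ (proj₂ cand))
      K' = past N k'
      k'<L = proj₁ (proj₂ (proj₂ (proj₂ cand)))
      k<L = proj₁ fr
      strong = proj₁ (proj₂ (proj₂ (proj₂ (proj₂ cand))))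
      same-st = Sem.sameSt⇒ wf k<L k'<L (proj₁ (proj₂ (proj₂ (proj₂ (proj₂ (proj₂ cand))))))
      same-ip = Sem.sameIp⇒ wf k<L k'<L (proj₁ (proj₂ (proj₂ (proj₂ (proj₂ (proj₂ (proj₂ cand)))))))
      con = proj₂ (proj₂ (proj₂ (proj₂ (proj₂ (proj₂ (proj₂ cand))))))

      ¬jk : ¬ Participates N k i
      ¬jk jk = proj₁ (proj₂ cand) (participates⇒iEvent jk)

      cfg⁺ : Config N C⁺
      cfg⁺ = fire-config cfgC fr

      k'≺k : N ⊢ k' ≺ k
      k'≺k = <ₙ⇒≺ (proj₁ strong)

      E-down : Down N E
      E-down = config-down (anchor-config an)

      E⊆C⁺ : E ⊆ₑ C⁺
      E⊆C⁺ m Em = add-old {C} (E⊆C m Em)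

      K⊆C⁺ : K ⊆ₑ C⁺
      K⊆C⁺ m Km = down-≼ (config-down cfg⁺) (past⇒ Km) (add-new C k)

      K'⊆K : K' ⊆ₑ K
      K'⊆K m p = ⇒past (past⇒ p ◅◅ ≺⇒≼ k'≺k)

      k∉E : ¬ (E k ≡ true)
      k∉E Ek = fire-∉ fr (E⊆C k Ek)

      i-in-E : ∀ {m} → C⁺ m ≡ true → Participates N m i → E m ≡ true
      i-in-E {m} p jm with add⇒ {C} {k} {m} p
      ... | inj₂ refl = ⊥-elim (¬jk jm)
      ... | inj₁ Cm with E m in Em
      ...   | true = refl
      ...   | false = ⊥-elim (noI m (⇒∖ C E m Cm Em) jm)

      -- A path from inside [k] to outside has an arc leaving [k]: `y` is its end inside, `y'` its
      -- end outside.
      crossing : ∀ {m x} → N ⊢ m ≼ x → N ⊢ m ≼ k → ¬ (N ⊢ x ≼ k) →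
                 Σ ℕ λ y → Σ ℕ λ y' → N ⊢ m ≼ y × N ⊢ y ≼ k × DirectCause N y y' × ¬ (N ⊢ y' ≼ k) × N ⊢ y' ≼ x
      crossing ε p q = ⊥-elim (q p)
      crossing (_◅_ {j = y} d r) p q with ≼? N y k
      ... | no ¬y = _ , y , ε , p , d , ¬y , r
      ... | yes y≼k with crossing r y≼k q
      ...   | u , u' , a , b , z , v , w = u , u' , d ◅ a , b , z , v , w

      -- Two events of one configuration that consume the same condition coincide, since the later
      -- one would find a newer condition in the cut.
      no-conflict : ∀ {x} → C⁺ x ≡ true → ¬ (N ⊢ evt x # evt k)
      no-conflict {x} Cx (z , _ , _ , k₁ , k₂ , ne , a₁ , a₂ , l₁ , l₂) =
        clash (arc-consumes a₁) (arc-consumes a₂)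
          (down-≼ (config-down cfg⁺) (≤ₙ⇒≼ l₁) Cx) (K⊆C⁺ k₂ (⇒past (≤ₙ⇒≼ l₂)))
        where
        older : ∀ {k₁ k₂ z j s₁ s₂} → partAt N k₁ j ≡ just (z , s₁) → partAt N k₂ j ≡ just (z , s₂) →
                C⁺ k₁ ≡ true → C⁺ k₂ ≡ true → ¬ (k₁ < k₂)
        older {k₁} {k₂} {z} {j} e₁ e₂ c₁ c₂ lt with cut-≥ {N} {C⁺} {k₂} {j} lt c₁ (_ , e₁) | origin e₁
        ... | y , eq , k₁≤y , _ | inj₁ z≡ = case trans (sym (proj₂ (cfg⁺ k₂ c₂) j _ _ e₂)) eq of λ { refl → case z≡ of λ () }
        ... | y , eq , k₁≤y , _ | inj₂ (y' , y'<k₁ , z≡ , _)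
          with out-injective (trans (sym z≡) (trans (sym (proj₂ (cfg⁺ k₂ c₂) j _ _ e₂)) eq))
        ...   | refl = <⇒≱ y'<k₁ k₁≤y
        clash : Consumes N k₁ z → Consumes N k₂ z → C⁺ k₁ ≡ true → C⁺ k₂ ≡ true → ⊥
        clash (j , s₁ , e₁) (j' , s₂ , e₂) c₁ c₂ with trans (sym (pre-comp e₁)) (pre-comp e₂)
        ... | refl with <-cmp k₁ k₂
        ...   | tri< lt _ _ = older e₁ e₂ c₁ c₂ lt
        ...   | tri≈ _ eq _ = ne eq
        ...   | tri> _ _ gt = older e₂ e₁ c₂ c₁ gt

      -- If m were in the past of the anchor x and of k but not of k', strong causality would put k' below x.
      shared : ∀ {x} → c ≡ out x i → Participates N x i → co st x ≡ nothing →
               ∀ {m} → N ⊢ m ≼ x → N ⊢ m ≼ k → N ⊢ m ≼ k'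
      shared {x} refl jx cx {m} m≼x m≼k with ≼? N x k
      -- Every i-event of `C⁺` is at or below `x`, so `x` produced the i-condition of M(k). As ip(k)
      -- = ip(k'), this event lies in [k'].
      ... | yes x≼k = m≼x ◅◅ past⇒ x∈K'
        where
        ip-k : cutOf k i ≡ out x i
        ip-k with cut-≥ {N} {K} {length N} {i} (participates-< jx) (⇒past x≼k) jx
        ... | y , eq , x≤y , y< , Ky , jy with ≤-antisym x≤y (≼⇒≤ (past⇒ (i-in-E (K⊆C⁺ y Ky) jy)))
        ...   | refl = eq
        x∈K' : K' x ≡ true
        x∈K' with cutOf k' i | cut-view N K' (length N) i | trans (sym same-ip) ip-k
        ... | _ | last _ _ p _ _ | refl = p
      -- The output of `y` that `y'` consumes is in M(k) but not in M(k'). Strong causality places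
      -- it above the condition of M(k') given by `frontier`, so k' is below `y`, hence below `x`.
      -- But `x` is concurrent with k, and by the inclusion of Con also with k'.
      ... | no x⋠k = decidable-stable (≼? N m k') λ m⋠k' →
          let y , y' , m≼y , y≼k , dp@(y<y' , j , s' , eq) , y'⋠k , y'≼x = crossing m≼x m≼k x⋠k
              Cy' = E⊆C⁺ y' (⇒past y'≼x)
              jy : Participates N y j
              jy = jev-of eq
              in-k : cutOf k j ≡ out y j
              in-k = cut-≡ (last y (participates-< jy) (⇒past y≼k) jy λ z y<z _ Kz jz → after y' Cy' eq y'⋠k z y<z Kz jz)
              not-k' : ¬ InM N k' (out y j)
              not-k' p = m⋠k' (m≼y ◅◅ past⇒ (last-in (InM⇒ p)))
              j' , jk' , not-k = frontier
              b'<b = proj₂ strong (out y j) (out k' j') (⇒InM k<L in-k) not-k'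
                       (⇒InM k'<L (cutOf-own jk')) not-k
              f , y₁ , cons , f≼ , ends = from-cnd b'<b
              y≡ = ends-y ends
          in k'≰x (≼⇒≤ₙ (consumes⇒cause cons ◅ subst (N ⊢ f ≼_) y≡ f≼ ◅◅ (dp ◅ y'≼x)))
        where
        jev-of : ∀ {y y' j s'} → partAt N y' j ≡ just (out y j , s') → Participates N y j
        jev-of eq with origin eq
        ... | inj₂ (_ , _ , refl , jy) = jy
        last-in : ∀ {D y j} → finalCut N D j ≡ out y j → D y ≡ true
        last-in {D} {y} {j} eq with finalCut N D j | cut-view N D (length N) j
        last-in refl | _ | last _ _ p _ _ = p
        ends-y : ∀ {y j y₁} → Ends N (cnd (out y j)) y₁ → y₁ ≡ y
        ends-y (_ , refl , _) = refl
        -- Since `y'` consumes the j-output of `y`, no j-event of `C⁺` lies between them; a j-event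
        -- of [k] from `y'` on would pull `y'` into [k].
        after : ∀ y' → C⁺ y' ≡ true → ∀ {y j s'} → partAt N y' j ≡ just (out y j , s') → ¬ (N ⊢ y' ≼ k) →
                ∀ z → y < z → K z ≡ true → ¬ Participates N z j
        after y' Cy' {y} {j} eq y'⋠k z y<z Kz jz with <-cmp z y'
        ... | tri≈ _ refl _ = y'⋠k (past⇒ Kz)
        ... | tri> _ _ y'<z = y'⋠k (≺⇒≼ (≺-same-comp cfg⁺ z y'<z Cy' (K⊆C⁺ z Kz) (_ , eq) jz) ◅◅ past⇒ Kz)
        ... | tri< z<y' _ _ with cut-≥ {N} {C⁺} {y'} {j} z<y' (K⊆C⁺ z Kz) jz
        ...   | u , cu , z≤u , _ with out-injective (trans (sym (proj₂ (cfg⁺ y' Cy') j _ _ eq)) cu)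
        ...     | refl = <⇒≱ y<z z≤u
        -- The first arc of a causal path from k' to k consumes an output of k' inside [k], so M(k)
        -- no longer contains it.
        frontier : ∃[ j ] (Participates N k' j × ¬ InM N k (out k' j))
        frontier = go k'≺k
          where
          at : ∀ {z} → DirectCause N k' z → N ⊢ z ≼ k → ∃[ j ] (Participates N k' j × ¬ InM N k (out k' j))
          at {z} (k'<z , j , s' , eq) z≼k = j , jev-of eq , λ p →
            let y , cy , z≤y , _ = cut-≥ {N} {K} {length N} {j} (partAt-< N z j eq) (⇒past z≼k) (_ , eq)
            in <⇒≱ k'<z (subst (z ≤_) (out-injective (trans (sym cy) (InM⇒ p))) z≤y)
          go : N ⊢ k' ≺ k → ∃[ j ] (Participates N k' j × ¬ InM N k (out k' j))
          go (_ , ε , d) = at d ε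
          go (_ , d ◅ p , d') = at d (p ◅◅ (d' ◅ ε))
        k'≰x : ¬ (N ⊢ evt k' ≤ₙ evt x)
        k'≰x with con x (participates-< jx , participates⇒iEvent jx , cx ,
                  (λ p → x⋠k (≤ₙ⇒≼ p)) , (λ p → k∉E (⇒past (≤ₙ⇒≼ p))) , no-conflict (E⊆C⁺ x (⇒past ε)))
        ... | _ , _ , _ , _ , ¬k'≤x , _ = ¬k'≤x

      E∩K⊆K' : ∀ m → E m ≡ true → K m ≡ true → K' m ≡ true
      E∩K⊆K' m Em Km = go an refl Em
        where
        go : ∀ {c'} → Anchor c' → c ≡ c' → pastOf N c' m ≡ true → K' m ≡ true
        go (node jx cx) c≡ e = ⇒past (shared c≡ jx cx (past⇒ e) (past⇒ Km))

      ∪-down : ∀ {X Y} → Down N X → Down N Y → Down N (X ∪ Y)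
      ∪-down {X} {Y} dx dy l m d p with ∪⇒ X Y m p
      ... | inj₁ q = ∪-l X Y l (dx l m d q)
      ... | inj₂ q = ∪-r X Y l (dy l m d q)

      E∪K⊆ : (E ∪ K) ⊆ₑ C⁺
      E∪K⊆ m p with ∪⇒ E K m p
      ... | inj₁ q = E⊆C⁺ m q
      ... | inj₂ q = K⊆C⁺ m q

      E∪K'⊆ : (E ∪ K') ⊆ₑ (E ∪ K)
      E∪K'⊆ m p with ∪⇒ E K' m p
      ... | inj₁ q = ∪-l E K m q
      ... | inj₂ q = ∪-r E K m (K'⊆K m q)

      cfgK : Config N (E ∪ K)
      cfgK = sub-config cfg⁺ E∪K⊆ (∪-down {E} {K} E-down (down-past N k))

      cfgK' : Config N (E ∪ K')
      cfgK' = sub-config cfgK E∪K'⊆ (∪-down {E} {K'} E-down (down-past N k'))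

      -- If some j-event of `E` lies outside `K`, the last j-event of E ∪ K is in `E`, for one in
      -- `K` would pull the former into `K`; both cuts then agree at j. Otherwise E ∩ K ⊆ K' leaves
      -- component j to `K` and `K'` alone, and St(k) = St(k') applies.
      state-eq : stateOf N (E ∪ K') ≐ stateOf N (E ∪ K)
      state-eq j with anyUpTo? (λ m → (E ∖ K) m B≟ true ×-dec participates? N m j) (length N)
      ... | no none' = trans (cong (labelAt N j) (cut-cong (length N) j eqK'))
                      (trans (sym (same-st j)) (cong (labelAt N j) (sym (cut-cong (length N) j eqK))))
        where
        E⊆K : ∀ m → m < length N → Participates N m j → E m ≡ true → K m ≡ true
        E⊆K m m< jm Em with K m in Km
        ... | true = refl
        ... | false = ⊥-elim (none' (m , m< , ⇒∖ E K m Em Km , jm))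
        eqK : ∀ m → m < length N → Participates N m j → (E ∪ K) m ≡ K m
        eqK m m< jm = bool-≡ to (∪-r E K m)
          where
          to : (E ∪ K) m ≡ true → K m ≡ true
          to p with ∪⇒ E K m p
          ... | inj₁ q = E⊆K m m< jm q
          ... | inj₂ q = q
        eqK' : ∀ m → m < length N → Participates N m j → (E ∪ K') m ≡ K' m
        eqK' m m< jm = bool-≡ to (∪-r E K' m)
          where
          to : (E ∪ K') m ≡ true → K' m ≡ true
          to p with ∪⇒ E K' m p
          ... | inj₁ q = E∩K⊆K' m q (E⊆K m m< jm q)
          ... | inj₂ q = q
      ... | yes (d , d< , ed , jd) = cong (labelAt N j) same
        where
        Ed = proj₁ (∖⇒ E K d ed)
        Kd = proj₂ (∖⇒ E K d ed)
        same : finalCut N (E ∪ K') j ≡ finalCut N (E ∪ K) j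
        same with finalCut N (E ∪ K) j | cut-view N (E ∪ K) (length N) j
        ... | _ | none f = ⊥-elim (f d d< (∪-l E K d Ed) jd)
        ... | _ | last y y< p jy f = cut-≡ (last y y< (∪-l E K' y Ey) jy λ z y<z z< q → f z y<z z< (E∪K'⊆ z q))
          where
          Ey : E y ≡ true
          Ey with ∪⇒ E K y p
          ... | inj₁ q = q
          ... | inj₂ Ky with <-cmp d y
          ...   | tri≈ _ refl _ = Ed
          ...   | tri> _ _ y<d = ⊥-elim (f d y<d d< (∪-l E K d Ed) jd)
          ...   | tri< d<y _ _ = ⊥-elim (true⇒≢false (⇒past (≺⇒≼ (≺-same-comp cfgK y d<y (∪-l E K d Ed) p jd jy) ◅◅ past⇒ Ky)) Kd)

      noI⁺ : ∀ {X Y} → X ⊆ₑ C⁺ → E ⊆ₑ Y → ∀ m → (X ∖ Y) m ≡ true → ¬ Participates N m i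
      noI⁺ {X} {Y} X⊆ E⊆ m p jm =
        true⇒≢false (E⊆ m (i-in-E (X⊆ m (proj₁ (∖⇒ X Y m p))) jm)) (proj₂ (∖⇒ X Y m p))

      -- Run from `E` to E ∪ K', identify its state with that of E ∪ K, and continue to `C⁺`. The
      -- two parts fire disjoint sets of events of `C⁺` outside `E`, and neither fires k.
      shorter : ∃[ m ] (m < count (C⁺ ∖ E) (length N) × SilentRun m (stateOf N E) (stateOf N C⁺))
      shorter = _ , less , silent-append (count ((E ∪ K') ∖ E) (length N))
          (silent-respʳ (count ((E ∪ K') ∖ E) (length N)) state-eq
            (run {E ∪ K'} {E} cfgK' (anchor-config an) (∪-l E K')
              (noI⁺ {E ∪ K'} {E} (λ m p → E∪K⊆ m (E∪K'⊆ m p)) (λ _ p → p))))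
          (run {C⁺} {E ∪ K} cfg⁺ cfgK E∪K⊆ (noI⁺ {C⁺} {E ∪ K} (λ _ p → p) (∪-l E K)))
        where
        X = (E ∪ K') ∖ E
        Y = C⁺ ∖ (E ∪ K)
        Z = C⁺ ∖ E
        X⇒ : ∀ m → X m ≡ true → K' m ≡ true × E m ≡ false
        X⇒ m p with ∖⇒ (E ∪ K') E m p
        ... | q , e with ∪⇒ E K' m q
        ...   | inj₁ r = ⊥-elim (true⇒≢false r e)
        ...   | inj₂ r = r , e
        less : count X (length N) + count Y (length N) < count Z (length N)
        less = count-sub-< {X} {Y} {Z} {k} (length N) k<L sub
          (≢true⇒false λ p → <⇒≱ (≺⇒< k'≺k) (≼⇒≤ (past⇒ (proj₁ (X⇒ k p)))))
          (≢true⇒false λ p → true⇒≢false (∪-r E K k (⇒past ε)) (proj₂ (∖⇒ C⁺ (E ∪ K) k p)))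
          (⇒∖ C⁺ E k (add-new C k) (≢true⇒false k∉E))
          where
          sub : ∀ m → Sub (X m) (Y m) (Z m)
          sub m = (λ p → let a , b = X⇒ m p in ⇒∖ C⁺ E m (K⊆C⁺ m (K'⊆K m a)) b)
                , (λ p → let a , b = ∖⇒ C⁺ (E ∪ K) m p in ⇒∖ C⁺ E m a (≢true⇒false λ q → true⇒≢false (∪-l E K m q) b))
                , (λ p q → true⇒≢false (∪-r E K m (K'⊆K m (proj₁ (X⇒ m p)))) (proj₂ (∖⇒ C⁺ (E ∪ K) m q)))

    Result : CId → ℕ → GState → Set
    Result c a s' = Σ CId λ c' → Anchor c' × step F c a c' × ∃[ m ] SilentRun m (stateAfter N c') s'

    -- Replayed events that are not below k are postponed until after k. They form the silent run
    -- with which the next stage starts, at the anchor equivalent to the output of k.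
    arrive : ∀ {c a s' C k} → Anchor c → Config N C → pastOf N c ⊆ₑ C →
             (∀ m → (C ∖ pastOf N c) m ≡ true → ¬ Participates N m i) →
             Fireable N C k → actAt N k ≡ a → a ∈ Σi → stateOf N (add C k) ≐ s' → Result c a s'
    arrive {c} {a} {s'} {C} {k} an cC E⊆C noI fr ae a∈ eq
      with ∈⇒participates {k} {i} (proj₁ fr) (subst (_∈ Σi) (sym ae) a∈)
    ... | jk@((b , t) , pe) with anchorOf k jk | <-nth N k (proj₁ fr)
    ...   | c' , an' , eqv , st' | e , ne =
        c' , an' , (k , e , b , t , ne , trans (sym (nth-partAt N k i ne)) pe , trans (sym (cong actOf ne)) ae
                 , subst (λ x → (N , co st) ⊢ c ≈ x) c≡b ε , eqv)
      , _ , silent-respˡ m st' (silent-respʳ m eq (run {add C k} {K} cC⁺ (past-config (proj₁ fr)) K⊆ noI'))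
      where
      E = pastOf N c
      K = past N k
      m = count (add C k ∖ K) (length N)
      cC⁺ = fire-config cC fr
      c≡b : c ≡ b
      c≡b = trans (sym (anchor-cut an)) (trans (cut-cong {C = E} {C' = C} (length N) i same) (proj₂ fr i b t pe))
        where
        same : ∀ x → x < length N → Participates N x i → E x ≡ C x
        same x _ jx = bool-≡ (E⊆C x) λ Cx → back Cx
          where
          back : C x ≡ true → E x ≡ true
          back Cx with E x in Ex
          ... | true = refl
          ... | false = ⊥-elim (noI x (⇒∖ C E x Cx Ex) jx)
      K⊆ : K ⊆ₑ add C k
      K⊆ x p = down-≼ (config-down cC⁺) (past⇒ p) (add-new C k)
      noI' : ∀ x → (add C k ∖ K) x ≡ true → ¬ Participates N x i
      noI' x p jx with ∖⇒ (add C k) K x p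
      ... | q , x∉K with add⇒ {C} {k} {x} q
      ...   | inj₂ refl = true⇒≢false (⇒past ε) x∉K
      ...   | inj₁ Cx with ≼-total-comp cC⁺ q (add-new C k) jx jk
      ...     | inj₁ x≼k = true⇒≢false (⇒past x≼k) x∉K
      ...     | inj₂ k≺x = fire-∉ fr (down-≼ (config-down cC) (≺⇒≼ k≺x) Cx)

    Sim : ℕ → Set
    Sim M = ∀ {m c s a s'} → m < M → Anchor c → SilentRun m (stateAfter N c) s → a ∈ Σi → GStep s a s' → Result c a s'

    -- Events replayed since the anchor plus steps still to do amount to at most `M`. At a candidate
    -- all that was replayed, the candidate included, is exchanged for a strictly shorter run from
    -- the anchor, so the total drops below `M` and `rec` applies.
    unroll : ∀ {M} → Sim M → ∀ m {c s a s' C g} → Anchor c → Config N C → Clean C → pastOf N c ⊆ₑ C →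
             (∀ x → (C ∖ pastOf N c) x ≡ true → ¬ Participates N x i) →
             count (C ∖ pastOf N c) (length N) + m < suc M →
             g ≐ stateOf N C → SilentRun m g s → a ∈ Σi → GStep s a s' → Result c a s'
    unroll rec zero {C = C} an cC clean E⊆C noI lt eq p a∈ st
      with occurs {C} cC clean eq (gstep-resp (≐-sym p) (λ _ → refl) st)
    ... | k , fr , ae , eq' = arrive {C = C} an cC E⊆C noI fr ae a∈ eq'
    unroll {M} rec (suc m) {c} {s} {C = C} an cC clean E⊆C noI lt eq (b , g' , b∉ , x , r) a∈ st'
      with occurs {C} cC clean eq x
    ... | k , fr , ae , eq' = go (coc st k) refl
      where
      E = pastOf N c
      C⁺ = add C k
      ¬jk : ¬ Participates N k i
      ¬jk jk = b∉ (subst (_∈ Σi) ae (participates⇒∈ jk))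
      noI⁺ : ∀ y → (C⁺ ∖ E) y ≡ true → ¬ Participates N y i
      noI⁺ y p jy with ∖⇒ C⁺ E y p
      ... | q , e with add⇒ {C} {k} {y} q
      ...   | inj₁ Cy = noI y (⇒∖ C E y Cy e) jy
      ...   | inj₂ refl = ¬jk jy
      one-more : count (C⁺ ∖ E) (length N) ≤ suc (count (C ∖ E) (length N))
      one-more = count-insert {C⁺ ∖ E} {C ∖ E} {k} (length N) λ y y≢k → cong (_∧ not (E y)) (add-≢ {C} y≢k)
      bound : count (C⁺ ∖ E) (length N) + m < suc M
      bound = ≤-<-trans (+-monoˡ-≤ m one-more) (subst (_< suc M) (+-suc (count (C ∖ E) (length N)) m) lt)
      go : ∀ t → coc st k ≡ t → Result c _ _
      go false ck = unroll rec m {C = C⁺} an (fire-config cC fr) clean⁺ (λ y p → add-old {C} (E⊆C y p)) noI⁺ bound (≐-sym eq') r a∈ st'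
        where
        no-co : co st k ≡ nothing
        no-co with co st k in e
        ... | nothing = refl
        ... | just _ = ⊥-elim (¬jk (proj₁ (proj₂ (proj₂ (co-just e)))))
        clean⁺ : Clean C⁺
        clean⁺ y p with add⇒ {C} {k} {y} p
        ... | inj₁ Cy = clean y Cy
        ... | inj₂ refl = no-co , ck
      -- Candidacy is doubly negated, but the shorter run it yields has bounded length, and the
      -- existence of such a run is decidable.
      go true ck with decidable-stable (anyUpTo? (λ l → silentRun? l (stateOf N E) (stateOf N C⁺)) (count (C⁺ ∖ E) (length N)))
                        (λ ¬sh → proj₂ (coc-t ck) λ cand → ¬sh (Shorten.shorter an cC E⊆C noI fr cand))
      ... | l , l< , r' = rec {l + m} (≤-pred (≤-<-trans (+-monoˡ-≤ m l<) bound)) an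
                            (silent-append l (silent-respʳ l eq' r') r) a∈ st'

    sim : ∀ M → Sim M
    sim (suc M) {m} {c} m<M an r a∈ st = unroll (sim M) m {C = pastOf N c} an (anchor-config an) (anchor-clean an) (λ _ p → p)
      (λ x p → ⊥-elim (true⇒≢false (proj₁ (∖⇒ E E x p)) (proj₂ (∖⇒ E E x p))))
      (subst (λ z → z + m < suc M) (sym empty) m<M) (λ _ → refl) r a∈ st
      where
      E = pastOf N c
      count-∅ : ∀ l → count ∅ l ≡ 0
      count-∅ zero = refl
      count-∅ (suc l) = count-∅ l
      empty : count (E ∖ E) (length N) ≡ 0
      empty = trans (count-cong {E ∖ E} {∅} (length N) λ x _ → ≢true⇒false λ p → true⇒≢false (proj₁ (∖⇒ E E x p)) (proj₂ (∖⇒ E E x p)))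
                    (count-∅ (length N))

    simulate : ∀ {m c s a s'} → Anchor c → SilentRun m (stateAfter N c) s → a ∈ Σi → GStep s a s' → Result c a s'
    simulate {m} = sim (suc m) ≤-refl

    fin-path : ∀ {m c s u} → Anchor c → SilentRun m (stateAfter N c) s → Path Global s u → Path F c (proj u)
    fin-path an r [] = []
    fin-path {m} an r (_∷_ {a = a} {w = w} x xs) with a ∈? Σi
    ... | no a∉ = fin-path an (silent-snoc m r a∉ x) xs
    ... | yes a∈ with simulate an r a∈ x
    ...   | c' , an' , stp , _ , r' = stp ∷ fin-path an' r' xs

    silent-start : SilentRun 0 (stateAfter N (ini i)) ginit
    silent-start = ≐-sym (ginit-stateAfter N)

    prefix-path : ∀ (f : ℕ → GState) u → (∀ k → GStep (f k) (u k) (f (suc k))) → ∀ m → Path Global (f 0) (prefix u m)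
    prefix-path f u h zero = []
    prefix-path f u h (suc m) = h 0 ∷ prefix-path (λ k → f (suc k)) (λ k → u (suc k)) (λ k → h (suc k)) m

    fin-complete : ∀ {w} → FinInProj w → FinTrace F w
    fin-complete (inj₁ (u , p , refl)) = fin-path root silent-start p
    fin-complete (inj₂ (u , (f , f0 , h) , m , refl , _)) =
      fin-path root silent-start (subst (λ g → Path Global g (prefix u m)) f0 (prefix-path f u h m))

    -- Between stages only an anchor and a silent run from its state to `f (pos k)` are kept, where
    -- `pos (suc k)` is the position just after the action `w k`. The run is prolonged up to `g k`
    -- before `simulate` takes over.
    inf-complete : ∀ {w} → InfInProj w → InfTrace F w
    inf-complete {w} (u , (f , f0 , h) , g , g< , gw , only) = (λ k → proj₁ (at k)) , refl , λ k → proj₂ (next k (at k))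
      where
      pos : ℕ → ℕ
      pos zero    = 0
      pos (suc k) = suc (g k)

      pos≤ : ∀ k → pos k ≤ g k
      pos≤ zero = z≤n
      pos≤ (suc k) = g< k

      quiet : ∀ k t → pos k ≤ t → t < g k → u t ∉ Σi
      quiet k t p q u∈ with only t u∈
      ... | l , refl with <-cmp l k
      ...   | tri≈ _ refl _ = <-irrefl refl q
      ...   | tri> _ _ k<l = <-asym q (mono-steps g g< k<l)
      quiet (suc k) t p q u∈ | l , refl | tri< (s≤s l≤k) _ _ with m≤n⇒m<n∨m≡n l≤k
      ...     | inj₁ l<k = <-asym p (mono-steps g g< l<k)
      ...     | inj₂ refl = <-irrefl refl p

      silent : ∀ k d → pos k + d ≤ g k → ∀ {m s} → SilentRun m s (f (pos k)) → SilentRun (d + m) s (f (pos k + d))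
      silent k zero le {m} {s} r = subst (λ t → SilentRun m s (f t)) (sym (+-identityʳ (pos k))) r
      silent k (suc d) le {m} {s} r = subst (λ t → SilentRun (suc d + m) s (f t)) (sym (+-suc (pos k) d))
        (silent-snoc (d + m) (silent k d (<⇒≤ lt) r) (quiet k (pos k + d) (m≤m+n _ _) lt) (h (pos k + d)))
        where lt = subst (_≤ g k) (+-suc (pos k) d) le

      Status : ℕ → Set
      Status k = Σ CId λ c → Anchor c × ∃[ m ] SilentRun m (stateAfter N c) (f (pos k))

      next : ∀ k → (x : Status k) → Σ (Status (suc k)) λ y → step F (proj₁ x) (w k) (proj₁ y)
      next k (c , an , m , r) =
        let d , e = m≤n⇒∃[o]m+o≡n (pos≤ k)
            c' , an' , stp , m' , r' = simulate an
              (subst (λ t → SilentRun (d + m) (stateAfter N c) (f t)) e (silent k d (≤-reflexive e) r)) (proj₁ (gw k)) (h (g k))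
        in (c' , an' , m' , r') , subst (λ a → step F c a c') (proj₂ (gw k)) stp

      at : ∀ k → Status k
      at zero = ini i , root , 0 , subst (λ x → SilentRun 0 (stateAfter N (ini i)) x) (sym f0) silent-start
      at (suc k) = proj₁ (next k (at k))

  -- Termination

  remove : ∀ {X : Set} {x : X} {xs} → x ∈ xs →
           Σ (List X) λ ys → length xs ≡ suc (length ys) × (∀ {y} → y ∈ xs → y ≡ x ⊎ y ∈ ys) × (∀ {y} → y ∈ ys → y ∈ xs)
  remove {xs = x ∷ xs} (here refl) = xs , refl , (λ { (here e) → inj₁ e ; (there p) → inj₂ p }) , there
  remove {xs = z ∷ xs} (there p) with remove p
  ... | ys , l , f , g = z ∷ ys , cong suc l
    , (λ { (here e) → inj₂ (here e) ; (there q) → case f q of λ { (inj₁ e) → inj₁ e ; (inj₂ r) → inj₂ (there r) } })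
    , (λ { (here e) → here e ; (there q) → there (g q) })

  ¬¬-∀ : ∀ m {P : Fin m → Set} → (∀ t → ¬ ¬ P t) → ¬ ¬ (∀ t → P t)
  ¬¬-∀ zero h k = k λ ()
  ¬¬-∀ (suc m) h k = h Fin.zero λ p → ¬¬-∀ m (λ t → h (Fin.suc t)) λ f → k λ { Fin.zero → p ; (Fin.suc t) → f t }

  encode-injective : ∀ {m} (f : Fin m → ℕ) {g h} → encode f g ≡ encode f h → ∀ j → g j ≡ h j
  encode-injective f {g} {h} eq j = trans (sym (decode-encode f g j)) (trans (cong (λ c → decode f c j) eq) (decode-encode f h j))

  -- Counts the possible events of bounded depth. In each component an event does nothing, or has a
  -- target state and an input that is initial or the output of one of at most `codes d` shallower
  -- events.
  codes : ℕ → ℕ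
  codes zero    = 0
  codes (suc d) = ∏ λ j → suc (suc (codes d) * size (A j))

  -- Causal depth and the number of events

  module Depth {N : Net} (wf : WellFormed N) where
    open WellFormed wf
    open Core wf
    open Link wf

    DepthBelow : ℕ → ℕ → Set
    DepthBelow zero    k = ⊥
    DepthBelow (suc d) k = ∀ k' → DirectCause N k' k → DepthBelow d k'

    Chain : ℕ → ℕ → Set
    Chain d k = Σ (ℕ → ℕ) λ c → c d ≡ k × (∀ t → t < d → DirectCause N (c t) (c (suc t)))

    chain-snoc : ∀ {d k k'} → Chain d k' → DirectCause N k' k → Chain (suc d) k
    chain-snoc {d} {k} {k'} (c , e , h) dp = c' , end , step'
      where
      c' : ℕ → ℕ
      c' t with t ≤? d
      ... | yes _ = c t
      ... | no _  = k
      low : ∀ {t} → t ≤ d → c' t ≡ c t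
      low {t} t≤d with t ≤? d
      ... | yes _ = refl
      ... | no ¬p = ⊥-elim (¬p t≤d)
      end : c' (suc d) ≡ k
      end with suc d ≤? d
      ... | yes p = ⊥-elim (<-irrefl refl p)
      ... | no _ = refl
      step' : ∀ t → t < suc d → DirectCause N (c' t) (c' (suc t))
      step' t (s≤s t≤d) with m≤n⇒m<n∨m≡n t≤d
      ... | inj₁ t<d rewrite low t≤d | low t<d = h t t<d
      ... | inj₂ refl rewrite low t≤d | end | e = dp

    depth-or-chain : ∀ d k → DepthBelow d k ⊎ Chain d k
    depth-or-chain zero k = inj₂ ((λ _ → k) , refl , λ t ())
    depth-or-chain (suc d) k with search k
      where
      search : ∀ b → (∀ k' → k' < b → DirectCause N k' k → DepthBelow d k') ⊎ Chain (suc d) k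
      search zero = inj₁ λ _ ()
      search (suc b) with search b | directCause? N b k | depth-or-chain d b
      ... | inj₂ c | _ | _ = inj₂ c
      ... | inj₁ _ | yes p | inj₂ c = inj₂ (chain-snoc c p)
      ... | inj₁ f | no ¬p | _ = inj₁ λ { k' (s≤s k'≤b) p → case m≤n⇒m<n∨m≡n k'≤b of λ
              { (inj₁ q) → f k' q p ; (inj₂ refl) → ⊥-elim (¬p p) } }
      ... | inj₁ f | yes _ | inj₁ h = inj₁ λ { k' (s≤s k'≤b) p → case m≤n⇒m<n∨m≡n k'≤b of λ
              { (inj₁ q) → f k' q p ; (inj₂ refl) → h } }
    ... | inj₁ f = inj₁ λ k' p → f k' (DirectCause.cause-< p) p
    ... | inj₂ c = inj₂ c

    code  : ∀ d k → DepthBelow d k → Fin (codes d)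
    pcode : ∀ d k j → DepthBelow (suc d) k → (p : Maybe (CId × S j)) → partAt N k j ≡ p → Fin (suc (suc (codes d) * size (A j)))
    code (suc d) k h = encode _ λ j → pcode d k j h (partAt N k j) refl
    pcode d k j h nothing eq = Fin.zero
    pcode d k j h (just (ini _ , s)) eq = Fin.suc (combine {suc (codes d)} Fin.zero s)
    pcode d k j h (just (out k' _ , s)) eq = Fin.suc (combine (Fin.suc (code d k' (h k' (consumes⇒cause (j , s , eq))))) s)

    -- The code fixes all inputs and targets. A transition of any participating component then fixes
    -- the action, and `distinct` identifies the events.
    code-injective : ∀ d {k k'} (h : DepthBelow d k) (h' : DepthBelow d k') → k < length N → k' < length N →
                     code d k h ≡ code d k' h' → k ≡ k'
    pcode-injective : ∀ d {k k'} j (h : DepthBelow (suc d) k) (h' : DepthBelow (suc d) k') p p' eq eq' →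
                      pcode d k j h p eq ≡ pcode d k' j h' p' eq' → p ≡ p'
    code-injective (suc d) {k} {k'} h h' k< k'< e = distinct k< k'< same-act same
      where
      same : ∀ j → partAt N k j ≡ partAt N k' j
      same j = pcode-injective d j h h' _ _ refl refl (encode-injective _ e j)
      same-act : actAt N k ≡ actAt N k'
      same-act with participant k<
      ... | j , ((b , s) , eq) = just-injective (trans (sym (is-transition eq)) (is-transition (trans (sym (same j)) eq)))
    pcode-injective d j h h' nothing nothing eq eq' e = refl
    pcode-injective d j h h' nothing (just (ini _ , _)) eq eq' ()
    pcode-injective d j h h' nothing (just (out _ _ , _)) eq eq' ()
    pcode-injective d j h h' (just (ini _ , _)) nothing eq eq' ()
    pcode-injective d j h h' (just (out _ _ , _)) nothing eq eq' ()
    pcode-injective d j h h' (just (ini j₁ , s)) (just (ini j₂ , s')) eq eq' e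
      with Fin.combine-injectiveʳ {suc (codes d)} Fin.zero s Fin.zero s' (Fin.suc-injective e)
         | trans (pre-comp eq) (sym (pre-comp eq'))
    ... | refl | refl = refl
    pcode-injective d j h h' (just (out k₁ j₁ , s)) (just (out k₂ j₂ , s')) eq eq' e
      with Fin.combine-injective (Fin.suc (code d k₁ _)) s (Fin.suc (code d k₂ _)) s' (Fin.suc-injective e)
         | trans (pre-comp eq) (sym (pre-comp eq'))
    ... | e' , refl | refl
      with code-injective d _ _ (out-< eq) (out-< eq') (Fin.suc-injective e')
      where
      out-< : ∀ {k k₁ j₁ s} → partAt N k j ≡ just (out k₁ j₁ , s) → k₁ < length N
      out-< eq = <-trans (DirectCause.cause-< (consumes⇒cause (j , _ , eq))) (partAt-< N _ j eq)
    ... | refl = refl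
    pcode-injective d j h h' (just (ini _ , s)) (just (out k₂ _ , s')) eq eq' e
      with Fin.combine-injectiveˡ {suc (codes d)} Fin.zero s (Fin.suc (code d k₂ _)) s' (Fin.suc-injective e)
    ... | ()
    pcode-injective d j h h' (just (out k₁ _ , s)) (just (ini _ , s')) eq eq' e
      with Fin.combine-injectiveˡ {suc (codes d)} (Fin.suc (code d k₁ _)) s Fin.zero s' (Fin.suc-injective e)
    ... | ()

    size-bound : ∀ d → (∀ k → k < length N → ¬ Chain d k) → length N ≤ codes d
    size-bound d noChain = ≮⇒≥ λ lt →
      let t , t' , t<t' , e = Fin.pigeonhole lt λ t → code d (toℕ t) (ht t)
      in <⇒≢ t<t' (code-injective d (ht t) (ht t') (Fin.toℕ<n t) (Fin.toℕ<n t') e)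
      where
      ht : (t : Fin (length N)) → DepthBelow d (toℕ t)
      ht t with depth-or-chain d (toℕ t)
      ... | inj₁ h = h
      ... | inj₂ c = ⊥-elim (noChain (toℕ t) (Fin.toℕ<n t) c)

    -- Long chains and strong causality

    Moves : ℕ → ℕ → Fin n → Set
    Moves a z j = Σ ℕ λ g → g < length N × Participates N g j × N ⊢ g ≼ z × ¬ (N ⊢ g ≼ a)

    moves? : ∀ a z j → Dec (Moves a z j)
    moves? a z j = anyUpTo? (λ g → participates? N g j ×-dec ≼? N g z ×-dec ¬? (≼? N g a)) (length N)

    moves-mono : ∀ {a a' z' z j} → N ⊢ a ≼ a' → N ⊢ z' ≼ z → Moves a' z' j → Moves a z j
    moves-mono p q (g , g< , jg , g≼ , g⋠) = g , g< , jg , g≼ ◅◅ q , λ r → g⋠ (r ◅◅ p)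

    -- Descend from `g` through j-events until the input is initial or produced inside [a]. The
    -- event reached consumes the j-condition of M(a).
    consumer : ∀ {a q j} → q < length N → N ⊢ a ≼ q → Moves a q j →
               Σ ℕ λ f → N ⊢ f ≼ q × Σ (S j) λ s' → partAt N f j ≡ just (cutOf a j , s')
    consumer {a} {q} {j} q< a≼q (g , _ , jg , g≼q , g⋠a) = <-rec P go g jg g≼q g⋠a
      where
      P : ℕ → Set
      P g = Participates N g j → N ⊢ g ≼ q → ¬ (N ⊢ g ≼ a) →
            Σ ℕ λ f → N ⊢ f ≼ q × Σ (S j) λ s' → partAt N f j ≡ just (cutOf a j , s')
      cfgQ = past-config q<
      go : ∀ g → (∀ {g'} → g' < g → P g') → P g
      go g rec jg@((b , s') , eq) g≼q g⋠a with origin eq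
      ... | inj₁ refl = g , g≼q , s' , trans eq (cong (λ b → just (b , s')) (sym (cut-≡ (none empty))))
        where
        cutg : cut N (past N q) g j ≡ ini j
        cutg = proj₂ (cfgQ g (⇒past g≼q)) j (ini j) s' eq
        empty : ∀ h → h < length N → past N a h ≡ true → ¬ Participates N h j
        empty h _ h∈ jh with ≼-total-comp cfgQ (⇒past g≼q) (⇒past (past⇒ h∈ ◅◅ a≼q)) jg jh
        ... | inj₁ g≼h = g⋠a (g≼h ◅◅ past⇒ h∈)
        ... | inj₂ h≺g with cut-≥ {N} {past N q} {g} {j} (≺⇒< h≺g) (⇒past (past⇒ h∈ ◅◅ a≼q)) jh
        ...   | _ , e , _ = case trans (sym cutg) e of λ ()
      ... | inj₂ (g' , g'<g , refl , jg') with ≼? N g' a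
      ...   | no g'⋠a = rec g'<g jg' ((g'<g , j , s' , eq) ◅ g≼q) g'⋠a
      ...   | yes g'≼a = g , g≼q , s' , trans eq (cong (λ b → just (b , s')) (sym (cut-≡
                  (last g' (participates-< jg') (⇒past g'≼a) jg' later))))
        where
        cutg : cut N (past N q) g j ≡ out g' j
        cutg = proj₂ (cfgQ g (⇒past g≼q)) j (out g' j) s' eq
        later : ∀ h → g' < h → h < length N → past N a h ≡ true → ¬ Participates N h j
        later h g'<h _ h∈ jh with ≼-total-comp cfgQ (⇒past g≼q) (⇒past (past⇒ h∈ ◅◅ a≼q)) jg jh
        ... | inj₁ g≼h = g⋠a (g≼h ◅◅ past⇒ h∈)
        ... | inj₂ h≺g with cut-≥ {N} {past N q} {g} {j} (≺⇒< h≺g) (⇒past (past⇒ h∈ ◅◅ a≼q)) jh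
        ...   | _ , e , h≤ , _ with trans (sym cutg) e
        ...     | refl = <⇒≱ g'<h h≤

    module Learn (q : ℕ) where

      -- Causality read as flow of information: by the time of `z`, component j has taken part in an
      -- event at or after `q`.
      Knows : ℕ → Fin n → Set
      Knows z j = Σ ℕ λ m → m < length N × Participates N m j × N ⊢ m ≼ z × N ⊢ q ≼ m

      knows? : ∀ z j → Dec (Knows z j)
      knows? z j = anyUpTo? (λ m → participates? N m j ×-dec ≼? N m z ×-dec ≼? N q m) (length N)

      knows-mono : ∀ {z z' j} → N ⊢ z ≼ z' → Knows z j → Knows z' j
      knows-mono p (m , m< , jm , m≼ , q≼) = m , m< , jm , m≼ ◅◅ p , q≼

      -- Follow a path from g up to z': it must meet an event above q. The first such event
      -- shares a component with its predecessor on the path, which did not know q before.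
      learn : ∀ {z z'} → z' < length N → N ⊢ q ≼ z → N ⊢ z ≼ z' → ∀ {g} → N ⊢ g ≼ z' → ¬ (N ⊢ g ≼ z) →
              ∀ j → Participates N g j → ¬ Knows z j → ∃[ j' ] (Knows z' j' × ¬ Knows z j')
      learn {z} {z'} z'< q≼z z≼z' = go
        where
        go : ∀ {g} → N ⊢ g ≼ z' → ¬ (N ⊢ g ≼ z) →
             ∀ j → Participates N g j → ¬ Knows z j → ∃[ j' ] (Knows z' j' × ¬ Knows z j')
        go {g} g≼z' g⋠z j jg ¬k with ≼? N q g
        ... | yes q≼g = j , (g , participates-< jg , jg , g≼z' , q≼g) , ¬k
        go ε g⋠z j jg ¬k | no q⋠g = ⊥-elim (q⋠g (q≼z ◅◅ z≼z'))
        go {g} (_◅_ {j = g'} d@(_ , j' , s' , eq) r) g⋠z j jg ¬k | no q⋠g with origin eq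
        ... | inj₂ (_ , _ , refl , jg') with knows? z j'
        ...   | no ¬k' = go r (λ p → g⋠z (d ◅ p)) j' (_ , eq) ¬k'
        ...   | yes (m , m< , jm , m≼z , q≼m)
          with ≼-total-comp (past-config z'<) (⇒past (d ◅ r)) (⇒past (m≼z ◅◅ z≼z')) jg' jm
        ...     | inj₁ g≼m = ⊥-elim (g⋠z (g≼m ◅◅ m≼z))
        ...     | inj₂ m≺g = ⊥-elim (q⋠g (q≼m ◅◅ ≺⇒≼ m≺g))

    module Blocks (r D : ℕ) (r>0 : 0 < r) (c : ℕ → ℕ) (chain : ∀ t → t < suc D → DirectCause N (c t) (c (suc t))) where

      c-< : ∀ {t} → t ≤ suc D → c t < length N
      c-< {zero} _ with chain 0 (s≤s z≤n)
      ... | d@(_ , j , _ , eq) = <-trans (DirectCause.cause-< d) (partAt-< N _ j eq)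
      c-< {suc t} t<D with chain t t<D
      ... | (_ , j , _ , eq) = partAt-< N _ j eq

      c-≼ : ∀ {t u} → t ≤ u → u ≤ suc D → N ⊢ c t ≼ c u
      c-≼ {t} {zero} z≤n _ = ε
      c-≼ {t} {suc u} t≤u u<D with m≤n⇒m<n∨m≡n t≤u
      ... | inj₁ (s≤s t≤u') = c-≼ t≤u' (<⇒≤ u<D) ◅◅ (chain u u<D ◅ ε)
      ... | inj₂ refl = ε

      c-≺ : ∀ {t u} → t < u → u ≤ suc D → N ⊢ c t ≺ c u
      c-≺ {t} {suc u} (s≤s t≤u) u<D = c u , c-≼ t≤u (<⇒≤ u<D) , chain u u<D

      width : ℕ → ℕ
      width zero    = 1
      width (suc p) = r * width p

      width>0 : ∀ p → 0 < width p
      width>0 zero    = s≤s z≤n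
      width>0 (suc p) = *-mono-≤ r>0 (width>0 p)

      record Block : Set where
        field
          x w   : ℕ
          js    : List (Fin n)
          w>0   : 0 < w
          fits  : x + r * w ≤ D
          few   : length js ≤ n
          only  : ∀ j → Moves (c x) (c (x + r * w)) j → j ∈ js
          all   : ∀ t → t < r → ∀ j → j ∈ js → Moves (c (x + t * w)) (c (x + suc t * w)) j

      -- Recursion on the number of components that may still move, which explains the powers of `r`
      -- as widths. A piece in which one of them rests has one fewer. With none left a contradiction
      -- arises, since every arc of the chain moves some component.
      block : ∀ p js → length js ≡ p → p ≤ n → ∀ x → x + width p ≤ D →
              (∀ j → Moves (c x) (c (x + width p)) j → j ∈ js) → Block
      block zero [] _ _ x le only with participant (c-< {x + 1} (m≤n⇒m≤1+n le))
      ... | j , jg = case only j (c (x + 1) , c-< (m≤n⇒m≤1+n le) , jg , ε ,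
                       λ p → <⇒≱ (≺⇒< (c-≺ (m<m+n x (s≤s z≤n)) (m≤n⇒m≤1+n le))) (≼⇒≤ p)) of λ ()
      block (suc p) js len p≤n x le only
        with anyUpTo? (λ t → Any.any? (λ j → ¬? (moves? (c (x + t * width p)) (c (x + suc t * width p)) j)) js) r
      ... | no none' = record { x = x ; w = width p ; js = js ; w>0 = width>0 p ; fits = le ; few = subst (_≤ n) (sym len) p≤n
          ; only = only
          ; all = λ t t<r j j∈ → decidable-stable (moves? _ _ j) λ ¬m → none' (t , t<r , Mem.lose j∈ ¬m) }
      ... | yes (t , t<r , some) with Mem.find some
      ...   | j , j∈ , ¬m with remove j∈
      ...     | ys , l , f , _ = block p ys (suc-injective (trans (sym l) len)) (<⇒≤ p≤n) (x + t * width p)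
          (≤-trans inside le) only'
        where
        eq : x + t * width p + width p ≡ x + suc t * width p
        eq = trans (+-assoc x _ _) (cong (x +_) (+-comm (t * width p) (width p)))
        inside : x + t * width p + width p ≤ x + r * width p
        inside = subst (_≤ x + r * width p) (sym eq) (+-monoʳ-≤ x (*-monoˡ-≤ (width p) t<r))
        only' : ∀ j' → Moves (c (x + t * width p)) (c (x + t * width p + width p)) j' → j' ∈ ys
        only' j' mv with f (only j' (moves-mono (c-≼ (m≤m+n x _) (≤-trans (≤-trans (m≤m+n _ (width p)) inside) (m≤n⇒m≤1+n le)))
                                              (c-≼ inside (m≤n⇒m≤1+n le)) mv))
        ... | inj₂ j'∈ = j'∈
        ... | inj₁ refl = ⊥-elim (¬m (subst (λ z → Moves (c (x + t * width p)) (c z) j') eq mv))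

      module Strong (B : Block) where
        open Block B

        milestone : ℕ → ℕ
        milestone t = c (x + t * w)

        le : ∀ {t} → t ≤ r → x + t * w ≤ suc D
        le t≤r = ≤-trans (+-monoʳ-≤ x (*-monoˡ-≤ w t≤r)) (m≤n⇒m≤1+n fits)

        milestone-< : ∀ {t} → t ≤ r → milestone t < length N
        milestone-< t≤r = c-< (le t≤r)

        milestone-≼ : ∀ {t u} → t ≤ u → u ≤ r → N ⊢ milestone t ≼ milestone u
        milestone-≼ t≤u u≤r = c-≼ (+-monoʳ-≤ x (*-monoˡ-≤ w t≤u)) (le u≤r)

        milestone-only : ∀ {t u j} → u ≤ r → Moves (milestone t) (milestone u) j → t ≤ u → j ∈ js
        milestone-only {t} {u} {j} u≤r mv t≤u = only j (moves-mono
          (c-≼ (m≤m+n x _) (le (≤-trans t≤u u≤r))) (milestone-≼ u≤r ≤-refl) mv)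

        module _ (u : ℕ) where
          open Learn (milestone (suc u))

          -- `U` lists the components that may still be uninformed. They all move in the next block,
          -- and by `learn` a path from such a move leads to a component that learns within it; so
          -- `U` loses a member per block until all know.
          spread : ∀ l U s → length U ≡ l → suc u ≤ s → s + l ≤ r → (∀ {j} → j ∈ U → j ∈ js) →
                   (∀ {j} → j ∈ js → j ∈ U ⊎ Knows (milestone s) j) → ∀ {j} → j ∈ js → Knows (milestone (s + l)) j
          spread zero [] s _ _ _ _ h {j} j∈ with h j∈
          ... | inj₂ k rewrite +-identityʳ s = k
          spread (suc l) U s len u<s s≤r U⊆ h {j} j∈ with Any.any? (λ j → ¬? (knows? (milestone s) j)) U
          ... | no none' = knows-mono (milestone-≼ (m≤m+n s _) s≤r) (known (h j∈))
            where
            known : j ∈ U ⊎ Knows (milestone s) j → Knows (milestone s) j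
            known (inj₁ q) = decidable-stable (knows? (milestone s) j) λ ¬k → none' (Mem.lose q ¬k)
            known (inj₂ k) = k
          ... | yes some with Mem.find some
          ...   | j₀ , j₀∈ , ¬k₀ = subst (λ z → Knows (milestone z) j) (sym (+-suc s l)) result
            where
            s<r : s < r
            s<r = ≤-trans (m<m+n s (s≤s z≤n)) s≤r
            step-≼ : N ⊢ milestone s ≼ milestone (suc s)
            step-≼ = milestone-≼ (n≤1+n s) s<r
            mv₀ = all s s<r j₀ (U⊆ j₀∈)
            result : Knows (milestone (suc s + l)) j
            result with mv₀
            ... | g , g< , jg , g≼ , g⋠ with learn (milestone-< s<r) (milestone-≼ u<s (<⇒≤ s<r)) step-≼ g≼ g⋠ j₀ jg ¬k₀
            ...   | j₁ , kn@(m , m< , jm , m≼ , q≼) , ¬k₁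
              with milestone-only s<r (m , m< , jm , m≼ , λ p → ¬k₁ (m , m< , jm , p , q≼)) (n≤1+n s)
            ...     | j₁∈js with h j₁∈js
            ...       | inj₂ k = ⊥-elim (¬k₁ k)
            ...       | inj₁ j₁∈U with remove j₁∈U
            ...         | U' , l' , f , g' = spread l U' (suc s) (suc-injective (trans (sym l') len)) (m≤n⇒m≤1+n u<s)
                            (subst (_≤ r) (+-suc s l) s≤r) (λ p → U⊆ (g' p)) h' j∈
              where
              h' : ∀ {j} → j ∈ js → j ∈ U' ⊎ Knows (milestone (suc s)) j
              h' j∈ with h j∈
              ... | inj₂ k = inj₂ (knows-mono step-≼ k)
              ... | inj₁ p with f p
              ...   | inj₁ refl = inj₂ kn
              ...   | inj₂ p' = inj₁ p'

          -- The first block consumes the vanishing conditions of M(a), at or below `q`; at most n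
          -- further blocks make every moving component know `q`, so the new conditions of M(z) are
          -- produced at or above `q`. This accounts for the distance `suc n`.
          strong : ∀ {v} → u + suc n ≤ v → v ≤ r → N ⊢ milestone u ≺ milestone v → N ⊢ milestone u ≪ milestone v
          strong {v} lt v≤r a≺z = ≺⇒<ₙ a≺z , above
            where
            u<v : u < v
            u<v = ≤-trans (m<m+n u (s≤s z≤n)) lt
            u<r = ≤-trans u<v v≤r
            a = milestone u
            z = milestone v
            q = milestone (suc u)
            a≼z = ≺⇒≼ a≺z
            knows-z : ∀ {j} → j ∈ js → Knows z j
            knows-z j∈ = knows-mono (milestone-≼ le' v≤r)
              (spread (length js) js (suc u) refl ≤-refl (≤-trans le' v≤r) (λ p → p) inj₁ j∈)
              where
              le' : suc u + length js ≤ v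
              le' = ≤-trans (≤-trans (+-monoʳ-≤ (suc u) few) (≤-reflexive (sym (+-suc u n)))) lt
            same-cut : ∀ {j} → ¬ Moves a z j → cutOf z j ≡ cutOf a j
            same-cut {j} ¬mv = cut-cong (length N) j λ g g< jg → bool-≡
              (λ p → ⇒past (decidable-stable (≼? N g a) λ g⋠ → ¬mv (g , g< , jg , past⇒ p , g⋠)))
              (λ p → ⇒past (past⇒ p ◅◅ a≼z))
            moved : ∀ {b} → InM N z b → ¬ InM N a b → Moves a z (compOf b)
            moved {b} inz ¬ina = decidable-stable (moves? a z (compOf b)) λ ¬mv →
              ¬ina (⇒InM (milestone-< (<⇒≤ u<r)) (trans (sym (same-cut ¬mv)) (InM⇒ inz)))
            moved' : ∀ {b} → InM N a b → ¬ InM N z b → Moves a z (compOf b)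
            moved' {b} ina ¬inz = decidable-stable (moves? a z (compOf b)) λ ¬mv →
              ¬inz (⇒InM (milestone-< v≤r) (trans (same-cut ¬mv) (InM⇒ ina)))
            above : ∀ b b' → InM N z b → ¬ InM N a b → InM N a b' → ¬ InM N z b' → N ⊢ cnd b' <ₙ cnd b
            above b b' inz ¬ina ina' ¬inz' = subst (λ b → N ⊢ cnd b' <ₙ cnd b) (InM⇒ inz)
                (finish (cut-view N (past N z) (length N) j))
              where
              j = compOf b
              j' = compOf b'
              in-js : ∀ {j} → Moves a z j → j ∈ js
              in-js mv = milestone-only v≤r mv (<⇒≤ u<v)
              eats = consumer (milestone-< u<r) (milestone-≼ (n≤1+n u) u<r) (all u u<r j' (in-js (moved' ina' ¬inz')))
              finish : ∀ {b₁} → Cut N (past N z) (length N) j b₁ → N ⊢ cnd b' <ₙ cnd b₁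
              kn = knows-z (in-js (moved inz ¬ina))
              finish (none f) = let m₀ , m₀< , jm₀ , m₀≼ , _ = kn in ⊥-elim (f m₀ m₀< (⇒past m₀≼) jm₀)
              finish (last m m< m∈ jm later) =
                  let f , f≼q , s' , eq = eats ; m₀ , m₀< , jm₀ , m₀≼ , q≼ = kn in
                  cnd-< (j' , s' , trans eq (cong (λ b → just (b , s')) (InM⇒ ina')))
                    (f≼q ◅◅ q≼ ◅◅ below m₀ m₀< jm₀ m₀≼) jm
                where
                below : ∀ m₀ → m₀ < length N → Participates N m₀ j → N ⊢ m₀ ≼ z → N ⊢ m₀ ≼ m
                below m₀ m₀< jm₀ m₀≼ with ≼-total-comp (past-config (milestone-< v≤r)) (⇒past m₀≼) m∈ jm₀ jm
                ... | inj₁ p = p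
                ... | inj₂ m≺m₀ = ⊥-elim (later m₀ (≺⇒< m≺m₀) m₀< (⇒past m₀≼) jm₀)

  -- The uniform bound on the process

  states : ℕ
  states = ∏ sizes

  bits : Fin states → ℕ
  bits _ = 2

  -- The factors are for St, ip and Con. Non-cut-off i-events are identified by their states, so ip
  -- needs one value per state and one for the initial condition, and Con is a set of states. No net
  -- enters the number, which makes the bound uniform.
  colours : ℕ
  colours = states * (suc states * ∏ bits)

  -- Room for `suc colours` end points, as the pigeonhole principle needs, at the distance `suc n`
  -- that `strong` needs.
  rounds : ℕ
  rounds = colours * suc n

  maxWidth : ℕ → ℕ
  maxWidth zero    = 1
  maxWidth (suc p) = rounds * maxWidth p

  -- One arc more than the blocks occupy: even the last end point then has a successor, hence is not
  -- in `coc`.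
  maxChain : ℕ
  maxChain = suc (maxWidth n)

  module Bound {st : AState} (inv : Inv st) where
    open Inv inv
    N = net st
    open WellFormed wf
    open Core wf
    open Link wf
    open Depth wf

    stateCode : ℕ → Fin states
    stateCode k = encode sizes (St[ N ] k)

    noncut-unique : ∀ {x y} → Participates N x i → Participates N y i → co st x ≡ nothing → co st y ≡ nothing → stateCode x ≡ stateCode y → x ≡ y
    noncut-unique {x} {y} jx jy cx cy e with <-cmp x y
    ... | tri≈ _ eq _ = eq
    ... | tri< x<y _ _ = ⊥-elim (co-none x<y jy jx cy (encode-injective sizes (sym e)))
    ... | tri> _ _ y<x = ⊥-elim (co-none y<x jx jy cx (encode-injective sizes e))

    ConAt : ℕ → Fin states → Set
    ConAt k g = Σ ℕ λ x → InCon N N (co st) x k × stateCode x ≡ g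

    bit : ∀ {P : Set} → Dec P → Fin 2
    bit (yes _) = Fin.suc Fin.zero
    bit (no _)  = Fin.zero

    bit-transfer : ∀ {P Q : Set} (p : Dec P) (q : Dec Q) → bit p ≡ bit q → P → Q
    bit-transfer (yes _) (yes q) _ _ = q
    bit-transfer (no ¬p) _ _ x = ⊥-elim (¬p x)

    ipCode : CId → Fin (suc states)
    ipCode (ini _)   = Fin.zero
    ipCode (out x _) = Fin.suc (stateCode x)

    colour : ∀ k → (∀ g → Dec (ConAt k g)) → Fin colours
    colour k d = combine (stateCode k) (combine (ipCode (cutOf k i)) (encode bits (λ g → bit (d g))))

    same-colour⇒cand : ∀ {k' k m m'} (d' : ∀ g → Dec (ConAt k' g)) (d : ∀ g → Dec (ConAt k g)) →
      k < length N → N ⊢ k' ≪ k → N ⊢ k' ≺ m' → N ⊢ k ≺ m → colour k' d' ≡ colour k d → IsCand N N (co st) k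
    same-colour⇒cand {k'} {k} {m} {m'} d' d k< ll k'≺m' k≺m e =
      <-nth N k k< , not-i , k' , k'< , ll , Sem.⇒sameSt wf (encode-injective sizes (sym e₁)) , Sem.⇒sameIp wf (sym ip)
      , con
      where
      k'≺k = <ₙ⇒≺ (proj₁ ll)
      k'< = <-trans (≺⇒< k'≺k) k<
      e₁ = proj₁ (Fin.combine-injective (stateCode k') _ (stateCode k) _ e)
      e₂₃ = Fin.combine-injective (ipCode (cutOf k' i)) (encode bits (λ g → bit (d' g))) (ipCode (cutOf k i)) (encode bits (λ g → bit (d g)))
              (proj₂ (Fin.combine-injective (stateCode k') _ (stateCode k) _ e))
      -- The producers of the two i-conditions have later events above them, thanks to `m'` and `m`;
      -- so they are no cut-offs, and equal states make them equal.
      ip : cutOf k' i ≡ cutOf k i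
      ip with cutOf k' i | cut-view N (past N k') (length N) i | cutOf k i | cut-view N (past N k) (length N) i | proj₁ e₂₃
      ... | _ | none _ | _ | none _ | _ = refl
      ... | _ | last x _ x∈ jx _ | _ | last y _ y∈ jy _ | e₂ = cong (λ z → out z i)
        (noncut-unique jx jy (proj₁ (succs (≼-≺-trans (past⇒ x∈) k'≺m'))) (proj₁ (succs (≼-≺-trans (past⇒ y∈) k≺m)))
          (Fin.suc-injective e₂))
      -- An i-event k has its own output as ip(k); with ip(k') = ip(k) this would put k into the
      -- past of k'.
      not-i : ¬ IsIEvent N k
      not-i ie with cutOf k' i | cut-view N (past N k') (length N) i | trans ip (cutOf-own (iEvent⇒participates ie))
      ... | _ | last _ _ k∈ _ _ | refl = <⇒≱ (≺⇒< k'≺k) (≼⇒≤ (past⇒ k∈))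
      con : ∀ x → InCon N N (co st) x k → InCon N N (co st) x k'
      con x cx@(_ , ix , nx , _)
        with bit-transfer (d (stateCode x)) (d' (stateCode x)) (sym (encode-injective bits (proj₂ e₂₃) (stateCode x))) (x , cx , refl)
      ... | y , cy@(_ , iy , ny , _) , eq with noncut-unique (iEvent⇒participates ix) (iEvent⇒participates iy) nx ny (sym eq)
      ... | refl = cy

    no-long-chain : ∀ k → ¬ Chain maxChain k
    no-long-chain k (c , _ , chain) =
      -- Whether Con contains an event with a given state is not decided. Only finitely many such
      -- questions occur and the goal is absurdity, so they may be assumed answered.
      ¬¬-∀ (suc colours) (λ t → ¬¬-∀ states λ g → ¬¬-excluded-middle) λ dec →
        let t , t' , t<t' , e = Fin.pigeonhole ≤-refl (λ t → colour (point t) (dec t))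
            a≺z = ≺-point t<t'
        in coc-f (milestone-< (top t')) (proj₂ (succs (next-point t')))
             (same-colour⇒cand (dec t) (dec t') (milestone-< (top t'))
               (strong (toℕ t * suc n) (gap t<t') (top t') a≺z) (next-point t) (next-point t') e)
      where
      some-colour : Fin colours
      some-colour = combine (stateCode 0) (combine {suc states} Fin.zero (encode bits (λ _ → Fin.zero)))
      rounds>0 : 0 < rounds
      rounds>0 = *-mono-≤ (≤-<-trans z≤n (Fin.toℕ<n some-colour)) (s≤s z≤n)
      open Blocks rounds (maxWidth n) rounds>0 c chain
      width-max : ∀ p → width p ≡ maxWidth p
      width-max zero = refl
      width-max (suc p) = cong (rounds *_) (width-max p)
      blk : Block
      blk = block n (allFin n) (length-tabulate (λ x → x)) ≤-refl 0 (≤-reflexive (width-max n)) λ j _ → ∈-allFin j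
      open Strong blk
      open Block blk
      point : Fin (suc colours) → ℕ
      point t = milestone (toℕ t * suc n)
      top : ∀ (t : Fin (suc colours)) → toℕ t * suc n ≤ rounds
      top t = *-monoˡ-≤ (suc n) (≤-pred (Fin.toℕ<n t))
      gap : ∀ {t t' : Fin (suc colours)} → toℕ t < toℕ t' → toℕ t * suc n + suc n ≤ toℕ t' * suc n
      gap {t} {t'} lt = subst (_≤ toℕ t' * suc n) (+-comm (suc n) (toℕ t * suc n)) (*-monoˡ-≤ (suc n) lt)
      next-point : ∀ t → N ⊢ point t ≺ c (suc (x + toℕ t * suc n * w))
      next-point t = c-≺ ≤-refl (s≤s (≤-trans (+-monoʳ-≤ x (*-monoˡ-≤ w (top t))) fits))
      ≺-point : ∀ {t t' : Fin (suc colours)} → toℕ t < toℕ t' → N ⊢ point t ≺ point t'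
      ≺-point {t} {t'} lt = c-≺ (+-monoʳ-< x (<-≤-trans (m<n+m (toℕ t * suc n * w) w>0)
          (*-monoˡ-≤ w (≤-trans (m<m+n (toℕ t * suc n) (s≤s z≤n)) (gap {t} {t'} lt))))) (le (top t'))

    length-bound : length N ≤ codes maxChain
    length-bound = size-bound maxChain λ k _ → no-long-chain k

  -- The fuel bounds the number of events that can still be added, one per step. When it is used up,
  -- a further step would lead to a net exceeding `length-bound`.
  terminates : ∀ fuel {st} → Inv st → codes maxChain ≤ length (net st) + fuel → Acc (λ y x → AlgStep x y) st
  terminates fuel {st} inv le = acc λ {st'} s → go fuel le s
    where
    len : ∀ {st'} → AlgStep st st' → length (net st') ≡ suc (length (net st))
    len (e , _ , eq , _) = trans (cong length eq) (length-∷ʳ (net st) e)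
    go : ∀ fuel → codes maxChain ≤ length (net st) + fuel → ∀ {st'} → AlgStep st st' → Acc (λ y x → AlgStep x y) st'
    go zero le s = ⊥-elim (<⇒≱ (≤-reflexive (sym (len s)))
      (≤-trans (Bound.length-bound (inv-step inv s)) (subst (codes maxChain ≤_) (+-identityʳ _) le)))
    go (suc fuel) le {st'} s = terminates fuel (inv-step inv s)
      (subst (codes maxChain ≤_) (trans (+-suc (length (net st)) fuel) (cong (_+ fuel) (sym (len s)))) le)

theorem2 : (n : ℕ) (A : Fin n → LTS) (i : Fin n) →
    let open Comp n A i in
    Acc (λ y x → AlgStep x y) initial
    × (∀ st → Star AlgStep initial st → Final st
    → IsBP (net st) × IsSummary (Folding (net st) (co st)))
theorem2 n A i =
    terminates (codes maxChain) inv-initial ≤-refl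
  , λ st steps final → let inv = inv-star inv-initial steps in
      Inv.bp inv
    , (λ w → Sound.fin-sound inv , Complete.fin-complete inv final)
    , (λ w → Sound.inf-sound inv , Complete.inf-complete inv final)
  where open Unfolding n A i
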